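{- For every integer $n\geqslant 1$, $$\sum_{\sigma\in \mathcal{Q}_{n+1}^{(1)}}x^{\operatorname{pap}(\sigma)}y^{\operatorname{cap}(\sigma)}s^{\operatorname{impap}(\sigma)}t^{\operatorname{bk}_2(\sigma)}p^{{\rm even}(\sigma)}q^{\operatorname{tr}(\sigma)} =\sum_{\pi\in \mathfrak{S}_n^B}x^{{\rm exc}(\pi)}y^{{\rm aexc}(\pi)}s^{{\rm single}(\pi)}t^{{\rm fix}(\pi)}p^{{\rm neg}(\pi)}q^{{\rm cyc}(\pi)},$$ where for $\sigma\in\mathcal{Q}_{n+1}^{(1)}$ we set $\operatorname{cap}(\sigma)=n-\operatorname{pap}(\sigma)-\operatorname{impap}(\sigma)-\operatorname{bk}_2(\sigma)$.
   Context: Stirling side. A Stirling permutation of a multiset is a word using each element with its multiplicity such that for each value $i$ all letters between two occurrences of $i$ are at least $i$. For $m\geqslant 1$, $\mathcal{Q}_m^{(1)}$ is the set of Stirling permutations of $\{1,2,2,3,3,\ldots,m,m\}$; such words have length $L=2m-1$. For $\sigma=\sigma_1\cdots\sigma_L$ put $\sigma_0=\sigma_{L+1}=0$. The set of ascent-plateaux is $\operatorname{Ap}(\sigma)=\{\sigma_i: 2\leqslant i\leqslant L-1,\ \sigma_{i-1}<\sigma_i=\sigma_{i+1}\}$. A right-to-left minimum is a letter $\sigma_i$ which is the first occurrence (from the left) of its value and satisfies $\sigma_i\leqslant\sigma_j$ for all $j\in\{i+1,\ldots,L\}$; $\operatorname{Rlmin}(\sigma)$ is the set of their values. Improper ascent-plateaux: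 $\operatorname{Impap}(\sigma)=\operatorname{Ap}(\sigma)\cap\operatorname{Rlmin}(\sigma)$; proper ascent-plateaux: $\operatorname{Pap}(\sigma)=\operatorname{Ap}(\sigma)\setminus\operatorname{Rlmin}(\sigma)$; $\operatorname{impap},\operatorname{pap}$ are their cardinalities. A left-to-right minimum is a letter $\sigma_i$ with $i=1$ or $\sigma_i<\sigma_j$ for all $j<i$. The blocks of $\sigma$ are the maximal consecutive factors that begin with a left-to-right minimum and contain no other left-to-right minimum; $\operatorname{bk}_2(\sigma)$ is the number of blocks of size exactly $2$ (such a block consists of two equal letters). ${\rm even}(\sigma)$ is the number of values whose first occurrence (reading left to right) is at an even position. For $2\leqslant k\leqslant m$, let $\sigma|_k\in\mathcal{Q}_k^{(1)}$ be the subword of $\sigma$ formed by the letters $\leqslant k$. $\operatorname{Trace}(\sigma)$ is the set of values $v$ such that for some $k\in\{2,\ldots,m\}$, either $v\in\operatorname{Impap}(\sigma|_k)$ or $v$ is the second entry of a block of size exactly $2$ of $\sigma|_k$; $\operatorname{tr}(\sigma)=\#\operatorname{Trace}(\sigma)$. (Example: for $\sigma=884554122377366$, $\operatorname{Pap}=\{5,7\}$, $\operatorname{Impap}=\{2,6\}$, $\operatorname{Trace}=\{2,3,4,6,8\}$.) Signed side. $\mathfrak{S}_n^B$ is the set of signed permutations: bijections $\pi$ of $\{\pm1,\ldots,\pm n\}$ with $\pi(-i)=-\pi(i)$, written $\pi(1)\cdots\pi(n)$. Its cycles are the cycles of the permutation $i\mapsto|\pi(i)|$ of $[n]$ (with letters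 $\pi(i)$ written with their signs), and ${\rm cyc}(\pi)$ is their number. ${\rm exc}(\pi)=\#\{i\in[n]:\pi(|\pi(i)|)>\pi(i)\}$, ${\rm aexc}(\pi)=\#\{i\in[n]:\pi(|\pi(i)|)<\pi(i)\}$, ${\rm fix}(\pi)=\#\{i:\pi(i)=i\}$, ${\rm single}(\pi)=\#\{i:\pi(i)=-i\}$, ${\rm neg}(\pi)=\#\{i:\pi(i)<0\}$. -}

module Defs where

open import Data.Nat.Base using (ℕ; zero; suc; _+_; _∸_; _*_; _≡ᵇ_; _<ᵇ_; _≤ᵇ_)
open import Data.Bool.Base using (Bool; true; false; _∧_; _∨_; not)
open import Data.List.Base using (List; []; _∷_; map; upTo; length; filterᵇ; concatMap; foldr; _++_)
open import Data.Integer.Base as Z using (ℤ; +_; -_; ∣_∣)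
open import Algebra.Bundles using (CommutativeSemiring)

-- range a b = [a, a+1, ..., b]  (empty if b < a)
range : ℕ → ℕ → List ℕ
range a b = map (λ j → a + j) (upTo (suc b ∸ a))

allB : {A : Set} → (A → Bool) → List A → Bool
allB P = foldr (λ a r → P a ∧ r) true

anyB : {A : Set} → (A → Bool) → List A → Bool
anyB P = foldr (λ a r → P a ∨ r) false

countB : {A : Set} → (A → Bool) → List A → ℕ
countB P = foldr (λ a r → if′ P a then suc r else r) 0
  where
  if′_then_else_ : Bool → ℕ → ℕ → ℕ
  if′ true  then x else y = x
  if′ false then x else y = y

allR : ℕ → ℕ → (ℕ → Bool) → Bool
allR a b P = allB P (range a b)

anyR : ℕ → ℕ → (ℕ → Bool) → Bool
anyR a b P = anyB P (range a b)

countR : ℕ → ℕ → (ℕ → Bool) → ℕ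
countR a b P = countB P (range a b)

infixr 5 _⇒ᵇ_

_⇒ᵇ_ : Bool → Bool → Bool
a ⇒ᵇ b = not a ∨ b

evenᵇ : ℕ → Bool
evenᵇ zero          = true
evenᵇ (suc zero)    = false
evenᵇ (suc (suc n)) = evenᵇ n

-- Words, 1-indexed, with σ₀ = σ_{L+1} = 0 (any out-of-range index gives 0)

at : List ℕ → ℕ → ℕ
at σ       zero          = 0
at []      (suc i)       = 0
at (x ∷ σ) (suc zero)    = x
at (x ∷ σ) (suc (suc i)) = at σ (suc i)

occ : ℕ → List ℕ → ℕ
occ v = countB (λ a → a ≡ᵇ v)

words : ℕ → ℕ → List (List ℕ)
words m zero    = [] ∷ []
words m (suc L) = concatMap (λ a → map (a ∷_) (words m L)) (range 1 m)

isMultiset : ℕ → List ℕ → Bool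
isMultiset m σ =
  allB (λ a → (1 ≤ᵇ a) ∧ (a ≤ᵇ m)) σ ∧ (occ 1 σ ≡ᵇ 1) ∧ allR 2 m (λ k → occ k σ ≡ᵇ 2)

stirlingCond : List ℕ → Bool
stirlingCond σ =
  allR 1 (length σ) λ i → allR i (length σ) λ k →
    (at σ i ≡ᵇ at σ k) ⇒ᵇ allR i k (λ j → at σ i ≤ᵇ at σ j)

isStirling : ℕ → List ℕ → Bool
isStirling m σ = isMultiset m σ ∧ stirlingCond σ

Q : ℕ → List (List ℕ)
Q m = filterᵇ (isStirling m) (words m (2 * m ∸ 1))

inAp : List ℕ → ℕ → Bool
inAp σ v = anyR 2 (length σ ∸ 1) λ i →
  (at σ (i ∸ 1) <ᵇ at σ i) ∧ (at σ i ≡ᵇ at σ (suc i)) ∧ (at σ i ≡ᵇ v)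

firstOcc : List ℕ → ℕ → Bool
firstOcc σ i = allR 1 (i ∸ 1) (λ j → not (at σ j ≡ᵇ at σ i))

inRlmin : List ℕ → ℕ → Bool
inRlmin σ v = anyR 1 (length σ) λ i →
  (at σ i ≡ᵇ v) ∧ firstOcc σ i ∧ allR (suc i) (length σ) (λ j → at σ i ≤ᵇ at σ j)

impap : ℕ → List ℕ → ℕ
impap m σ = countR 1 m (λ v → inAp σ v ∧ inRlmin σ v)

pap : ℕ → List ℕ → ℕ
pap m σ = countR 1 m (λ v → inAp σ v ∧ not (inRlmin σ v))

isLtrMin : List ℕ → ℕ → Bool
isLtrMin σ i = (i ≡ᵇ 1) ∨ allR 1 (i ∸ 1) (λ j → at σ i <ᵇ at σ j)

-- a block of size exactly 2 starts at position i (blocks start at the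
-- left-to-right minima; the block starting at i is σ_i σ_{i+1})
block2At : List ℕ → ℕ → Bool
block2At σ i =
  isLtrMin σ i ∧ (suc i ≤ᵇ length σ) ∧ not (isLtrMin σ (suc i))
    ∧ ((i + 2 ≡ᵇ suc (length σ)) ∨ isLtrMin σ (i + 2))

bk₂ : List ℕ → ℕ
bk₂ σ = countR 1 (length σ) (block2At σ)

even : List ℕ → ℕ
even σ = countR 1 (length σ) (λ i → evenᵇ i ∧ firstOcc σ i)

restrict : ℕ → List ℕ → List ℕ
restrict k = filterᵇ (λ a → a ≤ᵇ k)

inTrace : ℕ → List ℕ → ℕ → Bool
inTrace m σ v = anyR 2 m λ k →
  (inAp (restrict k σ) v ∧ inRlmin (restrict k σ) v)
  ∨ anyR 1 (length (restrict k σ))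
      (λ i → block2At (restrict k σ) i ∧ (at (restrict k σ) (suc i) ≡ᵇ v))

tr : ℕ → List ℕ → ℕ
tr m σ = countR 1 m (inTrace m σ)

cap : ℕ → List ℕ → ℕ
cap n σ = n ∸ pap (suc n) σ ∸ impap (suc n) σ ∸ bk₂ σ

-- Signed permutations, written as the word π(1)⋯π(n) of integers

infix 4 _≤ℤ_ _<ℤ_ _≡ℤ_

_≤ℤ_ : ℤ → ℤ → Bool
a ≤ℤ b = a Z.≤ᵇ b

_<ℤ_ : ℤ → ℤ → Bool
a <ℤ b = not (b Z.≤ᵇ a)

_≡ℤ_ : ℤ → ℤ → Bool
a ≡ℤ b = (a Z.≤ᵇ b) ∧ (b Z.≤ᵇ a)

-- π(i), 1-indexed (0 out of range)
atZ : List ℤ → ℕ → ℤ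
atZ π       zero          = + 0
atZ []      (suc i)       = + 0
atZ (x ∷ π) (suc zero)    = x
atZ (x ∷ π) (suc (suc i)) = atZ π (suc i)

signedWords : ℕ → ℕ → List (List ℤ)
signedWords n zero    = [] ∷ []
signedWords n (suc ℓ) =
  concatMap (λ a → map (a ∷_) (signedWords n ℓ))
    (map (λ k → + k) (range 1 n) ++ map (λ k → - (+ k)) (range 1 n))

isSignedPerm : ℕ → List ℤ → Bool
isSignedPerm n π =
  (length π ≡ᵇ n) ∧ allB (λ a → (1 ≤ᵇ ∣ a ∣) ∧ (∣ a ∣ ≤ᵇ n)) π
    ∧ allR 1 n (λ k → countB (λ a → ∣ a ∣ ≡ᵇ k) π ≡ᵇ 1)

SB : ℕ → List (List ℤ)
SB n = filterᵇ (isSignedPerm n) (signedWords n n)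

exc : ℕ → List ℤ → ℕ
exc n π = countR 1 n (λ i → atZ π i <ℤ atZ π ∣ atZ π i ∣)

aexc : ℕ → List ℤ → ℕ
aexc n π = countR 1 n (λ i → atZ π ∣ atZ π i ∣ <ℤ atZ π i)

fix : ℕ → List ℤ → ℕ
fix n π = countR 1 n (λ i → atZ π i ≡ℤ + i)

single : ℕ → List ℤ → ℕ
single n π = countR 1 n (λ i → atZ π i ≡ℤ - (+ i))

neg : ℕ → List ℤ → ℕ
neg n π = countR 1 n (λ i → atZ π i <ℤ + 0)

iterAbs : List ℤ → ℕ → ℕ → ℕ
iterAbs π zero    i = i
iterAbs π (suc r) i = ∣ atZ π (iterAbs π r i) ∣

-- number of cycles of i ↦ |π(i)|: count the i which are minimal in their cycle
cyc : ℕ → List ℤ → ℕ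
cyc n π = countR 1 n (λ i → allR 1 n (λ r → i ≤ᵇ iterAbs π r i))

module _ {c ℓ} (R : CommutativeSemiring c ℓ) where
  open CommutativeSemiring R using (Carrier; 1#; 0#) renaming (_*_ to _·_; _+_ to _⊕_)

  pow : Carrier → ℕ → Carrier
  pow x zero    = 1#
  pow x (suc k) = x · pow x k

  sumOver : {A : Set} → List A → (A → Carrier) → Carrier
  sumOver xs f = foldr (λ a r → f a ⊕ r) 0# xs

{-# OPTIONS --safe #-}
module Submission where

open import Defs
open import Algebra.Bundles using (CommutativeSemiring)
open import Data.Bool.Base using (Bool; true; false; _∧_; _∨_; not; T; if_then_else_)
open import Data.Bool.Properties using (T-∧; T-∨)
open import Data.Empty using (⊥; ⊥-elim)
open import Data.Fin.Base using (Fin; toℕ; fromℕ<)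
import Data.Fin.Properties as Fin
open import Data.Integer.Base as Z using (ℤ; ∣_∣; -[1+_])
import Data.Integer.Properties as Zₚ
open import Data.List.Base using (List; []; _∷_; map; upTo; applyUpTo; length; concatMap; _++_; replicate; cartesianProductWith)
open import Data.List.Properties using (map-++; upTo-∷ʳ; map-∘; concatMap-map; map-concatMap; length-applyUpTo; ∷-injective; filter-all; filter-accept; filter-reject)
open import Data.List.Membership.Propositional using (_∈_)
open import Data.List.Membership.Propositional.Properties
open import Data.List.Membership.Propositional.Properties.WithK using (unique∧set⇒bag)
open import Data.List.Relation.Binary.BagAndSetEquality using (∼bag⇒↭)
open import Data.List.Relation.Binary.Permutation.Propositional as Perm using (_↭_; ↭-refl; ↭-sym; ↭-trans; prep; swap; module PermutationReasoning)
import Data.List.Relation.Binary.Permutation.Propositional.Properties as Permₚ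
open Permₚ using (++⁺; ++⁺ˡ; map⁺)
open import Data.List.Relation.Unary.All as All using ([]; _∷_)
open import Data.List.Relation.Unary.AllPairs using ([]; _∷_)
open import Data.List.Relation.Unary.Any using (here; there)
open import Data.List.Relation.Unary.Unique.Propositional using (Unique)
import Data.List.Relation.Unary.Unique.Propositional.Properties as Uniq
open import Data.Nat.Base as ℕ hiding (_*_)
open import Data.Nat.Properties
open import Data.Product using (∃; _×_; _,_; proj₁; proj₂)
open import Data.Product.Properties using (,-injective)
open import Data.Sum using (_⊎_; inj₁; inj₂)
open import Data.Unit using (tt)
open import Function.Base using (_∘_)
open import Function.Bundles using (Equivalence; mk⇔)
open import Relation.Binary.Definitions using (Tri; tri<; tri≈; tri>)
open import Relation.Binary.PropositionalEquality using (_≡_; _≢_; refl; sym; trans; cong; cong₂; subst; subst₂; module ≡-Reasoning)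
open import Relation.Nullary using (¬_; yes; no)
open import Relation.Nullary.Decidable using (T?)

-- Both sums satisfy the same recursion in n. Deleting the two letters m of a word in Q m leaves a word in
-- Q (m − 1); conversely the two new letters can be inserted in 2m − 2 gaps. The first gap creates a block
-- of size 2 (factor t q), the last one an improper ascent-plateau (factor s p q). Of the 2n inner gaps of
-- a word in Q (n + 1), each ascent-plateau v v is destroyed by the gap before it and the gap inside it, each
-- block v v of size 2 by the gap inside it and the gap after it; these are consecutive, hence of opposite
-- parity. The other 2 cap inner gaps destroy nothing, and every inner gap creates a proper ascent-plateau.
-- On the signed side ±(n + 1) forms a new cycle (factors t q and s p q) or is inserted into one of the n
-- arcs π(h) → π(|π(h)|), which is then replaced by one excedance and one anti-excedance.
-- So on both sides each of the n factors x, y, s, t of a monomial is replaced by x y, once with factor 1 and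
-- once with factor p, and the number of traces resp. cycles changes only in the two exceptional cases.
-- A semiring has no derivatives, so the recursion is proved for the lists of exponents, up to permutation.

-- The power of p depends on the position j + 1 of the first new letter of an insertion into gap j;
-- a pair of letters moves old letters by 0 or 2 places, so their parities persist. Hence even gaps
-- carry 1 and odd gaps p, and the gaps 0 and 2n + 1 carry different factors. That the gap behind a
-- block of size 2 is always an inner one rests on the letter 1 being single: the last block begins
-- with it and never has size 2. Traces behave like cycles because `Trace` collects over all
-- restrictions: a plateau or block that is broken later has already left its trace, and no
-- insertion gives an old letter a new one. Lists of exponents forget which gap or arc contributes
-- which factor, so the n gaps of one parity and the n arcs are compared only as multisets of kinds.
-- Truncated subtraction is kept out of the changes by the form new + lost = gained + old.

private variable
  A B C : Set

-- Booleans

∧-intro : ∀ {a b} → T a → T b → T (a ∧ b)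
∧-intro p q = Equivalence.from T-∧ (p , q)

∧-elim : ∀ {a b} → T (a ∧ b) → T a × T b
∧-elim = Equivalence.to T-∧

∨-intro : ∀ {a b} → T a ⊎ T b → T (a ∨ b)
∨-intro = Equivalence.from T-∨

∨-elim : ∀ {a b} → T (a ∨ b) → T a ⊎ T b
∨-elim = Equivalence.to T-∨

not-intro : ∀ {a} → ¬ T a → T (not a)
not-intro {true}  f = f tt
not-intro {false} _ = tt

not-elim : ∀ {a} → T (not a) → ¬ T a
not-elim {false} _ ()

⇒-intro : ∀ {a b} → (T a → T b) → T (a ⇒ᵇ b)
⇒-intro {true}  f = f tt
⇒-intro {false} f = tt

⇒-elim : ∀ {a b} → T (a ⇒ᵇ b) → T a → T b
⇒-elim {true} p _ = p

T-ext : ∀ {a b} → (T a → T b) → (T b → T a) → a ≡ b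
T-ext {true}  {true}  f g = refl
T-ext {true}  {false} f g = ⊥-elim (f tt)
T-ext {false} {true}  f g = ⊥-elim (g tt)
T-ext {false} {false} f g = refl

T⇒≡ : ∀ {a} → T a → a ≡ true
T⇒≡ {true} _ = refl

¬T⇒≡ : ∀ {a} → ¬ T a → a ≡ false
¬T⇒≡ {true}  f = ⊥-elim (f tt)
¬T⇒≡ {false} _ = refl

≡ᵇ-intro : ∀ {m n} → m ≡ n → T (m ≡ᵇ n)
≡ᵇ-intro {m} {n} = ≡⇒≡ᵇ m n

≡ᵇ-elim : ∀ {m n} → T (m ≡ᵇ n) → m ≡ n
≡ᵇ-elim {m} {n} = ≡ᵇ⇒≡ m n

≤ᵇ-elim : ∀ {m n} → T (m ≤ᵇ n) → m ≤ n
≤ᵇ-elim {m} {n} = ≤ᵇ⇒≤ m n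

<ᵇ-elim : ∀ {m n} → T (m <ᵇ n) → m < n
<ᵇ-elim {m} {n} = <ᵇ⇒< m n

-- Bounded quantifiers

∈-range⁺ : ∀ {a b i} → a ≤ i → i ≤ b → i ∈ range a b
∈-range⁺ {a} {b} {i} a≤i i≤b =
  subst (_∈ range a b) (m+[n∸m]≡n a≤i) (∈-map⁺ (a +_) (∈-upTo⁺ (∸-monoˡ-< (s≤s i≤b) a≤i)))

m<n∸o⇒o+m<n : ∀ m n o → m < n ∸ o → o + m < n
m<n∸o⇒o+m<n m n       zero    p = p
m<n∸o⇒o+m<n m (suc n) (suc o) p = s≤s (m<n∸o⇒o+m<n m n o p)

∈-range⁻ : ∀ {a b i} → i ∈ range a b → a ≤ i × i ≤ b
∈-range⁻ {a} {b} i∈ with j , j∈ , refl ← ∈-map⁻ (a +_) i∈ =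
  m≤m+n a j , s≤s⁻¹ (m<n∸o⇒o+m<n j (suc b) a (∈-upTo⁻ j∈))

module _ {A : Set} {P : A → Bool} where

  allB-intro : ∀ {xs} → (∀ {x} → x ∈ xs → T (P x)) → T (allB P xs)
  allB-intro {[]}     f = tt
  allB-intro {x ∷ xs} f = ∧-intro (f (here refl)) (allB-intro (f ∘ there))

  allB-elim : ∀ {xs x} → T (allB P xs) → x ∈ xs → T (P x)
  allB-elim {y ∷ ys} p (here refl) = proj₁ (∧-elim p)
  allB-elim {y ∷ ys} p (there x∈)  = allB-elim {ys} (proj₂ (∧-elim {P y} p)) x∈

  anyB-intro : ∀ {xs x} → x ∈ xs → T (P x) → T (anyB P xs)
  anyB-intro (here refl) p = ∨-intro (inj₁ p)
  anyB-intro {y ∷ ys} (there x∈) p = ∨-intro {P y} (inj₂ (anyB-intro x∈ p))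

  anyB-elim : ∀ {xs} → T (anyB P xs) → ∃ λ x → x ∈ xs × T (P x)
  anyB-elim {x ∷ xs} p with ∨-elim {P x} p
  ... | inj₁ q = x , here refl , q
  ... | inj₂ q with y , y∈ , r ← anyB-elim {xs} q = y , there y∈ , r

module _ {a b : ℕ} {P : ℕ → Bool} where

  allR-intro : (∀ {i} → a ≤ i → i ≤ b → T (P i)) → T (allR a b P)
  allR-intro f = allB-intro λ i∈ → let p , q = ∈-range⁻ i∈ in f p q

  allR-elim : T (allR a b P) → ∀ {i} → a ≤ i → i ≤ b → T (P i)
  allR-elim p l u = allB-elim {P = P} p (∈-range⁺ l u)

  anyR-intro : ∀ {i} → a ≤ i → i ≤ b → T (P i) → T (anyR a b P)
  anyR-intro l u p = anyB-intro (∈-range⁺ l u) p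

  anyR-elim : T (anyR a b P) → ∃ λ i → a ≤ i × i ≤ b × T (P i)
  anyR-elim p with i , i∈ , q ← anyB-elim {P = P} p = let l , u = ∈-range⁻ i∈ in i , l , u , q

-- Counting

ind : Bool → ℕ
ind true  = 1
ind false = 0

sumTo : ℕ → (ℕ → ℕ) → ℕ
sumTo zero    f = 0
sumTo (suc n) f = f (suc n) + sumTo n f

count : ℕ → (ℕ → Bool) → ℕ
count n P = sumTo n (ind ∘ P)

countB-∷ : ∀ (P : A → Bool) x xs → countB P (x ∷ xs) ≡ ind (P x) + countB P xs
countB-∷ P x xs with P x
... | true  = refl
... | false = refl

countB-++ : ∀ (P : A → Bool) xs ys → countB P (xs ++ ys) ≡ countB P xs + countB P ys
countB-++ P []       ys = refl
countB-++ P (x ∷ xs) ys = begin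
  countB P (x ∷ xs ++ ys)                      ≡⟨ countB-∷ P x (xs ++ ys) ⟩
  ind (P x) + countB P (xs ++ ys)              ≡⟨ cong (ind (P x) +_) (countB-++ P xs ys) ⟩
  ind (P x) + (countB P xs + countB P ys)      ≡⟨ +-assoc (ind (P x)) _ _ ⟨
  (ind (P x) + countB P xs) + countB P ys      ≡⟨ cong (_+ countB P ys) (countB-∷ P x xs) ⟨
  countB P (x ∷ xs) + countB P ys              ∎
  where open ≡-Reasoning

range-suc : ∀ n → range 1 (suc n) ≡ range 1 n ++ suc n ∷ []
range-suc n = trans (cong (map suc) (sym (upTo-∷ʳ n))) (map-++ suc (upTo n) (n ∷ []))

countR≡count : ∀ n P → countR 1 n P ≡ count n P
countR≡count zero    P = refl
countR≡count (suc n) P = begin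
  countB P (range 1 (suc n))                          ≡⟨ cong (countB P) (range-suc n) ⟩
  countB P (range 1 n ++ suc n ∷ [])                  ≡⟨ countB-++ P (range 1 n) _ ⟩
  countB P (range 1 n) + countB P (suc n ∷ [])        ≡⟨ cong₂ _+_ (countR≡count n P)
    (trans (countB-∷ P (suc n) []) (+-identityʳ _)) ⟩
  count n P + ind (P (suc n))                         ≡⟨ +-comm (count n P) _ ⟩
  count (suc n) P                                     ∎
  where open ≡-Reasoning

sumTo-cong : ∀ n {f g} → (∀ {k} → 1 ≤ k → k ≤ n → f k ≡ g k) → sumTo n f ≡ sumTo n g
sumTo-cong zero    e = refl
sumTo-cong (suc n) e = cong₂ _+_ (e (s≤s z≤n) ≤-refl) (sumTo-cong n λ l u → e l (m≤n⇒m≤1+n u))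

count-cong : ∀ n {P Q} → (∀ {k} → 1 ≤ k → k ≤ n → P k ≡ Q k) → count n P ≡ count n Q
count-cong n e = sumTo-cong n λ l u → cong ind (e l u)

interchange : ∀ a b c d → (a + b) + (c + d) ≡ (a + c) + (b + d)
interchange a b c d = begin
  (a + b) + (c + d) ≡⟨ +-assoc a b _ ⟩
  a + (b + (c + d)) ≡⟨ cong (a +_) (+-assoc b c d) ⟨
  a + ((b + c) + d) ≡⟨ cong (λ z → a + (z + d)) (+-comm b c) ⟩
  a + ((c + b) + d) ≡⟨ cong (a +_) (+-assoc c b d) ⟩
  a + (c + (b + d)) ≡⟨ +-assoc a c _ ⟨
  (a + c) + (b + d) ∎
  where open ≡-Reasoning

sumTo-+ : ∀ n f g → sumTo n (λ k → f k + g k) ≡ sumTo n f + sumTo n g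
sumTo-+ zero    f g = refl
sumTo-+ (suc n) f g = trans (cong (f (suc n) + g (suc n) +_) (sumTo-+ n f g)) (interchange (f (suc n)) _ _ _)

sumTo-const0 : ∀ n → sumTo n (λ _ → 0) ≡ 0
sumTo-const0 zero    = refl
sumTo-const0 (suc n) = sumTo-const0 n

sumTo-zero : ∀ n {f} → (∀ {k} → 1 ≤ k → k ≤ n → f k ≡ 0) → sumTo n f ≡ 0
sumTo-zero n e = trans (sumTo-cong n e) (sumTo-const0 n)

sumTo-swap : ∀ m n (f : ℕ → ℕ → ℕ) → sumTo m (λ i → sumTo n (f i)) ≡ sumTo n (λ j → sumTo m (λ i → f i j))
sumTo-swap zero    n f = sym (sumTo-const0 n)
sumTo-swap (suc m) n f = trans (cong (sumTo n (f (suc m)) +_) (sumTo-swap m n f))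
                               (sym (sumTo-+ n (f (suc m)) _))

sumTo-single : ∀ n {f i c} → 1 ≤ i → i ≤ n → f i ≡ c →
               (∀ {k} → 1 ≤ k → k ≤ n → k ≢ i → f k ≡ 0) → sumTo n f ≡ c
sumTo-single zero    {i = suc i} l () e z
sumTo-single (suc n) {f} {i} l u e z with i ≟ suc n
... | yes refl = trans (cong₂ _+_ e (sumTo-zero n λ l′ u′ → z l′ (m≤n⇒m≤1+n u′) (<⇒≢ (s≤s u′)))) (+-identityʳ _)
... | no i≢ = trans (cong₂ _+_ (z (s≤s z≤n) ≤-refl (i≢ ∘ sym))
                      (sumTo-single n l (s≤s⁻¹ (≤∧≢⇒< u i≢)) e λ l′ u′ → z l′ (m≤n⇒m≤1+n u′)))
                    refl

-- Both sides are the common part of the two sums plus `f i` and `g i`. It expresses that a single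
-- summand changes without subtracting.
sumTo-update : ∀ n {f g i} → 1 ≤ i → i ≤ n → (∀ {k} → 1 ≤ k → k ≤ n → k ≢ i → f k ≡ g k) →
               sumTo n f + g i ≡ sumTo n g + f i
sumTo-update zero    {i = suc i} l () e
sumTo-update (suc n) {f} {g} {i} l u e with i ≟ suc n
... | yes refl = begin
  (f i + sumTo n f) + g i ≡⟨ cong (λ z → (f i + z) + g i) (sumTo-cong n λ l′ u′ → e l′ (m≤n⇒m≤1+n u′) (<⇒≢ (s≤s u′))) ⟩
  (f i + sumTo n g) + g i ≡⟨ +-comm _ (g i) ⟩
  g i + (f i + sumTo n g) ≡⟨ cong (g i +_) (+-comm (f i) _) ⟩
  g i + (sumTo n g + f i) ≡⟨ +-assoc (g i) _ _ ⟨
  (g i + sumTo n g) + f i ∎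
  where open ≡-Reasoning
... | no i≢ = begin
  (f (suc n) + sumTo n f) + g i ≡⟨ +-assoc (f (suc n)) _ _ ⟩
  f (suc n) + (sumTo n f + g i) ≡⟨ cong₂ _+_ (e (s≤s z≤n) ≤-refl (i≢ ∘ sym))
                                     (sumTo-update n l (s≤s⁻¹ (≤∧≢⇒< u i≢)) λ l′ u′ → e l′ (m≤n⇒m≤1+n u′)) ⟩
  g (suc n) + (sumTo n g + f i) ≡⟨ +-assoc (g (suc n)) _ _ ⟨
  (g (suc n) + sumTo n g) + f i ∎
  where open ≡-Reasoning

-- Permutations of lists

-- Without repetitions, equality as sets is equality as multisets; so the two insertion bijections
-- need only membership in both directions.
unique⇒↭ : {xs ys : List A} → Unique xs → Unique ys →
           (∀ {x} → x ∈ xs → x ∈ ys) → (∀ {x} → x ∈ ys → x ∈ xs) → xs ↭ ys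
unique⇒↭ u v f g = ∼bag⇒↭ (unique∧set⇒bag u v (mk⇔ f g))

concatMap-↭ : (f : A → List B) {xs ys : List A} → xs ↭ ys → concatMap f xs ↭ concatMap f ys
concatMap-↭ f Perm.refl = ↭-refl
concatMap-↭ f (prep x p) = ++⁺ˡ (f x) (concatMap-↭ f p)
concatMap-↭ f (swap {xs} {ys} x y p) = begin
  f x ++ f y ++ concatMap f xs   ↭⟨ ++⁺ˡ (f x) (++⁺ˡ (f y) (concatMap-↭ f p)) ⟩
  f x ++ f y ++ concatMap f ys   ↭⟨ Permₚ.shifts (f x) (f y) ⟩
  f y ++ f x ++ concatMap f ys   ∎
  where open PermutationReasoning
concatMap-↭ f (Perm.trans p q) = ↭-trans (concatMap-↭ f p) (concatMap-↭ f q)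

concatMap-cong-↭ : {f g : A → List B} (xs : List A) → (∀ {x} → x ∈ xs → f x ↭ g x) →
                   concatMap f xs ↭ concatMap g xs
concatMap-cong-↭ []       e = ↭-refl
concatMap-cong-↭ (x ∷ xs) e = ++⁺ (e (here refl)) (concatMap-cong-↭ xs (e ∘ there))

map-unique : (f : A → B) {xs : List A} → (∀ {x y} → x ∈ xs → y ∈ xs → f x ≡ f y → x ≡ y) →
             Unique xs → Unique (map f xs)
map-unique f inj []       = []
map-unique f inj (x∉ ∷ u) =
  All.tabulate (λ y∈ e → let x , x∈ , e′ = ∈-map⁻ f y∈ in
                 All.lookup x∉ x∈ (inj (here refl) (there x∈) (trans e e′)))
  ∷ map-unique f (λ p q → inj (there p) (there q)) u

-- Injectivity is asked of listed arguments only: the two insertion maps are injective on valid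
-- words with valid places, but not on arbitrary lists.
cartesianProductWith-unique : (f : A → B → C) {xs : List A} {ys : List B} →
  (∀ {w x y z} → w ∈ xs → x ∈ xs → y ∈ ys → z ∈ ys → f w y ≡ f x z → w ≡ x × y ≡ z) →
  Unique xs → Unique ys → Unique (cartesianProductWith f xs ys)
cartesianProductWith-unique f {[]} inj u v = []
cartesianProductWith-unique {A} {B} {C} f {x ∷ xs} {ys} inj (x∉ ∷ u) v =
  Uniq.++⁺ (map-unique (f x) (λ p q e → proj₂ (inj (here refl) (here refl) p q e)) v)
           (cartesianProductWith-unique f (λ p q → inj (there p) (there q)) u v)
           disj
  where
  disj : ∀ {c} → ¬ (c ∈ map (f x) ys × c ∈ cartesianProductWith f xs ys)
  disj (p , q) with z , z∈ , e ← ∈-map⁻ (f x) p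
               with w , z′ , w∈ , z′∈ , e′ ← ∈-cartesianProductWith⁻ f xs ys q =
    All.lookup x∉ w∈ (proj₁ (inj (here refl) (there w∈) z∈ z′∈ (trans (sym e) e′)))

concatMap≡cartesianProductWith : (f : A → B → C) (xs : List A) (ys : List B) →
  concatMap (λ x → map (f x) ys) xs ≡ cartesianProductWith f xs ys
concatMap≡cartesianProductWith f []       ys = refl
concatMap≡cartesianProductWith f (x ∷ xs) ys = cong (map (f x) ys ++_) (concatMap≡cartesianProductWith f xs ys)

range-unique : ∀ a b → Unique (range a b)
range-unique a b = Uniq.map⁺ (+-cancelˡ-≡ a _ _) (Uniq.upTo⁺ (suc b ∸ a))

-- The common recursion

record Stat : Set where
  constructor ⟨_,_,_,_,_,_⟩
  field
    xᵉ yᵉ sᵉ tᵉ pᵉ qᵉ : ℕ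

-- The factor x, y, s or t that stands for an arc of π, or for what an insertion into an inner gap of σ destroys
-- (y if nothing).
data Kind : Set where
  excᵏ aexcᵏ singleᵏ fixᵏ : Kind

isExc isSingle isFix isAexc : Kind → Bool
isExc excᵏ = true
isExc _ = false
isAexc aexcᵏ = true
isAexc _ = false
isSingle singleᵏ = true
isSingle _ = false
isFix fixᵏ = true
isFix _ = false

-- A normal form for multisets of kinds. A monomial knows only how many factors of each kind it has,
-- and a fixed order makes `offspring` a function of the exponents alone.
canon : ℕ → ℕ → ℕ → ℕ → List Kind
canon a b c d = replicate a excᵏ ++ replicate b aexcᵏ ++ replicate c singleᵏ ++ replicate d fixᵏ

↭canon : ∀ κs → κs ↭ canon (countB isExc κs) (countB isAexc κs) (countB isSingle κs) (countB isFix κs)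
↭canon []        = ↭-refl
↭canon (excᵏ ∷ κs)  = prep excᵏ (↭canon κs)
↭canon (aexcᵏ ∷ κs)  = ↭-trans (prep aexcᵏ (↭canon κs)) (↭-sym (Permₚ.shift aexcᵏ (replicate (countB isExc κs) excᵏ) _))
↭canon (singleᵏ ∷ κs)  = ↭-trans (prep singleᵏ (↭canon κs))
  (↭-trans (↭-sym (Permₚ.shift singleᵏ (replicate (countB isExc κs) excᵏ) _))
           (++⁺ˡ (replicate (countB isExc κs) excᵏ) (↭-sym (Permₚ.shift singleᵏ (replicate (countB isAexc κs) aexcᵏ) _))))
↭canon (fixᵏ ∷ κs) = ↭-trans (prep fixᵏ (↭canon κs))
  (↭-trans (↭-sym (Permₚ.shift fixᵏ (replicate (countB isExc κs) excᵏ) _))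
           (++⁺ˡ (replicate (countB isExc κs) excᵏ)
             (↭-trans (↭-sym (Permₚ.shift fixᵏ (replicate (countB isAexc κs) aexcᵏ) _))
               (++⁺ˡ (replicate (countB isAexc κs) aexcᵏ) (↭-sym (Permₚ.shift fixᵏ (replicate (countB isSingle κs) singleᵏ) _))))))

-- One factor of the given kind is replaced by x y, so x only gains a y and y only gains an x; the
-- Boolean decides on the factor p. In `offspring` the kind is taken from `kinds`, so the exponent
-- under `pred` is positive there.
split : Kind → Bool → Stat → Stat
split excᵏ  e ⟨ a , b , c , d , p , q ⟩ = ⟨ a , suc b , c , d , ind e + p , q ⟩
split aexcᵏ  e ⟨ a , b , c , d , p , q ⟩ = ⟨ suc a , b , c , d , ind e + p , q ⟩
split singleᵏ  e ⟨ a , b , c , d , p , q ⟩ = ⟨ suc a , suc b , pred c , d , ind e + p , q ⟩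
split fixᵏ e ⟨ a , b , c , d , p , q ⟩ = ⟨ suc a , suc b , c , pred d , ind e + p , q ⟩

newFix newSingle : Stat → Stat
newFix ⟨ a , b , c , d , p , q ⟩ = ⟨ a , b , c , suc d , p , suc q ⟩
newSingle ⟨ a , b , c , d , p , q ⟩ = ⟨ a , b , suc c , d , suc p , suc q ⟩

kinds : Stat → List Kind
kinds ⟨ a , b , c , d , p , q ⟩ = canon a b c d

offspring : Stat → List Stat
offspring w = newFix w ∷ newSingle w ∷ map (λ k → split k false w) (kinds w) ++ map (λ k → split k true w) (kinds w)

module _ {c ℓ} (R : CommutativeSemiring c ℓ) where
  open CommutativeSemiring R using (Carrier; _≈_) renaming (_+_ to _⊕_)
  private module R = CommutativeSemiring R

  sumOver-map : (f : A → B) (g : B → Carrier) (xs : List A) → sumOver R (map f xs) g ≡ sumOver R xs (g ∘ f)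
  sumOver-map f g []       = refl
  sumOver-map f g (x ∷ xs) = cong (g (f x) ⊕_) (sumOver-map f g xs)

  sumOver-↭ : (g : A → Carrier) {xs ys : List A} → xs ↭ ys → sumOver R xs g ≈ sumOver R ys g
  sumOver-↭ g Perm.refl    = R.refl
  sumOver-↭ g (prep x p)   = R.+-congˡ (sumOver-↭ g p)
  sumOver-↭ g (swap x y p) = R.trans (R.sym (R.+-assoc _ _ _))
    (R.trans (R.+-cong (R.+-comm _ _) (sumOver-↭ g p)) (R.+-assoc _ _ _))
  sumOver-↭ g (Perm.trans p q) = R.trans (sumOver-↭ g p) (sumOver-↭ g q)

  sumOver-map-↭ : (f : A → C) (g : B → C) (h : C → Carrier) (xs : List A) (ys : List B) →
                  map f xs ↭ map g ys → sumOver R xs (h ∘ f) ≈ sumOver R ys (h ∘ g)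
  sumOver-map-↭ f g h xs ys p = R.trans (R.reflexive (sym (sumOver-map f h xs)))
    (R.trans (sumOver-↭ h p) (R.reflexive (sumOver-map g h ys)))

stat≡ : ∀ {a b c d p q a′ b′ c′ d′ p′ q′} → a ≡ a′ → b ≡ b′ → c ≡ c′ → d ≡ d′ → p ≡ p′ → q ≡ q′ →
        ⟨ a , b , c , d , p , q ⟩ ≡ ⟨ a′ , b′ , c′ , d′ , p′ , q′ ⟩
stat≡ refl refl refl refl refl refl = refl

drop0 : ∀ {a b} → a + 0 ≡ b → a ≡ b
drop0 {a} e = trans (sym (+-identityʳ a)) e

map-cong-∈ : {f g : A → B} (xs : List A) → (∀ {x} → x ∈ xs → f x ≡ g x) → map f xs ≡ map g xs
map-cong-∈ []       e = refl
map-cong-∈ (x ∷ xs) e = cong₂ _∷_ (e (here refl)) (map-cong-∈ xs (e ∘ there))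

countB-map : (P : B → Bool) (f : A → B) (xs : List A) → countB P (map f xs) ≡ countB (P ∘ f) xs
countB-map P f []       = refl
countB-map P f (x ∷ xs) = trans (countB-∷ P (f x) (map f xs))
  (trans (cong (ind (P (f x)) +_) (countB-map P f xs)) (sym (countB-∷ (P ∘ f) x xs)))

-- Four counts determine a list of kinds up to order. Thus gaps or arcs have to be matched with the
-- factors of a monomial in number only, without a bijection.
kinds-↭ : ∀ n (κ : ℕ → Kind) {a b c d p q} →
          count n (isExc ∘ κ) ≡ a → count n (isAexc ∘ κ) ≡ b → count n (isSingle ∘ κ) ≡ c → count n (isFix ∘ κ) ≡ d →
          map κ (range 1 n) ↭ kinds ⟨ a , b , c , d , p , q ⟩
kinds-↭ n κ refl refl refl refl = ↭-trans (↭canon (map κ (range 1 n)))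
  (Perm.↭-reflexive (canon-cong (e isExc) (e isAexc) (e isSingle) (e isFix)))
  where
  e : ∀ f → countB f (map κ (range 1 n)) ≡ count n (f ∘ κ)
  e f = trans (countB-map f κ (range 1 n)) (countR≡count n (f ∘ κ))
  canon-cong : ∀ {a b c d a′ b′ c′ d′} → a ≡ a′ → b ≡ b′ → c ≡ c′ → d ≡ d′ → canon a b c d ≡ canon a′ b′ c′ d′
  canon-cong refl refl refl refl = refl

offspring-↭ : (stat : A → Stat) (child : B → A) (w : Stat) (m₁ m₂ : B) (ms₁ ms₂ : List B) →
              stat (child m₁) ≡ newFix w → stat (child m₂) ≡ newSingle w →
              map (stat ∘ child) ms₁ ↭ map (λ k → split k false w) (kinds w) →
              map (stat ∘ child) ms₂ ↭ map (λ k → split k true w) (kinds w) →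
              map stat (map child (m₁ ∷ m₂ ∷ ms₁ ++ ms₂)) ↭ offspring w
offspring-↭ stat child w m₁ m₂ ms₁ ms₂ e₁ e₂ p q = ↭-trans (Perm.↭-reflexive eq)
  (prep _ (prep _ (++⁺ p q)))
  where
  eq : map stat (map child (m₁ ∷ m₂ ∷ ms₁ ++ ms₂)) ≡ newFix w ∷ newSingle w ∷ map (stat ∘ child) ms₁ ++ map (stat ∘ child) ms₂
  eq = cong₂ _∷_ e₁ (cong₂ _∷_ e₂ (trans (sym (map-∘ (ms₁ ++ ms₂))) (map-++ (stat ∘ child) ms₁ ms₂)))

-- The exponents of the children depend on the parent only through its own exponents, so the
-- recursion for words descends to one for lists of exponents, the same on both sides.
recursion-↭ : (stat : A → Stat) (stat′ : C → Stat) (child : A → B → C) (xs : List A) (ms : List B) {ys : List C} →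
              ys ↭ cartesianProductWith child xs ms →
              (∀ {x} → x ∈ xs → map stat′ (map (child x) ms) ↭ offspring (stat x)) →
              map stat′ ys ↭ concatMap offspring (map stat xs)
recursion-↭ stat stat′ child xs ms {ys} p e = begin
  map stat′ ys                                        ↭⟨ map⁺ stat′ p ⟩
  map stat′ (cartesianProductWith child xs ms)        ≡⟨ cong (map stat′) (concatMap≡cartesianProductWith child xs ms) ⟨
  map stat′ (concatMap (λ x → map (child x) ms) xs)   ≡⟨ map-concatMap stat′ (λ x → map (child x) ms) xs ⟩
  concatMap (λ x → map stat′ (map (child x) ms)) xs   ↭⟨ concatMap-cong-↭ xs e ⟩
  concatMap (offspring ∘ stat) xs                     ≡⟨ concatMap-map offspring stat xs ⟨
  concatMap offspring (map stat xs)                   ∎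
  where open PermutationReasoning

-- Further facts on counting: witnesses and lower bounds

sumTo-head : ∀ n f → sumTo (suc n) f ≡ f 1 + sumTo n (f ∘ suc)
sumTo-head zero    f = refl
sumTo-head (suc n) f = begin
  f (2 + n) + sumTo (suc n) f              ≡⟨ cong (f (2 + n) +_) (sumTo-head n f) ⟩
  f (2 + n) + (f 1 + sumTo n (f ∘ suc))    ≡⟨ +-assoc (f (2 + n)) _ _ ⟨
  (f (2 + n) + f 1) + sumTo n (f ∘ suc)    ≡⟨ cong (_+ sumTo n (f ∘ suc)) (+-comm (f (2 + n)) _) ⟩
  (f 1 + f (2 + n)) + sumTo n (f ∘ suc)    ≡⟨ +-assoc (f 1) _ _ ⟩
  f 1 + sumTo (suc n) (f ∘ suc)            ∎
  where open ≡-Reasoning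

sumTo-≤ : ∀ n {f g} → (∀ {k} → 1 ≤ k → k ≤ n → f k ≤ g k) → sumTo n f ≤ sumTo n g
sumTo-≤ zero    e = z≤n
sumTo-≤ (suc n) e = +-mono-≤ (e (s≤s z≤n) ≤-refl) (sumTo-≤ n λ l u → e l (m≤n⇒m≤1+n u))

ind-T : ∀ {b} → T b → ind b ≡ 1
ind-T {true} _ = refl

ind-¬T : ∀ {b} → ¬ T b → ind b ≡ 0
ind-¬T {true}  f = ⊥-elim (f _)
ind-¬T {false} f = refl

count-witness : ∀ n {P} → 1 ≤ count n P → ∃ λ i → 1 ≤ i × i ≤ n × T (P i)
count-witness zero    ()
count-witness (suc n) {P} c with P (suc n) in eq
... | true  = suc n , s≤s z≤n , ≤-refl , subst T (sym eq) _
... | false with i , l , u , t ← count-witness n c = i , l , m≤n⇒m≤1+n u , t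

count-≡ᵇ : ∀ n {i} → 1 ≤ i → i ≤ n → count n (_≡ᵇ i) ≡ 1
count-≡ᵇ n {i} l u = sumTo-single n l u (ind-T {i ≡ᵇ i} (≡ᵇ-intro {i} refl))
  λ {k} _ _ k≢i → ind-¬T {k ≡ᵇ i} (k≢i ∘ ≡ᵇ-elim)

count-≥1 : ∀ n {P i} → 1 ≤ i → i ≤ n → T (P i) → 1 ≤ count n P
count-≥1 n {P} {i} l u t = subst (_≤ count n P) (count-≡ᵇ n l u) (sumTo-≤ n bound)
  where
  bound : ∀ {k} → 1 ≤ k → k ≤ n → ind (k ≡ᵇ i) ≤ ind (P k)
  bound {k} _ _ with k ≟ i
  ... | yes refl rewrite ind-T t = ≤-trans (≤-reflexive (ind-T {k ≡ᵇ k} (≡ᵇ-intro {k} refl))) ≤-refl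
  ... | no k≢i rewrite ind-¬T {k ≡ᵇ i} (k≢i ∘ ≡ᵇ-elim) = z≤n

count-remove : ∀ n {P i} → 1 ≤ i → i ≤ n → T (P i) →
               count n P ≡ suc (count n (λ k → P k ∧ not (k ≡ᵇ i)))
count-remove n {P} {i} l u t = begin
  count n P                 ≡⟨ +-identityʳ _ ⟨
  count n P + 0             ≡⟨ cong (count n P +_)
    (ind-¬T {P i ∧ not (i ≡ᵇ i)} λ r → not-elim {i ≡ᵇ i} (proj₂ (∧-elim {P i} r)) (≡ᵇ-intro {i} refl)) ⟨
  count n P + ind (P∖i i)   ≡⟨ sumTo-update n l u
    (λ {k} _ _ k≢i → cong ind
      (T-ext {P k} {P∖i k} (λ p → ∧-intro p (not-intro (k≢i ∘ ≡ᵇ-elim))) (proj₁ ∘ ∧-elim {P k}))) ⟩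
  count n P∖i + ind (P i)   ≡⟨ cong (count n P∖i +_) (ind-T t) ⟩
  count n P∖i + 1           ≡⟨ +-comm _ 1 ⟩
  suc (count n P∖i)         ∎
  where
  open ≡-Reasoning
  P∖i = λ k → P k ∧ not (k ≡ᵇ i)

count-≥2 : ∀ n {P i j} → 1 ≤ i → i ≤ n → 1 ≤ j → j ≤ n → i ≢ j → T (P i) → T (P j) → 2 ≤ count n P
count-≥2 n {P} {i} {j} l u l′ u′ i≢j t t′ = subst (2 ≤_) (sym (count-remove n l u t))
  (s≤s (count-≥1 n l′ u′ (∧-intro {P j} t′ (not-intro (i≢j ∘ sym ∘ ≡ᵇ-elim)))))

count-≥3 : ∀ n {P i j k} → 1 ≤ i → i ≤ n → 1 ≤ j → j ≤ n → 1 ≤ k → k ≤ n →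
           i ≢ j → i ≢ k → j ≢ k → T (P i) → T (P j) → T (P k) → 3 ≤ count n P
count-≥3 n {P} {i} {j} {k} l u l′ u′ l″ u″ i≢j i≢k j≢k t t′ t″ = subst (3 ≤_) (sym (count-remove n l u t))
  (s≤s (count-≥2 n l′ u′ l″ u″ j≢k (∧-intro {P j} t′ (not-intro (i≢j ∘ sym ∘ ≡ᵇ-elim)))
                                  (∧-intro {P k} t″ (not-intro (i≢k ∘ sym ∘ ≡ᵇ-elim)))))

-- Indexing words by positions, for unsigned and signed letters alike

module Index {A : Set} (_‼_ : List A → ℕ → A)
             (first : ∀ x xs → (x ∷ xs) ‼ 1 ≡ x)
             (next  : ∀ x xs i → (x ∷ xs) ‼ suc (suc i) ≡ xs ‼ suc i) where

  ‼-ext : ∀ {xs ys} → length xs ≡ length ys →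
          (∀ {k} → 1 ≤ k → k ≤ length xs → xs ‼ k ≡ ys ‼ k) → xs ≡ ys
  ‼-ext {[]}     {[]}     l e = refl
  ‼-ext {x ∷ xs} {y ∷ ys} l e = cong₂ _∷_
    (trans (sym (first x xs)) (trans (e (s≤s z≤n) (s≤s z≤n)) (first y ys)))
    (‼-ext (suc-injective l) λ { {suc k} p q → trans (sym (next x xs k)) (trans (e (s≤s z≤n) (s≤s q)) (next y ys k)) })

  ‼-applyUpTo : ∀ f n {k} → k < n → applyUpTo f n ‼ suc k ≡ f k
  ‼-applyUpTo f (suc n) {zero}  p       = first _ _
  ‼-applyUpTo f (suc n) {suc k} (s≤s p) = trans (next _ _ k) (‼-applyUpTo (f ∘ suc) n p)

  table : ℕ → (ℕ → A) → List A
  table n f = applyUpTo (f ∘ suc) n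

  ‼-table : ∀ n f {k} → 1 ≤ k → k ≤ n → table n f ‼ k ≡ f k
  ‼-table n f {suc k} _ u = ‼-applyUpTo (f ∘ suc) n u

  -- Links multiplicities in lists, as the definitions state them, with counts over positions, on
  -- which all later arguments run.
  countB-‼ : ∀ P xs → countB P xs ≡ count (length xs) (P ∘ (xs ‼_))
  countB-‼ P []       = refl
  countB-‼ P (x ∷ xs) = begin
    countB P (x ∷ xs)                                           ≡⟨ countB-∷ P x xs ⟩
    ind (P x) + countB P xs                                     ≡⟨ cong (ind (P x) +_) (countB-‼ P xs) ⟩
    ind (P x) + count (length xs) (P ∘ (xs ‼_))                 ≡⟨ cong₂ _+_ (cong (ind ∘ P) (first x xs))
                                                                     (count-cong (length xs) λ { {suc k} _ _ → cong P (next x xs k) }) ⟨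
    ind (P ((x ∷ xs) ‼ 1)) + count (length xs) (P ∘ ((x ∷ xs) ‼_) ∘ suc) ≡⟨ sumTo-head (length xs)
      (ind ∘ P ∘ ((x ∷ xs) ‼_)) ⟨
    count (suc (length xs)) (P ∘ ((x ∷ xs) ‼_))                 ∎
    where open ≡-Reasoning

  ‼-∈ : ∀ {xs k} → 1 ≤ k → k ≤ length xs → xs ‼ k ∈ xs
  ‼-∈ {x ∷ xs} {suc zero}    l u       = here (first x xs)
  ‼-∈ {x ∷ xs} {suc (suc k)} l (s≤s u) = there (subst (_∈ xs) (sym (next x xs k)) (‼-∈ (s≤s z≤n) u))

  ∈-‼ : ∀ {xs x} → x ∈ xs → ∃ λ k → 1 ≤ k × k ≤ length xs × xs ‼ k ≡ x
  ∈-‼ {x ∷ xs} (here refl) = 1 , s≤s z≤n , s≤s z≤n , first x xs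
  ∈-‼ {y ∷ xs} (there x∈) with suc k , l , u , e ← ∈-‼ x∈ =
    suc (suc k) , s≤s z≤n , s≤s u , trans (next y xs k) e

module _ {A : Set} where

  -- The common form of `words` and `signedWords`, so that membership and absence of repetitions are
  -- settled once for both.
  wordsOver : List A → ℕ → List (List A)
  wordsOver ls zero    = [] ∷ []
  wordsOver ls (suc L) = cartesianProductWith _∷_ ls (wordsOver ls L)

  wordsOver-unique : ∀ {ls} → Unique ls → ∀ L → Unique (wordsOver ls L)
  wordsOver-unique u zero    = [] ∷ []
  wordsOver-unique u (suc L) = Uniq.cartesianProductWith⁺ _∷_ ∷-injective u (wordsOver-unique u L)

  ∈-wordsOver⁻ : ∀ {ls} L {xs} → xs ∈ wordsOver ls L → length xs ≡ L × (∀ {x} → x ∈ xs → x ∈ ls)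
  ∈-wordsOver⁻ zero    (here refl) = refl , λ ()
  ∈-wordsOver⁻ {ls} (suc L) xs∈ with y , ys , y∈ , ys∈ , refl ← ∈-cartesianProductWith⁻ _∷_ ls (wordsOver ls L) xs∈ =
    let l , s = ∈-wordsOver⁻ L ys∈ in cong suc l , λ { (here refl) → y∈ ; (there p) → s p }

  ∈-wordsOver⁺ : ∀ {ls} L {xs} → length xs ≡ L → (∀ {x} → x ∈ xs → x ∈ ls) → xs ∈ wordsOver ls L
  ∈-wordsOver⁺ zero    {[]}     l s = here refl
  ∈-wordsOver⁺ (suc L) {x ∷ xs} l s =
    ∈-cartesianProductWith⁺ _∷_ (s (here refl)) (∈-wordsOver⁺ L (suc-injective l) (s ∘ there))

count-witness₂ : ∀ n {P} → 2 ≤ count n P → ∃ λ a → ∃ λ b → 1 ≤ a × a < b × b ≤ n × T (P a) × T (P b)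
count-witness₂ zero    ()
count-witness₂ (suc n) {P} c with P (suc n) in eq
... | true  with a , l , u , t ← count-witness n (s≤s⁻¹ c) =
  a , suc n , l , s≤s u , ≤-refl , t , subst T (sym eq) _
... | false with a , b , l , a<b , u , t , t′ ← count-witness₂ n c =
  a , b , l , a<b , m≤n⇒m≤1+n u , t , t′

-- Stirling permutations

module Word = Index at (λ _ _ → refl) (λ _ _ _ → refl)
open Word

-- Here and below a word is a function on positions with a separate length: an insertion is then a
-- reindexing, and a change of length is a substitution.
record Plateau (w : ℕ → ℕ) (L i : ℕ) : Set where
  constructor plateau
  field
    2≤i  : 2 ≤ i
    i<L  : i < L
    rise : w (pred i) < w i
    flat : w i ≡ w (suc i)

First : (ℕ → ℕ) → ℕ → Set
First w i = ∀ {k} → 1 ≤ k → k < i → w k ≢ w i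

record RlMin (w : ℕ → ℕ) (L v : ℕ) : Set where
  constructor rlMin
  field
    {pos} : ℕ
    1≤pos : 1 ≤ pos
    pos≤L : pos ≤ L
    value : w pos ≡ v
    first : First w pos
    least : ∀ {k} → pos < k → k ≤ L → w pos ≤ w k

-- For position 1 the condition is vacuous, which absorbs the separate case i = 1 of `isLtrMin`.
LrMin : (ℕ → ℕ) → ℕ → Set
LrMin w i = ∀ {k} → 1 ≤ k → k < i → w i < w k

record Block2 (w : ℕ → ℕ) (L i : ℕ) : Set where
  constructor block2
  field
    start : LrMin w i
    i<L   : i < L
    inner : ¬ LrMin w (suc i)
    stop  : suc i ≡ L ⊎ LrMin w (2 + i)

pred-≤ : ∀ {k i} → k < i → k ≤ i ∸ 1
pred-≤ (s≤s p) = p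

≤-pred-< : ∀ {k i} → 1 ≤ k → k ≤ i ∸ 1 → k < i
≤-pred-< {i = suc i} _ p = s≤s p
≤-pred-< {suc k} {zero} _ ()

module _ {σ : List ℕ} where

  inAp-elim : ∀ {v} → T (inAp σ v) → ∃ λ i → Plateau (at σ) (length σ) i × at σ i ≡ v
  inAp-elim {v} t with i , l , u , t′ ← anyR-elim {2} {length σ ∸ 1} {λ i → (at σ (i ∸ 1) <ᵇ at σ i) ∧ (at σ i ≡ᵇ at σ (suc i)) ∧ (at σ i ≡ᵇ v)} t
    with a , b ← ∧-elim {at σ (i ∸ 1) <ᵇ at σ i} t′
    with b , c ← ∧-elim {at σ i ≡ᵇ at σ (suc i)} b
    = i , plateau l (≤-pred-< (≤-trans (s≤s z≤n) l) u) (<ᵇ-elim a) (≡ᵇ-elim b) , ≡ᵇ-elim c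

  inAp-intro : ∀ {i} → Plateau (at σ) (length σ) i → T (inAp σ (at σ i))
  inAp-intro {i} (plateau l u a b) =
    anyR-intro {2} {length σ ∸ 1} {λ k → (at σ (k ∸ 1) <ᵇ at σ k) ∧ (at σ k ≡ᵇ at σ (suc k)) ∧
      (at σ k ≡ᵇ at σ i)} {i} l (pred-≤ u)
    (∧-intro {at σ (i ∸ 1) <ᵇ at σ i} (<⇒<ᵇ a) (∧-intro {at σ i ≡ᵇ at σ (suc i)} (≡ᵇ-intro b) (≡ᵇ-intro {at σ i} refl)))

  firstOcc-elim : ∀ {i} → T (firstOcc σ i) → First (at σ) i
  firstOcc-elim {i} t {k} l u e =
    not-elim (allR-elim {1} {i ∸ 1} {λ j → not (at σ j ≡ᵇ at σ i)} t l (pred-≤ u)) (≡ᵇ-intro e)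

  firstOcc-intro : ∀ {i} → First (at σ) i → T (firstOcc σ i)
  firstOcc-intro {i} f =
    allR-intro {1} {i ∸ 1} {λ j → not (at σ j ≡ᵇ at σ i)} λ l u → not-intro (f l (≤-pred-< l u) ∘ ≡ᵇ-elim)

  inRlmin-elim : ∀ {v} → T (inRlmin σ v) → RlMin (at σ) (length σ) v
  inRlmin-elim {v} t with i , l , u , t′ ← anyR-elim {1} {length σ} {λ i → (at σ i ≡ᵇ v) ∧ firstOcc σ i ∧ allR (suc i) (length σ) (λ j → at σ i ≤ᵇ at σ j)} t
    with a , b ← ∧-elim {at σ i ≡ᵇ v} t′
    with b , c ← ∧-elim {firstOcc σ i} b
    = rlMin l u (≡ᵇ-elim a) (firstOcc-elim b) λ p q → ≤ᵇ-elim {at σ i}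
      (allR-elim {suc i} {length σ} {λ j → at σ i ≤ᵇ at σ j} c p q)

  inRlmin-intro : ∀ {v} → RlMin (at σ) (length σ) v → T (inRlmin σ v)
  inRlmin-intro {v} (rlMin {i} l u a b c) =
    anyR-intro {1} {length σ} {λ i → (at σ i ≡ᵇ v) ∧ firstOcc σ i ∧ allR (suc i) (length σ)
      (λ j → at σ i ≤ᵇ at σ j)} {i} l u
    (∧-intro {at σ i ≡ᵇ v} (≡ᵇ-intro a) (∧-intro {firstOcc σ i} (firstOcc-intro b) (allR-intro {suc i} {length σ} {λ j → at σ i ≤ᵇ at σ j} λ p q → ≤⇒≤ᵇ (c p q))))

  isLtrMin-elim : ∀ {i} → T (isLtrMin σ i) → LrMin (at σ) i
  isLtrMin-elim {i} t {k} l u with ∨-elim {i ≡ᵇ 1} t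
  ... | inj₂ a = <ᵇ-elim (allR-elim {1} {i ∸ 1} {λ j → at σ i <ᵇ at σ j} a l (pred-≤ u))
  ... | inj₁ a with refl ← ≡ᵇ-elim {i} {1} a = ⊥-elim (<⇒≱ u l)

  isLtrMin-intro : ∀ {i} → LrMin (at σ) i → T (isLtrMin σ i)
  isLtrMin-intro {i} f =
    ∨-intro {i ≡ᵇ 1} (inj₂ (allR-intro {1} {i ∸ 1} {λ j → at σ i <ᵇ at σ j} λ l u → <⇒<ᵇ (f l (≤-pred-< l u))))

  block2At-elim : ∀ {i} → T (block2At σ i) → Block2 (at σ) (length σ) i
  block2At-elim {i} t
    with a , t ← ∧-elim {isLtrMin σ i} t
    with b , t ← ∧-elim {suc i ≤ᵇ length σ} t
    with c , d ← ∧-elim {not (isLtrMin σ (suc i))} t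
    = block2 (isLtrMin-elim a) (≤ᵇ-elim {suc i} b) (not-elim c ∘ isLtrMin-intro)
      (stop′ (∨-elim {i + 2 ≡ᵇ suc (length σ)} d))
    where
    stop′ : T (i + 2 ≡ᵇ suc (length σ)) ⊎ T (isLtrMin σ (i + 2)) → suc i ≡ length σ ⊎ LrMin (at σ) (2 + i)
    stop′ (inj₁ e) = inj₁ (suc-injective (trans (+-comm 2 i) (≡ᵇ-elim {i + 2} e)))
    stop′ (inj₂ e) = inj₂ (subst (LrMin (at σ)) (+-comm i 2) (isLtrMin-elim e))

  block2At-intro : ∀ {i} → Block2 (at σ) (length σ) i → T (block2At σ i)
  block2At-intro {i} (block2 a b c d) =
    ∧-intro {isLtrMin σ i} (isLtrMin-intro a) (∧-intro {suc i ≤ᵇ length σ} (≤⇒≤ᵇ b)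
      (∧-intro {not (isLtrMin σ (suc i))} (not-intro (c ∘ isLtrMin-elim)) (∨-intro {i + 2 ≡ᵇ suc (length σ)} (stop′ d))))
    where
    stop′ : suc i ≡ length σ ⊎ LrMin (at σ) (2 + i) → T (i + 2 ≡ᵇ suc (length σ)) ⊎ T (isLtrMin σ (i + 2))
    stop′ (inj₁ e) = inj₁ (≡ᵇ-intro {i + 2} (trans (+-comm i 2) (cong suc e)))
    stop′ (inj₂ e) = inj₂ (isLtrMin-intro (subst (LrMin (at σ)) (+-comm 2 i) e))

-- Inserting two letters after position j moves the letter at position i to position shift j i.

shift : ℕ → ℕ → ℕ
shift j i = if i ≤ᵇ j then i else 2 + i

shift-≤ : ∀ {i j} → i ≤ j → shift j i ≡ i
shift-≤ {i} {j} p rewrite T⇒≡ {i ≤ᵇ j} (≤⇒≤ᵇ p) = refl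

shift-> : ∀ {i j} → j < i → shift j i ≡ 2 + i
shift-> {i} {j} p rewrite ¬T⇒≡ {i ≤ᵇ j} (λ t → <⇒≱ p (≤ᵇ-elim {i} t)) = refl

shift-mono-≤ : ∀ j {i k} → i ≤ k → shift j i ≤ shift j k
shift-mono-≤ j {i} {k} p with i ≤? j | k ≤? j
... | yes a | yes b rewrite shift-≤ a | shift-≤ b = p
... | yes a | no b  rewrite shift-≤ a | shift-> (≰⇒> b) = ≤-trans p (m≤n+m k 2)
... | no a  | yes b = ⊥-elim (a (≤-trans p b))
... | no a  | no b  rewrite shift-> (≰⇒> a) | shift-> (≰⇒> b) = s≤s (s≤s p)

shift-injective : ∀ j {i k} → shift j i ≡ shift j k → i ≡ k
shift-injective j {i} {k} e with i ≤? j | k ≤? j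
... | yes a | yes b rewrite shift-≤ a | shift-≤ b = e
... | no a  | no b  rewrite shift-> (≰⇒> a) | shift-> (≰⇒> b) = suc-injective (suc-injective e)
... | yes a | no b  rewrite shift-≤ a | shift-> (≰⇒> b) = ⊥-elim (b (≤-trans (≤-trans (m≤n+m k 2) (≤-reflexive (sym e))) a))
... | no a  | yes b rewrite shift-> (≰⇒> a) | shift-≤ b = ⊥-elim (a (≤-trans (≤-trans (m≤n+m i 2) (≤-reflexive e)) b))

shift-mono-< : ∀ j {i k} → i < k → shift j i < shift j k
shift-mono-< j p = ≤∧≢⇒< (shift-mono-≤ j (<⇒≤ p)) (<⇒≢ p ∘ shift-injective j)

shift-cancel-< : ∀ j {i k} → shift j i < shift j k → i < k
shift-cancel-< j p = ≰⇒> λ q → <⇒≱ p (shift-mono-≤ j q)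

shift-suc : ∀ {i j} → i ≢ j → shift j (suc i) ≡ suc (shift j i)
shift-suc {i} {j} i≢j with i ≤? j
... | yes a rewrite shift-≤ a | shift-≤ (≤∧≢⇒< a i≢j) = refl
... | no a  rewrite shift-> (≰⇒> a) | shift-> (m<n⇒m<1+n (≰⇒> a)) = refl

i≤shift : ∀ j i → i ≤ shift j i
i≤shift j i with i ≤? j
... | yes a rewrite shift-≤ a = ≤-refl
... | no a  rewrite shift-> (≰⇒> a) = m≤n+m i 2

shift≤2+ : ∀ j i → shift j i ≤ 2 + i
shift≤2+ j i with i ≤? j
... | yes a rewrite shift-≤ a = m≤n+m i 2
... | no a  rewrite shift-> (≰⇒> a) = ≤-refl

-- The case distinction behind every statement about the longer word: an old letter that was moved,
-- or one of the two new ones.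
data Position (j L : ℕ) : ℕ → Set where
  old  : ∀ {i} → 1 ≤ i → i ≤ L → Position j L (shift j i)
  new₁ : Position j L (suc j)
  new₂ : Position j L (2 + j)

position : ∀ {j L k} → j ≤ L → 1 ≤ k → k ≤ 2 + L → Position j L k
position {j} {L} {k} j≤L l u with k ≤? j
... | yes k≤j = subst (Position j L) (shift-≤ k≤j) (old l (≤-trans k≤j j≤L))
... | no k≰j with k ≟ suc j
...   | yes refl = new₁
...   | no k≢1 with k ≟ 2 + j
...     | yes refl = new₂
...     | no k≢2 = large (≤∧≢⇒< (≤∧≢⇒< (≰⇒> k≰j) (k≢1 ∘ sym)) (k≢2 ∘ sym)) u
  where
  large : ∀ {k} → 3 + j ≤ k → k ≤ 2 + L → Position j L k
  large {suc (suc i)} (s≤s (s≤s j<i)) (s≤s (s≤s i≤L)) =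
    subst (Position j L) (shift-> j<i) (old (≤-trans (s≤s z≤n) j<i) i≤L)

shift-bound⁻ : ∀ {j L k} → j ≤ L → shift j k ≤ 2 + L → k ≤ L
shift-bound⁻ {j} {L} {k} j≤L p = ≮⇒≥ λ L<k → <⇒≱ L<k (s≤s⁻¹ (s≤s⁻¹ (subst (_≤ 2 + L) (shift-> (≤-<-trans j≤L L<k)) p)))

shift-bound⁺ : ∀ {j L k} → k ≤ L → shift j k ≤ 2 + L
shift-bound⁺ {j} {L} {k} p = ≤-trans (shift≤2+ j k) (s≤s (s≤s p))

1≤shift : ∀ {j k} → 1 ≤ k → 1 ≤ shift j k
1≤shift {j} {k} p = ≤-trans p (i≤shift j k)

-- Only the values on the positions 1, ..., L + 2 are recorded. All changes of minima, plateaux and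
-- blocks follow from these equations and from m + 1 exceeding every old letter.
record Insertion (m L j : ℕ) (w w′ : ℕ → ℕ) : Set where
  field
    1≤L : 1 ≤ L
    j≤L : j ≤ L
    rng : ∀ {i} → 1 ≤ i → i ≤ L → 1 ≤ w i × w i ≤ m
    w′-old  : ∀ {i} → 1 ≤ i → i ≤ L → w′ (shift j i) ≡ w i
    w′-new₁ : w′ (suc j) ≡ suc m
    w′-new₂ : w′ (2 + j) ≡ suc m

  pos : ∀ {k} → 1 ≤ k → k ≤ 2 + L → Position j L k
  pos = position j≤L

  w<M : ∀ {i} → 1 ≤ i → i ≤ L → w i < suc m
  w<M l u = s≤s (proj₂ (rng l u))

  first-old⁺ : ∀ {i} → 1 ≤ i → i ≤ L → First w i → First w′ (shift j i)
  first-old⁺ {i} l u f l′ u′ e with pos l′ (≤-trans (<⇒≤ u′) (shift-bound⁺ u))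
  ... | old {k} lk uk = f lk (shift-cancel-< j u′) (trans (sym (w′-old lk uk)) (trans e (w′-old l u)))
  ... | new₁ = <⇒≢ (w<M l u) (trans (sym (w′-old l u)) (trans (sym e) w′-new₁))
  ... | new₂ = <⇒≢ (w<M l u) (trans (sym (w′-old l u)) (trans (sym e) w′-new₂))

  first-old⁻ : ∀ {i} → 1 ≤ i → i ≤ L → First w′ (shift j i) → First w i
  first-old⁻ l u f l′ u′ e = f (1≤shift l′) (shift-mono-< j u′)
    (trans (w′-old l′ (≤-trans (<⇒≤ u′) u)) (trans e (sym (w′-old l u))))

  first-new₁ : First w′ (suc j)
  first-new₁ {k} l u e with pos l (≤-trans (<⇒≤ u) (≤-trans (n≤1+n _) (s≤s (s≤s j≤L))))
  ... | old lk uk = <⇒≢ (w<M lk uk) (trans (sym (w′-old lk uk)) (trans e w′-new₁))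
  ... | new₁ = <-irrefl refl u
  ... | new₂ = <⇒≱ u (n≤1+n _)

  ¬first-new₂ : ¬ First w′ (2 + j)
  ¬first-new₂ f = f {suc j} (s≤s z≤n) ≤-refl (trans w′-new₁ (sym w′-new₂))

  lrMin-old⁺ : ∀ {i} → 1 ≤ i → i ≤ L → LrMin w i → LrMin w′ (shift j i)
  lrMin-old⁺ {i} l u f l′ u′ with pos l′ (≤-trans (<⇒≤ u′) (shift-bound⁺ u))
  ... | old lk uk = subst₂ _<_ (sym (w′-old l u)) (sym (w′-old lk uk)) (f lk (shift-cancel-< j u′))
  ... | new₁ = subst₂ _<_ (sym (w′-old l u)) (sym w′-new₁) (w<M l u)
  ... | new₂ = subst₂ _<_ (sym (w′-old l u)) (sym w′-new₂) (w<M l u)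

  lrMin-old⁻ : ∀ {i} → 1 ≤ i → i ≤ L → LrMin w′ (shift j i) → LrMin w i
  lrMin-old⁻ l u f l′ u′ = subst₂ _<_ (w′-old l u) (w′-old l′ (≤-trans (<⇒≤ u′) u)) (f (1≤shift l′) (shift-mono-< j u′))

  -- If 1 ≤ j, the first letter of `w` still stands at position 1, in front of the new letters and
  -- smaller than they are.
  lrMin-new₁ : LrMin w′ (suc j) → j ≡ 0
  lrMin-new₁ f with j ≟ 0
  ... | yes e = e
  ... | no j≢0 = ⊥-elim (<-asym (w<M (s≤s z≤n) 1≤L) (subst₂ _<_ w′-new₁ (w′-old (s≤s z≤n) 1≤L)
      (f (1≤shift {j} (s≤s z≤n)) (subst (_< suc j) (sym (shift-≤ (n≢0⇒n>0 j≢0))) (s≤s (n≢0⇒n>0 j≢0))))))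

  ¬lrMin-new₂ : ¬ LrMin w′ (2 + j)
  ¬lrMin-new₂ f = <-irrefl (trans w′-new₂ (sym w′-new₁)) (f {suc j} (s≤s z≤n) ≤-refl)

  -- For i = j the letter behind position i has become m + 1, so the word is no longer flat there;
  -- for i - 1 = j the letter in front has become m + 1, so there is no rise.
  plateau-old⁻ : ∀ {i} → 1 ≤ i → i ≤ L → Plateau w′ (2 + L) (shift j i) → Plateau w L i × i ≢ j × pred i ≢ j
  plateau-old⁻ {suc i₀} l u (plateau 2≤s s<L rise flat) = go i₀ refl
    where
    i = suc i₀
    i≢j : i ≢ j
    i≢j refl = <⇒≢ (w<M l u)
      (trans (sym (w′-old l u)) (trans flat (trans (cong (w′ ∘ suc) (shift-≤ {i} ≤-refl)) w′-new₁)))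
    p≢j : i₀ ≢ j
    p≢j refl = <-asym (w<M l u) (subst₂ _<_ (trans (cong (w′ ∘ pred) (shift-> {i} ≤-refl)) w′-new₂) (w′-old l u) rise)
    go : ∀ k → i₀ ≡ k → Plateau w L (suc i₀) × suc i₀ ≢ j × i₀ ≢ j
    -- Position 1 moves to a position at least 2 only for j = 0, which `p≢j` excludes.
    go zero refl = ⊥-elim (<⇒≱ 2≤s (≤-reflexive (shift-≤ (n≢0⇒n>0 (p≢j ∘ sym)))))
    go (suc _) refl = plateau (s≤s (s≤s z≤n)) i<L
        (subst₂ _<_ (trans (cong (w′ ∘ pred) (shift-suc p≢j)) (w′-old (s≤s z≤n) (≤-trans (n≤1+n _) u))) (w′-old l u) rise)
        (trans (sym (w′-old l u)) (trans flat (trans (cong w′ (sym (shift-suc i≢j))) (w′-old (s≤s z≤n) i<L))))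
      , i≢j , p≢j
      where
      i<L : i < L
      i<L = shift-bound⁻ j≤L (subst (_≤ 2 + L) (sym (shift-suc i≢j)) s<L)

  plateau-old⁺ : ∀ {i} → Plateau w L i → i ≢ j → pred i ≢ j → Plateau w′ (2 + L) (shift j i)
  plateau-old⁺ {suc i₀} (plateau 2≤i i<L rise flat) i≢j p≢j = plateau
    (≤-trans 2≤i (i≤shift j (suc i₀)))
    (subst (_≤ 2 + L) (shift-suc i≢j) (shift-bound⁺ {j} i<L))
    (subst₂ _<_ (sym (trans (cong (w′ ∘ pred) (shift-suc p≢j)) (w′-old (s≤s⁻¹ 2≤i) (≤-trans (n≤1+n _) (<⇒≤ i<L))))) (sym (w′-old (s≤s z≤n) (<⇒≤ i<L))) rise)
    (trans (w′-old (s≤s z≤n) (<⇒≤ i<L)) (trans flat (sym (trans (cong w′ (sym (shift-suc i≢j))) (w′-old (s≤s z≤n) i<L)))))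

  -- A plateau at the second new letter would need m + 1 as the following old letter. At the first
  -- new letter, position j + 1, the bound 2 ≤ i gives the claim.
  plateau-new⁻ : ∀ {i} → Plateau w′ (2 + L) i → w′ i ≡ suc m → 1 ≤ j
  plateau-new⁻ (plateau 2≤i i<L rise flat) e with pos (≤-trans (n≤1+n _) 2≤i) (<⇒≤ i<L)
  ... | old l u = ⊥-elim (<⇒≢ (w<M l u) (trans (sym (w′-old l u)) e))
  ... | new₁ = s≤s⁻¹ 2≤i
  ... | new₂ = ⊥-elim (<⇒≢ (w<M (s≤s z≤n) j<L) (trans (sym (w′-old (s≤s z≤n) j<L)) (trans (cong w′ (shift-> {suc j} ≤-refl)) (trans (sym flat) w′-new₂))))
    where j<L = s≤s⁻¹ (s≤s⁻¹ i<L)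

  plateau-new⁺ : 1 ≤ j → Plateau w′ (2 + L) (suc j)
  plateau-new⁺ 1≤j = plateau (s≤s 1≤j) (s≤s (s≤s j≤L))
    (subst₂ _<_ (trans (sym (w′-old 1≤j j≤L)) (cong w′ (shift-≤ {j} ≤-refl))) (sym w′-new₁) (w<M 1≤j j≤L))
    (trans w′-new₁ (sym w′-new₂))

  -- The new letters exceed every old value: they neither repeat `v` nor fall below it.
  rlMin-old⁺ : ∀ {v} → RlMin w L v → RlMin w′ (2 + L) v
  rlMin-old⁺ (rlMin {i} l u e f g) = rlMin (1≤shift {j} l) (shift-bound⁺ u) (trans (w′-old l u) e) (first-old⁺ l u f) g′
    where
    g′ : ∀ {k} → shift j i < k → k ≤ 2 + L → w′ (shift j i) ≤ w′ k
    g′ p q with pos (≤-trans (s≤s z≤n) p) q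
    ... | old lk uk = subst₂ _≤_ (sym (w′-old l u)) (sym (w′-old lk uk)) (g (shift-cancel-< j p) uk)
    ... | new₁ = subst₂ _≤_ (sym (w′-old l u)) (sym w′-new₁) (<⇒≤ (w<M l u))
    ... | new₂ = subst₂ _≤_ (sym (w′-old l u)) (sym w′-new₂) (<⇒≤ (w<M l u))

  rlMin-old⁻ : ∀ {v} → v ≤ m → RlMin w′ (2 + L) v → RlMin w L v
  rlMin-old⁻ v≤m (rlMin l u e f g) with pos l u
  ... | old lk uk = rlMin lk uk (trans (sym (w′-old lk uk)) e) (first-old⁻ lk uk f)
      λ p q → subst₂ _≤_ (w′-old lk uk) (w′-old (≤-trans lk (<⇒≤ p)) q) (g (shift-mono-< j p) (shift-bound⁺ q))
  ... | new₁ = ⊥-elim (<⇒≢ (s≤s v≤m) (trans (sym e) w′-new₁))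
  ... | new₂ = ⊥-elim (<⇒≢ (s≤s v≤m) (trans (sym e) w′-new₂))

  -- If j < L, the last letter of the new word is an old one; it lies to the right of m + 1 and is
  -- smaller.
  rlMin-new⁻ : RlMin w′ (2 + L) (suc m) → j ≡ L
  rlMin-new⁻ (rlMin {k} l u e f g) with m≤n⇒m<n∨m≡n j≤L
  ... | inj₂ j≡L = j≡L
  ... | inj₁ j<L = ⊥-elim (<⇒≱ (w<M 1≤L ≤-refl) (subst₂ _≤_ e (trans (cong w′ (sym (shift-> j<L))) (w′-old 1≤L ≤-refl)) (g (k<end (pos l u) e) ≤-refl)))
    where
    k<end : ∀ {k} → Position j L k → w′ k ≡ suc m → k < 2 + L
    k<end (old lk uk) e = ⊥-elim (<⇒≢ (w<M lk uk) (trans (sym (w′-old lk uk)) e))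
    k<end new₁ _ = s≤s (s≤s j≤L)
    k<end new₂ _ = s≤s (s≤s j<L)

  rlMin-new⁺ : j ≡ L → RlMin w′ (2 + L) (suc m)
  rlMin-new⁺ refl = rlMin (s≤s z≤n) (n≤1+n _) w′-new₁ first-new₁ λ p q → ≤-reflexive
    (trans w′-new₁ (trans (sym w′-new₂) (cong w′ (≤-antisym p q))))

  -- A pair put inside the block or directly behind it prolongs the block: the position where the
  -- next block should start then holds a new letter. For i = j this is the second new letter, never
  -- a minimum; for i + 1 = j it is the first one, a minimum only if j = 0.
  block2-old⁻ : ∀ {i} → 1 ≤ i → i ≤ L → Block2 w′ (2 + L) (shift j i) → Block2 w L i × i ≢ j × suc i ≢ j
  block2-old⁻ {i} l u (block2 start s<L inner stop) =
    block2 (lrMin-old⁻ l u start) i<L (λ b → inner (subst (LrMin w′) (shift-suc i≢j) (lrMin-old⁺ (s≤s z≤n) i<L b))) (stop⁻ stop) , i≢j , si≢j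
    where
    i≢j : i ≢ j
    i≢j refl = absurd stop
      where
      absurd : ¬ (suc (shift j i) ≡ 2 + L ⊎ LrMin w′ (2 + shift j i))
      absurd (inj₁ e) = <⇒≢ (s≤s (s≤s u)) (trans (cong suc (sym (shift-≤ {i} ≤-refl))) e)
      absurd (inj₂ b) = ¬lrMin-new₂ (subst (LrMin w′) (cong (2 +_) (shift-≤ {i} ≤-refl)) b)
    si≢j : suc i ≢ j
    si≢j refl = absurd stop
      where
      absurd : ¬ (suc (shift j i) ≡ 2 + L ⊎ LrMin w′ (2 + shift j i))
      absurd (inj₁ e) = <⇒≢ (s≤s (m≤n⇒m≤1+n j≤L)) (trans (cong suc (sym (shift-≤ {i} (n≤1+n i)))) e)
      absurd (inj₂ b) = 1+n≢0 (lrMin-new₁ (subst (LrMin w′) (cong (2 +_) (shift-≤ {i} (n≤1+n i))) b))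
    i<L : i < L
    i<L = shift-bound⁻ j≤L (subst (_≤ 2 + L) (sym (shift-suc i≢j)) s<L)
    stop⁻ : suc (shift j i) ≡ 2 + L ⊎ LrMin w′ (2 + shift j i) → suc i ≡ L ⊎ LrMin w (2 + i)
    stop⁻ (inj₁ e) =
      inj₁ (≤-antisym i<L (≮⇒≥ λ p → <⇒≢ (≤-<-trans (shift≤2+ j (suc i)) (s≤s (s≤s p))) (trans (shift-suc i≢j) e)))
    stop⁻ (inj₂ b) with m≤n⇒m<n∨m≡n i<L
    ... | inj₂ e = inj₁ e
    ... | inj₁ p = inj₂ (lrMin-old⁻ (s≤s z≤n) p (subst (LrMin w′) (sym (trans (shift-suc si≢j) (cong suc (shift-suc i≢j)))) b))

  block2-old⁺ : ∀ {i} → 1 ≤ i → Block2 w L i → i ≢ j → suc i ≢ j → Block2 w′ (2 + L) (shift j i)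
  block2-old⁺ {i} l (block2 start i<L inner stop) i≢j si≢j = block2
    (lrMin-old⁺ l (<⇒≤ i<L) start)
    (subst (_≤ 2 + L) (shift-suc i≢j) (shift-bound⁺ {j} i<L))
    (λ b → inner (lrMin-old⁻ (s≤s z≤n) i<L (subst (LrMin w′) (sym (shift-suc i≢j)) b)))
    (stop⁺ stop)
    where
    stop⁺ : suc i ≡ L ⊎ LrMin w (2 + i) → suc (shift j i) ≡ 2 + L ⊎ LrMin w′ (2 + shift j i)
    stop⁺ (inj₁ refl) = inj₁ (trans (sym (shift-suc i≢j)) (shift-> (≤∧≢⇒< j≤L (si≢j ∘ sym))))
    stop⁺ (inj₂ b) with m≤n⇒m<n∨m≡n i<L
    ... | inj₂ refl = inj₁ (trans (sym (shift-suc i≢j)) (shift-> (≤∧≢⇒< j≤L (si≢j ∘ sym))))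
    ... | inj₁ p = inj₂ (subst (LrMin w′) (trans (shift-suc si≢j) (cong suc (shift-suc i≢j))) (lrMin-old⁺ (s≤s z≤n) p b))

  block2-new₁⁻ : Block2 w′ (2 + L) (suc j) → j ≡ 0
  block2-new₁⁻ b = lrMin-new₁ (Block2.start b)

  -- The first old letter is smaller than both new ones and starts the next block right behind them.
  block2-new₁⁺ : j ≡ 0 → Block2 w′ (2 + L) (suc j)
  block2-new₁⁺ refl = block2 (λ l u → ⊥-elim (<⇒≱ u l)) (s≤s (s≤s z≤n)) ¬lrMin-new₂
    (inj₂ (lrMin-old⁺ {1} (s≤s z≤n) 1≤L λ l u → ⊥-elim (<⇒≱ u l)))

  ¬block2-new₂ : ¬ Block2 w′ (2 + L) (2 + j)
  ¬block2-new₂ b = ¬lrMin-new₂ (Block2.start b)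

-- Stirling words by positions, and membership in `Q`

words≡wordsOver : ∀ m ℓ → words m ℓ ≡ wordsOver (range 1 m) ℓ
words≡wordsOver m zero    = refl
words≡wordsOver m (suc ℓ) = trans
  (cong (λ ws → concatMap (λ a → map (a ∷_) ws) (range 1 m)) (words≡wordsOver m ℓ))
  (concatMap≡cartesianProductWith _∷_ (range 1 m) (wordsOver (range 1 m) ℓ))

record StirlingWord (m L : ℕ) (w : ℕ → ℕ) : Set where
  field
    rng  : ∀ {i} → 1 ≤ i → i ≤ L → 1 ≤ w i × w i ≤ m
    one  : count L (λ i → w i ≡ᵇ 1) ≡ 1
    two  : ∀ {v} → 2 ≤ v → v ≤ m → count L (λ i → w i ≡ᵇ v) ≡ 2
    nest : ∀ {i j k} → 1 ≤ i → i ≤ j → j ≤ k → k ≤ L → w i ≡ w k → w i ≤ w j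

  count≤2 : ∀ {v} → 1 ≤ v → v ≤ m → count L (λ i → w i ≡ᵇ v) ≤ 2
  count≤2 {suc zero}    _ _ = ≤-trans (≤-reflexive one) (s≤s z≤n)
  count≤2 {suc (suc v)} _ u = ≤-reflexive (two (s≤s (s≤s z≤n)) u)

  no-three : ∀ {a b c} → 1 ≤ a → a < b → b < c → c ≤ L → w a ≡ w b → w a ≡ w c → ⊥
  no-three {a} l a<b b<c u e e′ =
    let b≤L = ≤-trans (<⇒≤ b<c) u ; a≤L = ≤-trans (<⇒≤ a<b) b≤L ; 1≤b = ≤-trans l (<⇒≤ a<b)
        lv , uv = rng l a≤L in
    <⇒≱ (s≤s (count≤2 lv uv)) (count-≥3 L {λ i → w i ≡ᵇ w a} l a≤L 1≤b b≤L (≤-trans 1≤b (<⇒≤ b<c)) u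
      (<⇒≢ a<b) (<⇒≢ (<-trans a<b b<c)) (<⇒≢ b<c) (≡ᵇ-intro {w a} refl) (≡ᵇ-intro (sym e)) (≡ᵇ-intro (sym e′)))

StirlingWord-cong : ∀ {m L w w′} → (∀ {i} → 1 ≤ i → i ≤ L → w′ i ≡ w i) → StirlingWord m L w → StirlingWord m L w′
StirlingWord-cong {m} {L} {w} {w′} e S = record
  { rng  = λ l u → subst (λ a → 1 ≤ a × a ≤ m) (sym (e l u)) (rng l u)
  ; one  = trans (count-cong L λ l u → cong (_≡ᵇ 1) (e l u)) one
  ; two  = λ {v} a b → trans (count-cong L λ l u → cong (_≡ᵇ v) (e l u)) (two a b)
  ; nest = λ l p q u eq → let i≤L = ≤-trans p (≤-trans q u) in
      subst₂ _≤_ (sym (e l i≤L)) (sym (e (≤-trans l p) (≤-trans q u)))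
        (nest l p q u (trans (sym (e l i≤L)) (trans eq (e (≤-trans l (≤-trans p q)) u))))
  }
  where open StirlingWord S

∈-Q⁻ : ∀ {m σ} → σ ∈ Q m → length σ ≡ 2 ℕ.* m ∸ 1 × StirlingWord m (length σ) (at σ)
∈-Q⁻ {m} {σ} σ∈
  with σ∈words , t ← ∈-filter⁻ (T? ∘ isStirling m) {xs = words m (2 ℕ.* m ∸ 1)} σ∈
  with t , d ← ∧-elim {isMultiset m σ} t
  with a , t ← ∧-elim {allB (λ a → (1 ≤ᵇ a) ∧ (a ≤ᵇ m)) σ} t
  with b , c ← ∧-elim {occ 1 σ ≡ᵇ 1} t
  = proj₁ (∈-wordsOver⁻ (2 ℕ.* m ∸ 1) (subst (σ ∈_) (words≡wordsOver m (2 ℕ.* m ∸ 1)) σ∈words)) , record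
  { rng  = λ {i} l u → let p , q = ∧-elim {1 ≤ᵇ at σ i} (allB-elim {P = λ a → (1 ≤ᵇ a) ∧ (a ≤ᵇ m)} {σ} a (‼-∈ {σ} {i} l u)) in
           ≤ᵇ-elim {1} p , ≤ᵇ-elim {at σ i} q
  ; one  = trans (sym (countB-‼ (_≡ᵇ 1) σ)) (≡ᵇ-elim b)
  ; two  = λ {v} l u → trans (sym (countB-‼ (_≡ᵇ v) σ)) (≡ᵇ-elim (allR-elim {2} {m} {λ k → occ k σ ≡ᵇ 2} c l u))
  ; nest = λ {i} {j} {k} l p q u e → ≤ᵇ-elim {at σ i} (allR-elim {i} {k} {λ j → at σ i ≤ᵇ at σ j}
      (⇒-elim {at σ i ≡ᵇ at σ k} (allR-elim {i} {length σ} {λ k → (at σ i ≡ᵇ at σ k) ⇒ᵇ allR i k (λ j → at σ i ≤ᵇ at σ j)}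
        (allR-elim {1} {length σ} {λ i → allR i (length σ) λ k → (at σ i ≡ᵇ at σ k) ⇒ᵇ allR i k (λ j → at σ i ≤ᵇ at σ j)} d l (≤-trans p (≤-trans q u)))
        (≤-trans p q) u) (≡ᵇ-intro e)) p q)
  }

∈-Q⁺ : ∀ {m σ} → length σ ≡ 2 ℕ.* m ∸ 1 → StirlingWord m (length σ) (at σ) → σ ∈ Q m
∈-Q⁺ {m} {σ} len S = ∈-filter⁺ (T? ∘ isStirling m)
  (subst (σ ∈_) (sym (words≡wordsOver m (2 ℕ.* m ∸ 1))) (∈-wordsOver⁺ (2 ℕ.* m ∸ 1) len λ a∈ → let l , u = rng′ a∈ in ∈-range⁺ l u))
  (∧-intro {isMultiset m σ}
    (∧-intro {allB (λ a → (1 ≤ᵇ a) ∧ (a ≤ᵇ m)) σ}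
      (allB-intro {P = λ a → (1 ≤ᵇ a) ∧ (a ≤ᵇ m)} λ {a} a∈ → let l , u = rng′ a∈ in ∧-intro {1 ≤ᵇ a} (≤⇒≤ᵇ l) (≤⇒≤ᵇ u))
      (∧-intro {occ 1 σ ≡ᵇ 1} (≡ᵇ-intro (trans (countB-‼ (_≡ᵇ 1) σ) one))
        (allR-intro {2} {m} {λ k → occ k σ ≡ᵇ 2} λ {v} l u → ≡ᵇ-intro (trans (countB-‼ (_≡ᵇ v) σ) (two l u)))))
    (allR-intro {1} {length σ} {λ i → allR i (length σ) λ k → (at σ i ≡ᵇ at σ k) ⇒ᵇ allR i k (λ j → at σ i ≤ᵇ at σ j)} λ {i} l u →
     allR-intro {i} {length σ} {λ k → (at σ i ≡ᵇ at σ k) ⇒ᵇ allR i k (λ j → at σ i ≤ᵇ at σ j)} λ {k} l′ u′ →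
     ⇒-intro {at σ i ≡ᵇ at σ k} λ e → allR-intro {i} {k} {λ j → at σ i ≤ᵇ at σ j} λ p q → ≤⇒≤ᵇ (nest l p q u′ (≡ᵇ-elim e))))
  where
  open StirlingWord S
  rng′ : ∀ {a} → a ∈ σ → 1 ≤ a × a ≤ m
  rng′ a∈ with k , l , u , refl ← ∈-‼ a∈ = rng l u

Q-unique : ∀ m → Unique (Q m)
Q-unique m = Uniq.filter⁺ (T? ∘ isStirling m)
  (subst Unique (sym (words≡wordsOver m (2 ℕ.* m ∸ 1))) (wordsOver-unique (range-unique 1 m) (2 ℕ.* m ∸ 1)))

-- Inserting and deleting the pair of largest letters

insertPair : ℕ → ℕ → List ℕ → List ℕ
insertPair zero    M σ       = M ∷ M ∷ σ
insertPair (suc j) M []      = M ∷ M ∷ []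
insertPair (suc j) M (x ∷ σ) = x ∷ insertPair j M σ

length-insertPair : ∀ j M σ → length (insertPair j M σ) ≡ 2 + length σ
length-insertPair zero    M σ       = refl
length-insertPair (suc j) M []      = refl
length-insertPair (suc j) M (x ∷ σ) = cong suc (length-insertPair j M σ)

at-insertPair-≤ : ∀ {j} M σ {k} → j ≤ length σ → 1 ≤ k → k ≤ j → at (insertPair j M σ) k ≡ at σ k
at-insertPair-≤ {suc j} M (x ∷ σ) {suc zero}    p l u = refl
at-insertPair-≤ {suc j} M (x ∷ σ) {suc (suc k)} (s≤s p) l (s≤s u) = at-insertPair-≤ M σ p (s≤s z≤n) u

at-insertPair-> : ∀ {j} M σ {k} → j ≤ length σ → j < k → at (insertPair j M σ) (2 + k) ≡ at σ k
at-insertPair-> {zero}  M σ {suc k} p u = refl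
at-insertPair-> {suc j} M (x ∷ σ) {suc (suc k)} (s≤s p) (s≤s u) = at-insertPair-> M σ p u

at-insertPair-new₁ : ∀ {j} M σ → j ≤ length σ → at (insertPair j M σ) (suc j) ≡ M
at-insertPair-new₁ {zero}  M σ p = refl
at-insertPair-new₁ {suc j} M (x ∷ σ) (s≤s p) = at-insertPair-new₁ M σ p

at-insertPair-new₂ : ∀ {j} M σ → j ≤ length σ → at (insertPair j M σ) (2 + j) ≡ M
at-insertPair-new₂ {zero}  M σ p = refl
at-insertPair-new₂ {suc j} M (x ∷ σ) (s≤s p) = at-insertPair-new₂ M σ p

at-insertPair-shift : ∀ {j} M σ {k} → j ≤ length σ → 1 ≤ k → at (insertPair j M σ) (shift j k) ≡ at σ k
at-insertPair-shift {j} M σ {k} p l with k ≤? j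
... | yes k≤j = trans (cong (at (insertPair j M σ)) (shift-≤ k≤j)) (at-insertPair-≤ M σ p l k≤j)
... | no k≰j  = trans (cong (at (insertPair j M σ)) (shift-> (≰⇒> k≰j))) (at-insertPair-> M σ p (≰⇒> k≰j))

restrict-all : ∀ {m σ} → (∀ {a} → a ∈ σ → a ≤ m) → restrict m σ ≡ σ
restrict-all {m} f = filter-all (T? ∘ (_≤ᵇ m)) (All.tabulate (≤⇒≤ᵇ ∘ f))

restrict-accept : ∀ {m x} τ → x ≤ m → restrict m (x ∷ τ) ≡ x ∷ restrict m τ
restrict-accept {m} {x} τ u = filter-accept (T? ∘ (_≤ᵇ m)) {x} {τ} (≤⇒≤ᵇ u)

restrict-reject : ∀ {m x} τ → ¬ x ≤ m → restrict m (x ∷ τ) ≡ restrict m τ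
restrict-reject {m} {x} τ u = filter-reject (T? ∘ (_≤ᵇ m)) {x} {τ} (u ∘ ≤ᵇ-elim {x})

-- The new letters are the only ones above `m`, so restriction undoes the insertion. This recovers
-- the parent of a word, and it identifies the earlier restrictions in the definition of traces.
restrict-insertPair : ∀ j {m σ} → (∀ {a} → a ∈ σ → a ≤ m) → restrict m (insertPair j (suc m) σ) ≡ σ
restrict-insertPair zero {m} {σ} f =
  trans (restrict-reject {m} (suc m ∷ σ) (<-irrefl refl))
  (trans (restrict-reject {m} σ (<-irrefl refl)) (restrict-all f))
restrict-insertPair (suc j) {m} {[]} f = restrict-insertPair zero {m} {[]} f
restrict-insertPair (suc j) {m} {x ∷ σ} f = trans (restrict-accept (insertPair j (suc m) σ) (f (here refl)))
  (cong (x ∷_) (restrict-insertPair j (f ∘ there)))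

letters≤ : ∀ {m σ} → StirlingWord m (length σ) (at σ) → ∀ {a} → a ∈ σ → a ≤ m
letters≤ S a∈ with k , l , u , refl ← ∈-‼ a∈ = proj₂ (StirlingWord.rng S l u)

insertion : ∀ {m L j w w′} → 1 ≤ L → j ≤ L → StirlingWord m L w →
            (∀ {i} → 1 ≤ i → i ≤ L → w′ (shift j i) ≡ w i) → w′ (suc j) ≡ suc m → w′ (2 + j) ≡ suc m →
            Insertion m L j w w′
insertion 1≤L j≤L S a b c =
  record { 1≤L = 1≤L ; j≤L = j≤L ; rng = StirlingWord.rng S ; w′-old = a ; w′-new₁ = b ; w′-new₂ = c }

insertPair-insertion : ∀ {m σ j} → 1 ≤ length σ → j ≤ length σ → StirlingWord m (length σ) (at σ) →
                       Insertion m (length σ) j (at σ) (at (insertPair j (suc m) σ))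
insertPair-insertion {m} {σ} 1≤L j≤L S = insertion 1≤L j≤L S
  (λ l _ → at-insertPair-shift (suc m) σ j≤L l) (at-insertPair-new₁ (suc m) σ j≤L) (at-insertPair-new₂ (suc m) σ j≤L)

-- The positions of the longer word are j + 1, j + 2 and the images under `shift j` of the old ones.
count-shift : ∀ L {j} P → j ≤ L → count (2 + L) P ≡ (ind (P (suc j)) + ind (P (2 + j))) + count L (P ∘ shift j)
count-shift L {j} P j≤L with m≤n⇒m<n∨m≡n j≤L
... | inj₂ refl = begin
  ind (P (2 + j)) + (ind (P (suc j)) + count j P)  ≡⟨ +-assoc (ind (P (2 + j))) _ _ ⟨
  (ind (P (2 + j)) + ind (P (suc j))) + count j P  ≡⟨ cong₂ _+_ (+-comm (ind (P (2 + j))) _)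
    (count-cong j λ _ u → cong P (sym (shift-≤ u))) ⟩
  (ind (P (suc j)) + ind (P (2 + j))) + count j (P ∘ shift j) ∎
  where open ≡-Reasoning
count-shift (suc L) {j} P j≤L | inj₁ j<L = begin
  ind (P (3 + L)) + count (2 + L) P
    ≡⟨ cong₂ _+_ (cong (ind ∘ P) (sym (shift-> j<L))) (count-shift L P (s≤s⁻¹ j<L)) ⟩
  ind (P (shift j (suc L))) + ((ind (P (suc j)) + ind (P (2 + j))) + count L (P ∘ shift j))
    ≡⟨ +-assoc (ind (P (shift j (suc L)))) _ _ ⟨
  (ind (P (shift j (suc L))) + (ind (P (suc j)) + ind (P (2 + j)))) + count L (P ∘ shift j)
    ≡⟨ cong (_+ count L (P ∘ shift j)) (+-comm (ind (P (shift j (suc L)))) _) ⟩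
  ((ind (P (suc j)) + ind (P (2 + j))) + ind (P (shift j (suc L)))) + count L (P ∘ shift j)
    ≡⟨ +-assoc (ind (P (suc j)) + ind (P (2 + j))) _ _ ⟩
  (ind (P (suc j)) + ind (P (2 + j))) + count (suc L) (P ∘ shift j) ∎
  where open ≡-Reasoning

between : ∀ {j x} → suc j ≤ x → x ≤ 2 + j → x ≡ suc j ⊎ x ≡ 2 + j
between l u with m≤n⇒m<n∨m≡n l
... | inj₁ p = inj₂ (≤-antisym u p)
... | inj₂ e = inj₁ (sym e)

insertion-StirlingWord : ∀ {m L j w w′} → Insertion m L j w w′ → StirlingWord m L w → StirlingWord (suc m) (2 + L) w′
insertion-StirlingWord {m} {L} {j} {w} {w′} I S = record { rng = rng′ ; one = one′ ; two = two′ ; nest = nest′ }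
  where
  open Insertion I
  open StirlingWord S using (one; two; nest)
  rng′ : ∀ {i} → 1 ≤ i → i ≤ 2 + L → 1 ≤ w′ i × w′ i ≤ suc m
  rng′ l u with pos l u
  ... | old lk uk = let a , b = rng lk uk in subst (λ a → 1 ≤ a × a ≤ suc m) (sym (w′-old lk uk)) (a , m≤n⇒m≤1+n b)
  ... | new₁ = subst (λ a → 1 ≤ a × a ≤ suc m) (sym w′-new₁) (s≤s z≤n , ≤-refl)
  ... | new₂ = subst (λ a → 1 ≤ a × a ≤ suc m) (sym w′-new₂) (s≤s z≤n , ≤-refl)
  1≤m : 1 ≤ m
  1≤m = let a , b = rng (s≤s z≤n) 1≤L in ≤-trans a b
  count-v : ∀ v → count (2 + L) (λ i → w′ i ≡ᵇ v) ≡ (ind (suc m ≡ᵇ v) + ind (suc m ≡ᵇ v)) + count L (λ i → w i ≡ᵇ v)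
  count-v v = trans (count-shift L (λ i → w′ i ≡ᵇ v) j≤L) (cong₂ _+_
    (cong₂ (λ a b → ind (a ≡ᵇ v) + ind (b ≡ᵇ v)) w′-new₁ w′-new₂)
    (count-cong L λ l u → cong (_≡ᵇ v) (w′-old l u)))
  small : ∀ {v} → v ≤ m → count (2 + L) (λ i → w′ i ≡ᵇ v) ≡ count L (λ i → w i ≡ᵇ v)
  small {v} v≤m =
    trans (count-v v)
    (cong (λ z → (z + z) + count L (λ i → w i ≡ᵇ v)) (ind-¬T {suc m ≡ᵇ v} λ t → <⇒≢ (s≤s v≤m) (sym (≡ᵇ-elim t))))
  one′ = trans (small 1≤m) one
  two′ : ∀ {v} → 2 ≤ v → v ≤ suc m → count (2 + L) (λ i → w′ i ≡ᵇ v) ≡ 2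
  two′ {v} l u with m≤n⇒m<n∨m≡n u
  ... | inj₁ p = trans (small (s≤s⁻¹ p)) (two l (s≤s⁻¹ p))
  ... | inj₂ refl = trans (count-v v) (cong₂ (λ a b → (a + a) + b) (ind-T {m ≡ᵇ m} (≡ᵇ-intro {m} refl))
      (sumTo-zero L λ {k} l′ u′ → ind-¬T {w k ≡ᵇ suc m} λ t → <⇒≢ (w<M l′ u′) (≡ᵇ-elim t)))
  new : ∀ {i} → 1 ≤ i → i ≤ 2 + L → w′ i ≡ suc m → i ≡ suc j ⊎ i ≡ 2 + j
  new l u e with pos l u
  ... | new₁ = inj₁ refl
  ... | new₂ = inj₂ refl
  ... | old lk uk = ⊥-elim (<⇒≢ (w<M lk uk) (trans (sym (w′-old lk uk)) e))
  new-bounds : ∀ {i} → i ≡ suc j ⊎ i ≡ 2 + j → suc j ≤ i × i ≤ 2 + j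
  new-bounds (inj₁ refl) = ≤-refl , n≤1+n _
  new-bounds (inj₂ refl) = n≤1+n _ , ≤-refl
  w′-between : ∀ {x} → x ≡ suc j ⊎ x ≡ 2 + j → w′ x ≡ suc m
  w′-between (inj₁ refl) = w′-new₁
  w′-between (inj₂ refl) = w′-new₂
  -- Two equal letters m + 1 enclose only themselves. Any other equal pair is old; between its
  -- members stand old letters, handled by `nest`, or new ones, which are larger.
  nest′ : ∀ {i x k} → 1 ≤ i → i ≤ x → x ≤ k → k ≤ 2 + L → w′ i ≡ w′ k → w′ i ≤ w′ x
  nest′ {i} {x} {k} l p q u e with w′ i ≟ suc m
  ... | yes M = ≤-reflexive (trans M (sym (w′-between (between
          (≤-trans (proj₁ (new-bounds (new l (≤-trans p (≤-trans q u)) M))) p)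
          (≤-trans q (proj₂ (new-bounds (new (≤-trans l (≤-trans p q)) u (trans (sym e) M)))))))))
  ... | no ≢M with pos l (≤-trans p (≤-trans q u)) | pos (≤-trans l p) (≤-trans q u) | pos (≤-trans l (≤-trans p q)) u
  ... | new₁ | _ | _ = ⊥-elim (≢M w′-new₁)
  ... | new₂ | _ | _ = ⊥-elim (≢M w′-new₂)
  ... | old _ _ | _ | new₁ = ⊥-elim (≢M (trans e w′-new₁))
  ... | old _ _ | _ | new₂ = ⊥-elim (≢M (trans e w′-new₂))
  ... | old li ui | new₁ | old _ _ = subst₂ _≤_ (sym (w′-old li ui)) (sym w′-new₁) (<⇒≤ (w<M li ui))
  ... | old li ui | new₂ | old _ _ = subst₂ _≤_ (sym (w′-old li ui)) (sym w′-new₂) (<⇒≤ (w<M li ui))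
  ... | old {a} li ui | old {b} lx ux | old {c} lk uk = subst₂ _≤_ (sym (w′-old li ui)) (sym (w′-old lx ux))
        (nest li (≮⇒≥ λ b<a → <⇒≱ (shift-mono-< j b<a) p) (≮⇒≥ λ c<b → <⇒≱ (shift-mono-< j c<b) q) uk
          (trans (sym (w′-old li ui)) (trans e (w′-old lk uk))))

-- Nesting forces each letter between the two occurrences of the largest value m + 1 to be m + 1 as
-- well. A third occurrence is impossible, so the two are adjacent and can be removed together.
deletePair : ∀ {m L w′} → 1 ≤ m → StirlingWord (suc m) (2 + L) w′ →
             ∃ λ j → j ≤ L × w′ (suc j) ≡ suc m × w′ (2 + j) ≡ suc m × StirlingWord m L (w′ ∘ shift j)
deletePair {m} {L} {w′} 1≤m S with count-witness₂ (2 + L) (≤-reflexive (sym (StirlingWord.two S (s≤s 1≤m) ≤-refl)))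
... | suc j , b , la , a<b , ub , ta , tb = j , j≤L , wa , wb , record
    { rng = rng′ ; one = trans (sym (small 1≤m)) one ; two = λ l u → trans (sym (small u)) (two l (m≤n⇒m≤1+n u))
    ; nest = λ l p q u e → nest (1≤shift l) (shift-mono-≤ j p) (shift-mono-≤ j q) (shift-bound⁺ u) e }
  where
  open StirlingWord S
  wa = ≡ᵇ-elim {w′ (suc j)} ta
  b≡ : b ≡ 2 + j
  b≡ with m≤n⇒m<n∨m≡n a<b
  ... | inj₂ e = sym e
  ... | inj₁ p = ⊥-elim (no-three la ≤-refl p ub
    (≤-antisym (nest la (n≤1+n _) (<⇒≤ p) ub eq) (≤-trans (proj₂ (rng (s≤s z≤n) (≤-trans (<⇒≤ p) ub))) (≤-reflexive (sym wa)))) eq)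
    where eq = trans wa (sym (≡ᵇ-elim {w′ b} tb))
  wb = trans (cong w′ (sym b≡)) (≡ᵇ-elim {w′ b} tb)
  j≤L : j ≤ L
  j≤L = s≤s⁻¹ (s≤s⁻¹ (subst (_≤ 2 + L) b≡ ub))
  -- An old position with value m + 1 would be a third occurrence, either before or behind the pair.
  ≢M : ∀ {i} → 1 ≤ i → i ≤ L → w′ (shift j i) ≢ suc m
  ≢M {i} l u e with i ≤? j
  ... | yes i≤j = no-three (1≤shift {j} l) (s≤s (≤-trans (≤-reflexive (shift-≤ i≤j)) i≤j)) ≤-refl (s≤s (s≤s j≤L)) (trans e (sym wa)) (trans e (sym wb))
  ... | no i≰j  = no-three (s≤s z≤n) ≤-refl (subst (2 + j <_) (sym (shift-> (≰⇒> i≰j))) (s≤s (s≤s (≰⇒> i≰j)))) (shift-bound⁺ u) (trans wa (sym wb)) (trans wa (sym e))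
  rng′ : ∀ {i} → 1 ≤ i → i ≤ L → 1 ≤ w′ (shift j i) × w′ (shift j i) ≤ m
  rng′ l u = let a , b = rng (1≤shift {j} l) (shift-bound⁺ u) in a , s≤s⁻¹ (≤∧≢⇒< b (≢M l u))
  small : ∀ {v} → v ≤ m → count (2 + L) (λ i → w′ i ≡ᵇ v) ≡ count L (λ i → w′ (shift j i) ≡ᵇ v)
  small {v} v≤m = trans (count-shift L (λ i → w′ i ≡ᵇ v) j≤L)
    (cong₂ (λ a b → (a + b) + count L (λ i → w′ (shift j i) ≡ᵇ v)) (z wa) (z wb))
    where
    z : ∀ {i} → w′ i ≡ suc m → ind (w′ i ≡ᵇ v) ≡ 0
    z {i} e = ind-¬T {w′ i ≡ᵇ v} λ t → <⇒≢ (s≤s v≤m) (trans (sym (≡ᵇ-elim t)) e)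

-- Parity

evenᵇ-double : ∀ k → evenᵇ (k + k) ≡ true
evenᵇ-double zero    = refl
evenᵇ-double (suc k) rewrite +-suc k k = evenᵇ-double k

evenᵇ-suc-double : ∀ k → evenᵇ (suc (k + k)) ≡ false
evenᵇ-suc-double zero    = refl
evenᵇ-suc-double (suc k) rewrite +-suc k k = evenᵇ-suc-double k

double-injective : ∀ {k h} → k + k ≡ h + h → k ≡ h
double-injective {k} {h} e = trans (n≡⌊n+n/2⌋ k) (trans (cong ⌊_/2⌋ e) (sym (n≡⌊n+n/2⌋ h)))

double≢suc-double : ∀ k h → k + k ≢ suc (h + h)
double≢suc-double k h e with () ← trans (sym (evenᵇ-double k)) (trans (cong evenᵇ e) (evenᵇ-suc-double h))

halve : ∀ j → ∃ λ h → j ≡ h + h ⊎ j ≡ suc (h + h)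
halve zero = zero , inj₁ refl
halve (suc j) with halve j
... | h , inj₁ e = h , inj₂ (cong suc e)
... | h , inj₂ e = suc h , inj₁ (trans (cong suc e) (cong suc (sym (+-suc h h))))

double-cancel-≤ : ∀ {h n} → h + h ≤ suc (n + n) → h ≤ n
double-cancel-≤ {h} {n} p = ≮⇒≥ λ n<h → <⇒≱ (s≤s (≤-reflexive (sym (+-suc n n)))) (≤-trans (+-mono-≤ n<h n<h) p)

pred-double : ∀ k → pred (suc k + suc k) ≡ suc (k + k)
pred-double k = +-suc k k

-- Position 2k (resp. 2k − 1) for 1 ≤ k ≤ n are the inner gaps of a word of length 2n + 1.

evens odds gaps : ℕ → List ℕ
evens n = map (λ k → k + k) (range 1 n)
odds n  = map (λ k → pred (k + k)) (range 1 n)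
gaps n  = 0 ∷ suc (n + n) ∷ evens n ++ odds n

∈-evens⁻ : ∀ {n j} → j ∈ evens n → ∃ λ k → 1 ≤ k × k ≤ n × j ≡ k + k
∈-evens⁻ {n} j∈ with k , k∈ , e ← ∈-map⁻ (λ k → k + k) j∈ = let l , u = ∈-range⁻ {1} {n} k∈ in k , l , u , e

∈-odds⁻ : ∀ {n j} → j ∈ odds n → ∃ λ k → suc k ≤ n × j ≡ suc (k + k)
∈-odds⁻ {n} j∈ with k , k∈ , e ← ∈-map⁻ (λ k → pred (k + k)) j∈ = go k (∈-range⁻ {1} {n} k∈) e
  where
  go : ∀ {j} k → 1 ≤ k × k ≤ n → j ≡ pred (k + k) → ∃ λ k → suc k ≤ n × j ≡ suc (k + k)
  go (suc k) (_ , u) e = k , u , trans e (pred-double k)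

evens-bound : ∀ {n j} → j ∈ evens n → 1 ≤ j × j ≤ n + n
evens-bound {n} j∈ with k , l , u , refl ← ∈-evens⁻ {n} j∈ = ≤-trans l (m≤m+n k k) , +-mono-≤ u u

odds-bound : ∀ {n j} → j ∈ odds n → 1 ≤ j × j ≤ n + n
odds-bound {n} j∈ with k , u , refl ← ∈-odds⁻ {n} j∈ = s≤s z≤n , ≤-trans (≤-trans (n≤1+n _) (≤-reflexive (cong suc (sym (+-suc k k))))) (+-mono-≤ u u)

∈-gaps⁻ : ∀ {n j} → j ∈ gaps n → j ≤ suc (n + n)
∈-gaps⁻ (here refl) = z≤n
∈-gaps⁻ (there (here refl)) = ≤-refl
∈-gaps⁻ {n} (there (there j∈)) with ∈-++⁻ (evens n) j∈
... | inj₁ p = m≤n⇒m≤1+n (proj₂ (evens-bound {n} p))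
... | inj₂ p = m≤n⇒m≤1+n (proj₂ (odds-bound {n} p))

∈-gaps⁺ : ∀ {n j} → j ≤ suc (n + n) → j ∈ gaps n
∈-gaps⁺ {n} {j} u with halve j
... | zero  , inj₁ refl = here refl
... | suc h , inj₁ refl = there (there (∈-++⁺ˡ {ys = odds n} (∈-map⁺ (λ k → k + k) (∈-range⁺ {1} {n} (s≤s z≤n) (double-cancel-≤ u)))))
... | h , inj₂ refl with m≤n⇒m<n∨m≡n (double-cancel-≤ {h} {n} (≤-trans (n≤1+n _) u))
...   | inj₂ refl = there (here refl)
...   | inj₁ p = there (there (∈-++⁺ʳ (evens n) (subst (_∈ odds n) (pred-double h) (∈-map⁺ (λ k → pred (k + k)) (∈-range⁺ (s≤s z≤n) p)))))

gaps-unique : ∀ n → Unique (gaps n)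
gaps-unique n = ((λ ()) ∷ All.tabulate λ j∈ e → <⇒≢ (proj₁ (bound j∈)) e)
  ∷ (All.tabulate λ j∈ e → <⇒≢ (s≤s (proj₂ (bound j∈))) (sym e))
  ∷ Uniq.++⁺ (Uniq.map⁺ {f = λ k → k + k} double-injective (range-unique 1 n)) (map-unique (λ k → pred (k + k)) inj′ (range-unique 1 n)) disj
  where
  bound : ∀ {j} → j ∈ evens n ++ odds n → 1 ≤ j × j ≤ n + n
  bound j∈ with ∈-++⁻ (evens n) j∈
  ... | inj₁ p = evens-bound {n} p
  ... | inj₂ p = odds-bound {n} p
  inj′ : ∀ {k h} → k ∈ range 1 n → h ∈ range 1 n → pred (k + k) ≡ pred (h + h) → k ≡ h
  inj′ {k} {h} k∈ h∈ e with k | h | proj₁ (∈-range⁻ {1} {n} k∈) | proj₁ (∈-range⁻ {1} {n} h∈)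
  ... | suc _ | suc _ | _ | _ = double-injective (cong suc e)
  disj : ∀ {j} → ¬ (j ∈ evens n × j ∈ odds n)
  disj (p , q) with k , _ , _ , refl ← ∈-evens⁻ {n} p with h , _ , e ← ∈-odds⁻ {n} q = double≢suc-double k h e

-- The words of the next size as insertions into gaps

Q-length : ∀ n → 2 ℕ.* suc n ∸ 1 ≡ suc (n + n)
Q-length n = trans (+-suc n (n + 0)) (cong (λ z → suc (n + z)) (+-identityʳ n))

∈-Q-suc⁻ : ∀ {n σ} → σ ∈ Q (suc n) → length σ ≡ suc (n + n) × StirlingWord (suc n) (length σ) (at σ)
∈-Q-suc⁻ {n} σ∈ = let l , S = ∈-Q⁻ σ∈ in trans l (Q-length n) , S

∈-Q-suc⁺ : ∀ {n σ} → length σ ≡ suc (n + n) → StirlingWord (suc n) (length σ) (at σ) → σ ∈ Q (suc n)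
∈-Q-suc⁺ {n} l S = ∈-Q⁺ (trans l (sym (Q-length n))) S

childQ : ℕ → List ℕ → ℕ → List ℕ
childQ n σ j = insertPair j (2 + n) σ

childQ-insertion : ∀ {n σ j} → σ ∈ Q (suc n) → j ≤ suc (n + n) →
                   Insertion (suc n) (length σ) j (at σ) (at (childQ n σ j))
childQ-insertion {n} {σ} σ∈ u = let l , S = ∈-Q-suc⁻ σ∈ in
  insertPair-insertion {suc n} {σ} (≤-trans (s≤s z≤n) (≤-reflexive (sym l))) (≤-trans u (≤-reflexive (sym l))) S

childQ-∈ : ∀ {n σ j} → σ ∈ Q (suc n) → j ≤ suc (n + n) → childQ n σ j ∈ Q (2 + n)
childQ-∈ {n} {σ} {j} σ∈ u = let l , S = ∈-Q-suc⁻ σ∈ in ∈-Q-suc⁺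
  (trans (length-insertPair j (2 + n) σ) (trans (cong (2 +_) l) (cong (2 +_) (sym (+-suc n n)))))
  (subst (λ ℓ → StirlingWord (2 + n) ℓ (at (childQ n σ j))) (sym (length-insertPair j (2 + n) σ))
    (insertion-StirlingWord (childQ-insertion σ∈ u) S))

-- Restriction recovers the parent. The gap is recovered too: if gaps j < k gave the same word, its
-- position j + 1 would hold the new value and an old letter at once. Deleting the largest pair
-- shows that every word arises.
Q-suc : ∀ n → Q (2 + n) ↭ cartesianProductWith (childQ n) (Q (suc n)) (gaps n)
Q-suc n = unique⇒↭ (Q-unique (2 + n))
  (cartesianProductWith-unique (childQ n) inj′ (Q-unique (suc n)) (gaps-unique n)) to from
  where
  no-< : ∀ {σ τ j k} → σ ∈ Q (suc n) → τ ∈ Q (suc n) → j ≤ suc (n + n) → k ≤ suc (n + n) →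
    childQ n σ j ≡ childQ n τ k → ¬ j < k
  no-< {σ} {τ} {j} {k} σ∈ τ∈ uj uk e j<k =
    <⇒≢ (s≤s (proj₂ (StirlingWord.rng (proj₂ (∈-Q-suc⁻ {n} τ∈)) (s≤s z≤n) (≤-trans j<k k≤L))))
      (trans (sym (at-insertPair-≤ (2 + n) τ k≤L (s≤s z≤n) j<k)) (trans (cong (λ ρ → at ρ (suc j)) (sym e)) (Insertion.w′-new₁ (childQ-insertion {n} σ∈ uj))))
    where
    k≤L = Insertion.j≤L (childQ-insertion {n} τ∈ uk)
  inj′ : ∀ {σ τ j k} → σ ∈ Q (suc n) → τ ∈ Q (suc n) → j ∈ gaps n → k ∈ gaps n → childQ n σ j ≡ childQ n τ k →
    σ ≡ τ × j ≡ k
  inj′ {σ} {τ} {j} {k} σ∈ τ∈ j∈ k∈ e =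
      trans (sym (restrict-insertPair j (letters≤ (proj₂ (∈-Q-suc⁻ {n} σ∈)))))
        (trans (cong (restrict (suc n)) e) (restrict-insertPair k (letters≤ (proj₂ (∈-Q-suc⁻ {n} τ∈)))))
    , ≤-antisym (≮⇒≥ (no-< τ∈ σ∈ (∈-gaps⁻ {n} k∈) (∈-gaps⁻ {n} j∈) (sym e))) (≮⇒≥ (no-< σ∈ τ∈ (∈-gaps⁻ {n} j∈) (∈-gaps⁻ {n} k∈) e))
  to : ∀ {σ′} → σ′ ∈ Q (2 + n) → σ′ ∈ cartesianProductWith (childQ n) (Q (suc n)) (gaps n)
  to {σ′} σ′∈ with l , S ← ∈-Q-suc⁻ {suc n} σ′∈
    with l′ ← trans l (cong (2 +_) (+-suc n n))
    with j , j≤L , e₁ , e₂ , S′ ← deletePair {L = suc (n + n)} (s≤s z≤n) (subst (λ ℓ → StirlingWord (2 + n) ℓ (at σ′)) l′ S) =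
    subst (_∈ _) σ′≡ (∈-cartesianProductWith⁺ (childQ n) σ∈ (∈-gaps⁺ {n} j≤L))
    where
    σ = table (suc (n + n)) (at σ′ ∘ shift j)
    lσ : length σ ≡ suc (n + n)
    lσ = length-applyUpTo (at σ′ ∘ shift j ∘ suc) (suc (n + n))
    σ∈ : σ ∈ Q (suc n)
    σ∈ = ∈-Q-suc⁺ lσ
      (subst (λ ℓ → StirlingWord (suc n) ℓ (at σ)) (sym lσ)
        (StirlingWord-cong (‼-table (suc (n + n)) (at σ′ ∘ shift j)) S′))
    lτ : length (childQ n σ j) ≡ 2 + suc (n + n)
    lτ = trans (length-insertPair j (2 + n) σ) (cong (2 +_) lσ)
    open Insertion (childQ-insertion {n} {σ} {j} σ∈ j≤L) using (w′-old; w′-new₁; w′-new₂)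
    eq : ∀ {k} → Position j (suc (n + n)) k → at (childQ n σ j) k ≡ at σ′ k
    eq new₁ = trans w′-new₁ (sym e₁)
    eq new₂ = trans w′-new₂ (sym e₂)
    eq (old lk uk) =
      trans (w′-old lk (≤-trans uk (≤-reflexive (sym lσ)))) (‼-table (suc (n + n)) (at σ′ ∘ shift j) lk uk)
    σ′≡ : childQ n σ j ≡ σ′
    σ′≡ = ‼-ext (trans lτ (sym l′)) λ lk uk → eq (position j≤L lk (≤-trans uk (≤-reflexive lτ)))
  from : ∀ {σ′} → σ′ ∈ cartesianProductWith (childQ n) (Q (suc n)) (gaps n) → σ′ ∈ Q (2 + n)
  from σ′∈ with σ , j , σ∈ , j∈ , refl ← ∈-cartesianProductWith⁻ (childQ n) (Q (suc n)) (gaps n) σ′∈ = childQ-∈ σ∈ (∈-gaps⁻ {n} j∈)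

-- Counting plateaux and blocks by their positions

count-image : ∀ m L {E C : ℕ → Bool} {w : ℕ → ℕ} →
  (∀ {v} → 1 ≤ v → v ≤ m → T (E v) → ∃ λ i → 1 ≤ i × i ≤ L × T (C i) × w i ≡ v) →
  (∀ {i} → 1 ≤ i → i ≤ L → T (C i) → T (E (w i)) × 1 ≤ w i × w i ≤ m) →
  (∀ {i k} → 1 ≤ i → i ≤ L → 1 ≤ k → k ≤ L → T (C i) → T (C k) → w i ≡ w k → i ≡ k) →
  count m E ≡ count L C
count-image m L {E} {C} {w} preimage image inj = begin
  -- Pairs of a position in `C` and its value are counted twice: by injectivity a value in `E` has
  -- exactly one such position, and each position in `C` has one value.
  count m E                                                  ≡⟨ sumTo-cong m fibre ⟨
  sumTo m (λ v → sumTo L (λ i → ind (C i ∧ (w i ≡ᵇ v))))     ≡⟨ sumTo-swap m L _ ⟩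
  sumTo L (λ i → sumTo m (λ v → ind (C i ∧ (w i ≡ᵇ v))))     ≡⟨ sumTo-cong L point ⟩
  count L C                                                  ∎
  where
  open ≡-Reasoning
  hit : ∀ {i v} → T (C i ∧ (w i ≡ᵇ v)) → T (C i) × w i ≡ v
  hit {i} t = let a , b = ∧-elim {C i} t in a , ≡ᵇ-elim b
  fibre : ∀ {v} → 1 ≤ v → v ≤ m → sumTo L (λ i → ind (C i ∧ (w i ≡ᵇ v))) ≡ ind (E v)
  fibre {v} l u with T? (E v)
  ... | yes t = let i , li , ui , c , e = preimage l u t in
    trans (sumTo-single L li ui (ind-T {C i ∧ (w i ≡ᵇ v)} (∧-intro {C i} c (≡ᵇ-intro e)))
      λ {k} lk uk k≢i → ind-¬T {C k ∧ (w k ≡ᵇ v)} λ t′ → let c′ , e′ = hit {k} t′ in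
        k≢i (inj lk uk li ui c′ c (trans e′ (sym e))))
    (sym (ind-T t))
  ... | no ¬t = trans (sumTo-zero L λ {k} lk uk → ind-¬T {C k ∧ (w k ≡ᵇ v)} λ t′ → let c′ , e′ = hit {k} t′ in ¬t (subst (T ∘ E) e′ (proj₁ (image lk uk c′))))
    (sym (ind-¬T ¬t))
  point : ∀ {i} → 1 ≤ i → i ≤ L → sumTo m (λ v → ind (C i ∧ (w i ≡ᵇ v))) ≡ ind (C i)
  point {i} l u with T? (C i)
  ... | yes c = let _ , lw , uw = image l u c in
    trans (sumTo-single m lw uw (ind-T {C i ∧ (w i ≡ᵇ w i)} (∧-intro {C i} c (≡ᵇ-intro {w i} refl)))
      λ {v} _ _ v≢ → ind-¬T {C i ∧ (w i ≡ᵇ v)} λ t → v≢ (sym (proj₂ (hit {i} t))))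
    (sym (ind-T c))
  ... | no ¬c = trans (sumTo-zero m λ {v} _ _ → ind-¬T {C i ∧ (w i ≡ᵇ v)} λ t → ¬c (proj₁ (hit {i} t))) (sym (ind-¬T ¬c))

-- The range of `i` is asked for only if `P i` holds: next to an outer gap of a word, `i` may lie
-- outside the word.
count-drop : ∀ n {P i} → (T (P i) → 1 ≤ i × i ≤ n) → count n P ≡ ind (P i) + count n (λ k → P k ∧ not (k ≡ᵇ i))
count-drop n {P} {i} b with T? (P i)
... | yes t = let l , u = b t in trans (count-remove n {P} l u t) (cong (_+ count n (λ k → P k ∧ not (k ≡ᵇ i))) (sym (ind-T t)))
... | no ¬t = trans (count-cong n λ {k} _ _ → T-ext {P k} (λ p → ∧-intro p (not-intro λ e → ¬t (subst (T ∘ P) (≡ᵇ-elim e) p))) (proj₁ ∘ ∧-elim {P k}))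
                    (cong (_+ count n (λ k → P k ∧ not (k ≡ᵇ i))) (sym (ind-¬T ¬t)))

count-drop₂ : ∀ n {P i k} → (T (P i) → 1 ≤ i × i ≤ n) → (T (P k) → 1 ≤ k × k ≤ n) → (T (P k) → k ≢ i) →
              count n P ≡ (ind (P i) + ind (P k)) + count n (λ x → (P x ∧ not (x ≡ᵇ i)) ∧ not (x ≡ᵇ k))
count-drop₂ n {P} {i} {k} b b′ k≢i = begin
  count n P                                     ≡⟨ count-drop n b ⟩
  ind (P i) + count n P∖i                       ≡⟨ cong (ind (P i) +_)
    (count-drop n {P∖i} {k} (b′ ∘ proj₁ ∘ ∧-elim {P k})) ⟩
  ind (P i) + (ind (P∖i k) + count n _)         ≡⟨ cong
    (λ z → ind (P i) + (ind z + count n (λ x → P∖i x ∧ not (x ≡ᵇ k))))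
    (T-ext {P∖i k} {P k} (proj₁ ∘ ∧-elim {P k}) λ t → ∧-intro {P k} t (not-intro (k≢i t ∘ ≡ᵇ-elim))) ⟩
  ind (P i) + (ind (P k) + count n _)           ≡⟨ +-assoc (ind (P i)) _ _ ⟨
  (ind (P i) + ind (P k)) + count n (λ x → P∖i x ∧ not (x ≡ᵇ k)) ∎
  where
  open ≡-Reasoning
  P∖i = λ x → P x ∧ not (x ≡ᵇ i)

-- The range conditions are part of the test because an outer gap also asks about positions such as
-- 0 and L + 1, where the answer has to be false.
plateauᵇ : List ℕ → ℕ → Bool
plateauᵇ σ i = (2 ≤ᵇ i) ∧ (suc i ≤ᵇ length σ) ∧ (at σ (pred i) <ᵇ at σ i) ∧ (at σ i ≡ᵇ at σ (suc i))

plateauᵇ-elim : ∀ {σ i} → T (plateauᵇ σ i) → Plateau (at σ) (length σ) i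
plateauᵇ-elim {σ} {i} t
  with a , t ← ∧-elim {2 ≤ᵇ i} t
  with b , t ← ∧-elim {suc i ≤ᵇ length σ} t
  with c , d ← ∧-elim {at σ (pred i) <ᵇ at σ i} t
  = plateau (≤ᵇ-elim {2} a) (≤ᵇ-elim {suc i} b) (<ᵇ-elim c) (≡ᵇ-elim d)

plateauᵇ-intro : ∀ {σ i} → Plateau (at σ) (length σ) i → T (plateauᵇ σ i)
plateauᵇ-intro {σ} {i} (plateau a b c d) =
  ∧-intro {2 ≤ᵇ i} (≤⇒≤ᵇ a) (∧-intro {suc i ≤ᵇ length σ} (≤⇒≤ᵇ b) (∧-intro {at σ (pred i) <ᵇ at σ i} (<⇒<ᵇ c) (≡ᵇ-intro d)))

-- With `g` either `inRlmin σ` or its negation, one argument serves improper and proper plateaux.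
plateauWith : (ℕ → Bool) → List ℕ → ℕ → Bool
plateauWith g σ i = plateauᵇ σ i ∧ g (at σ i)

plateau-range : ∀ {w L i} → Plateau w L i → 1 ≤ i × i ≤ L
plateau-range (plateau a b _ _) = ≤-trans (s≤s z≤n) a , <⇒≤ b

-- Plateaux of one value at i < k would show it at the three positions i, i + 1 and k + 1.
plateau-injective : ∀ {m L w i k} → StirlingWord m L w → Plateau w L i → Plateau w L k → w i ≡ w k → i ≡ k
plateau-injective {m} {L} {w} S p q e = ≤-antisym (≮⇒≥ λ k<i → absurd q p (sym e) k<i) (≮⇒≥ λ i<k → absurd p q e i<k)
  where
  absurd : ∀ {i k} → Plateau w L i → Plateau w L k → w i ≡ w k → ¬ i < k
  absurd p q e i<k =
    StirlingWord.no-three S (proj₁ (plateau-range p)) ≤-refl (s≤s i<k) (Plateau.i<L q) (Plateau.flat p)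
    (trans e (Plateau.flat q))

count-inAp : ∀ {m σ} (g : ℕ → Bool) → StirlingWord m (length σ) (at σ) →
             count m (λ v → inAp σ v ∧ g v) ≡ count (length σ) (plateauWith g σ)
count-inAp {m} {σ} g S = count-image m (length σ) {λ v → inAp σ v ∧ g v} {plateauWith g σ} {at σ} preimage image
  λ {i} {k} _ _ _ _ c c′ → plateau-injective S (plateauᵇ-elim {σ} {i} (proj₁ (∧-elim {plateauᵇ σ i} c))) (plateauᵇ-elim {σ} {k} (proj₁ (∧-elim {plateauᵇ σ k} c′)))
  where
  preimage : ∀ {v} → 1 ≤ v → v ≤ m → T (inAp σ v ∧ g v) → ∃ λ i →
    1 ≤ i × i ≤ length σ × T (plateauWith g σ i) × at σ i ≡ v
  preimage {v} _ _ t with a , b ← ∧-elim {inAp σ v} t with i , p , refl ← inAp-elim {σ} a =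
    i , proj₁ (plateau-range p) , proj₂ (plateau-range p) , ∧-intro (plateauᵇ-intro {σ} {i} p) b , refl
  image : ∀ {i} → 1 ≤ i → i ≤ length σ → T (plateauWith g σ i) →
    T (inAp σ (at σ i) ∧ g (at σ i)) × 1 ≤ at σ i × at σ i ≤ m
  image {i} l u t = let a , b = ∧-elim {plateauᵇ σ i} t in
    ∧-intro (inAp-intro {σ} (plateauᵇ-elim {σ} {i} a)) b , StirlingWord.rng S l u

-- Position 0 is excluded explicitly, since the gap 0 asks about blocks at 0 and at `pred 0`, which
-- is 0 again.
blockᵇ : List ℕ → ℕ → Bool
blockᵇ σ i = (1 ≤ᵇ i) ∧ block2At σ i

blockᵇ-elim : ∀ {σ i} → T (blockᵇ σ i) → 1 ≤ i × Block2 (at σ) (length σ) i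
blockᵇ-elim {σ} {i} t = let a , b = ∧-elim {1 ≤ᵇ i} t in ≤ᵇ-elim {1} a , block2At-elim b

blockᵇ-intro : ∀ {σ i} → 1 ≤ i → Block2 (at σ) (length σ) i → T (blockᵇ σ i)
blockᵇ-intro {σ} {i} l b = ∧-intro {1 ≤ᵇ i} (≤⇒≤ᵇ l) (block2At-intro b)

bk₂≡count : ∀ σ → bk₂ σ ≡ count (length σ) (blockᵇ σ)
bk₂≡count σ =
  trans (countR≡count (length σ) (block2At σ))
  (count-cong (length σ) λ {i} l _ → T-ext {block2At σ i} {blockᵇ σ i} (∧-intro {1 ≤ᵇ i} (≤⇒≤ᵇ l))
    (proj₂ ∘ ∧-elim {1 ≤ᵇ i}))

-- The letter 1 occurs only once and starts the last block, so the last block does not have size 2.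
block-not-last : ∀ {m L w i} → StirlingWord m L w → 1 ≤ i → Block2 w L i → suc i < L
block-not-last {m} {L} {w} {i} S 1≤i (block2 start i<L inner stop) = ≤∧≢⇒< i<L absurd
  where
  open StirlingWord S
  absurd : suc i ≢ L
  absurd refl with count-witness L {λ k → w k ≡ᵇ 1} (≤-reflexive (sym one))
  ... | a , la , ua , ta = cases (<-cmp a i)
    where
    wa : w a ≡ 1
    wa = ≡ᵇ-elim ta
    unique : ∀ {b} → 1 ≤ b → b ≤ L → w b ≡ 1 → b ≡ a
    unique {b} l u e with b ≟ a
    ... | yes p = p
    ... | no p  = ⊥-elim (<⇒≱ (count-≥2 L {λ k → w k ≡ᵇ 1} l u la ua p (≡ᵇ-intro e) ta) (≤-reflexive one))
    big : ∀ {b} → 1 ≤ b → b ≤ L → b ≢ a → 1 < w b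
    big l u b≢a = ≤∧≢⇒< (proj₁ (rng l u)) (b≢a ∘ unique l u ∘ sym)
    -- If 1 is the letter before the last, the last letter v exceeds 1 and its other occurrence lies
    -- in front of the 1, so nesting gives v ≤ 1.
    at-i : a ≡ i → ⊥
    at-i refl = go
      (count-witness₂ L {λ k → w k ≡ᵇ v}
        (≤-reflexive (sym (two (big 1≤L ≤-refl (<⇒≢ ≤-refl ∘ sym)) (proj₂ (rng 1≤L ≤-refl))))))
      where
      v = w L
      1≤L : 1 ≤ L
      1≤L = s≤s z≤n
      go : (∃ λ b → ∃ λ c → 1 ≤ b × b < c × c ≤ L × T (w b ≡ᵇ v) × T (w c ≡ᵇ v)) → ⊥
      go (b , c , lb , b<c , uc , tb , _) = <⇒≱ (big 1≤L ≤-refl (<⇒≢ ≤-refl ∘ sym))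
        (subst₂ _≤_ (≡ᵇ-elim {w b} tb) wa (nest lb (s≤s⁻¹ (≤-trans b<c uc)) (n≤1+n _) ≤-refl (≡ᵇ-elim {w b} tb)))
    -- A 1 before i contradicts the minimum at i. A 1 behind i must be the last letter, which is
    -- then a left-to-right minimum inside the block.
    cases : Tri (a < i) (a ≡ i) (i < a) → ⊥
    cases (tri< a<i _ _) = <⇒≱ (start la a<i) (≤-trans (≤-reflexive wa) (proj₁ (rng 1≤i (<⇒≤ i<L))))
    cases (tri≈ _ a≡i _) = at-i a≡i
    cases (tri> _ _ i<a) = inner λ {k} l u → subst (_< w k) (trans (sym wa) (cong w (≤-antisym ua i<a)))
      (big l (<⇒≤ u) (λ e → <⇒≢ (≤-trans u i<a) e))

-- Restrictions and traces

restrict-restrict : ∀ {k m} → k ≤ m → ∀ τ → restrict k (restrict m τ) ≡ restrict k τ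
restrict-restrict k≤m [] = refl
restrict-restrict {k} {m} k≤m (x ∷ τ) with x ≤? k | x ≤? m
... | yes a | yes b = begin
  restrict k (restrict m (x ∷ τ))  ≡⟨ cong (restrict k) (restrict-accept τ b) ⟩
  restrict k (x ∷ restrict m τ)    ≡⟨ restrict-accept (restrict m τ) a ⟩
  x ∷ restrict k (restrict m τ)    ≡⟨ cong (x ∷_) (restrict-restrict k≤m τ) ⟩
  x ∷ restrict k τ                 ≡⟨ restrict-accept τ a ⟨
  restrict k (x ∷ τ)               ∎
  where open ≡-Reasoning
... | yes a | no b = ⊥-elim (b (≤-trans a k≤m))
... | no a | yes b = begin
  restrict k (restrict m (x ∷ τ))  ≡⟨ cong (restrict k) (restrict-accept τ b) ⟩
  restrict k (x ∷ restrict m τ)    ≡⟨ restrict-reject (restrict m τ) a ⟩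
  restrict k (restrict m τ)        ≡⟨ restrict-restrict k≤m τ ⟩
  restrict k τ                     ≡⟨ restrict-reject τ a ⟨
  restrict k (x ∷ τ)               ∎
  where open ≡-Reasoning
... | no a | no b = begin
  restrict k (restrict m (x ∷ τ))  ≡⟨ cong (restrict k) (restrict-reject τ b) ⟩
  restrict k (restrict m τ)        ≡⟨ restrict-restrict k≤m τ ⟩
  restrict k τ                     ≡⟨ restrict-reject τ a ⟨
  restrict k (x ∷ τ)               ∎
  where open ≡-Reasoning

isTraced : List ℕ → ℕ → Bool
isTraced τ v = (inAp τ v ∧ inRlmin τ v) ∨ anyR 1 (length τ) (λ i → block2At τ i ∧ (at τ (suc i) ≡ᵇ v))

Traced : List ℕ → ℕ → Set
Traced τ v = (∃ λ i → Plateau (at τ) (length τ) i × at τ i ≡ v × RlMin (at τ) (length τ) v)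
           ⊎ (∃ λ i → 1 ≤ i × Block2 (at τ) (length τ) i × at τ (suc i) ≡ v)

isTraced-elim : ∀ {τ v} → T (isTraced τ v) → Traced τ v
isTraced-elim {τ} {v} t with ∨-elim {inAp τ v ∧ inRlmin τ v} t
... | inj₁ a = let b , c = ∧-elim {inAp τ v} a ; i , p , e = inAp-elim {τ} b in inj₁ (i , p , e , inRlmin-elim c)
... | inj₂ a = let i , l , _ , b = anyR-elim {1} {length τ} {λ i → block2At τ i ∧ (at τ (suc i) ≡ᵇ v)} a ; c , d = ∧-elim {block2At τ i} b in
  inj₂ (i , l , block2At-elim c , ≡ᵇ-elim d)

isTraced-intro : ∀ {τ v} → Traced τ v → T (isTraced τ v)
isTraced-intro {τ} {v} (inj₁ (i , p , refl , r)) =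
  ∨-intro {inAp τ v ∧ inRlmin τ v} (inj₁ (∧-intro {inAp τ v} (inAp-intro {τ} p) (inRlmin-intro r)))
isTraced-intro {τ} {v} (inj₂ (i , l , b , e)) = ∨-intro {inAp τ v ∧ inRlmin τ v}
  (inj₂ (anyR-intro {1} {length τ} {λ i → block2At τ i ∧ (at τ (suc i) ≡ᵇ v)} {i} l (<⇒≤ (Block2.i<L b)) (∧-intro {block2At τ i} (block2At-intro b) (≡ᵇ-intro e))))

-- Needed for the value m + 1: it cannot be traced in a restriction to letters at most k ≤ m,
-- because it does not occur there.
Traced-∈ : ∀ {τ v} → Traced τ v → v ∈ τ
Traced-∈ {τ} (inj₁ (i , p , refl , _)) = ‼-∈ (proj₁ (plateau-range p)) (proj₂ (plateau-range p))
Traced-∈ {τ} (inj₂ (i , _ , b , refl)) = ‼-∈ (s≤s z≤n) (Block2.i<L b)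

inTrace-elim : ∀ {m σ v} → T (inTrace m σ v) → ∃ λ k → 2 ≤ k × k ≤ m × T (isTraced (restrict k σ) v)
inTrace-elim {m} {σ} {v} = anyR-elim {2} {m} {λ k → isTraced (restrict k σ) v}

inTrace-intro : ∀ {m σ v k} → 2 ≤ k → k ≤ m → T (isTraced (restrict k σ) v) → T (inTrace m σ v)
inTrace-intro {m} {σ} {v} = anyR-intro {2} {m} {λ k → isTraced (restrict k σ) v}

-- Change of each Stirling statistic under one insertion

module Child {m σ σ′ j} (S : StirlingWord m (length σ) (at σ)) (S′ : StirlingWord (suc m) (length σ′) (at σ′))
             (I : Insertion m (length σ) j (at σ) (at σ′))
             (len : length σ′ ≡ 2 + length σ) (res : restrict m σ′ ≡ σ) where
  open Insertion I

  private
    L = length σ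
    w = at σ
    w′ = at σ′
    to : ∀ {P : ℕ → Set} → P (length σ′) → P (2 + L)
    to {P} = subst P len
    from : ∀ {P : ℕ → Set} → P (2 + L) → P (length σ′)
    from {P} = subst P (sym len)

  inRlmin-old : ∀ {v} → v ≤ m → inRlmin σ′ v ≡ inRlmin σ v
  inRlmin-old {v} u = T-ext
    (λ t → inRlmin-intro {σ} {v} (rlMin-old⁻ u (to {λ ℓ → RlMin w′ ℓ v} (inRlmin-elim {σ′} {v} t))))
    (λ t → inRlmin-intro {σ′} {v} (from {λ ℓ → RlMin w′ ℓ v} (rlMin-old⁺ (inRlmin-elim {σ} {v} t))))

  inRlmin-new : inRlmin σ′ (suc m) ≡ (j ≡ᵇ L)
  inRlmin-new = T-ext
    (λ t → ≡ᵇ-intro (rlMin-new⁻ (to {λ ℓ → RlMin w′ ℓ (suc m)} (inRlmin-elim {σ′} {suc m} t))))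
    (λ t → inRlmin-intro {σ′} {suc m} (from {λ ℓ → RlMin w′ ℓ (suc m)} (rlMin-new⁺ (≡ᵇ-elim t))))

  inAp-new : inAp σ′ (suc m) ≡ (1 ≤ᵇ j)
  inAp-new = T-ext
    (λ t → let i , p , e = inAp-elim {σ′} t in ≤⇒≤ᵇ (plateau-new⁻ (to {λ ℓ → Plateau w′ ℓ i} p) e))
    (λ t → subst (T ∘ inAp σ′) w′-new₁ (inAp-intro {σ′} (from {λ ℓ → Plateau w′ ℓ (suc j)} (plateau-new⁺ (≤ᵇ-elim {1} t)))))

  -- The excluded positions are the plateaux that gap j breaks: the one at j from inside, the one at
  -- j + 1 from the front.
  kept : (ℕ → Bool) → ℕ → Bool
  kept P i = (P i ∧ not (i ≡ᵇ j)) ∧ not (i ≡ᵇ suc j)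

  kept-elim : ∀ {P i} → T (kept P i) → T (P i) × i ≢ j × i ≢ suc j
  kept-elim {P} {i} t = let a , b = ∧-elim {P i ∧ not (i ≡ᵇ j)} t ; c , d = ∧-elim {P i} a in
    c , not-elim d ∘ ≡ᵇ-intro , not-elim b ∘ ≡ᵇ-intro

  kept-intro : ∀ {P i} → T (P i) → i ≢ j → i ≢ suc j → T (kept P i)
  kept-intro {P} {i} p a b =
    ∧-intro {P i ∧ not (i ≡ᵇ j)} (∧-intro {P i} p (not-intro (a ∘ ≡ᵇ-elim))) (not-intro (b ∘ ≡ᵇ-elim))

  count-inAp-old : ∀ {g g′ : ℕ → Bool} → (∀ {v} → v ≤ m → g′ v ≡ g v) →
                   count m (λ v → inAp σ′ v ∧ g′ v) ≡ count L (kept (plateauWith g σ))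
  count-inAp-old {g} {g′} g≡ = count-image m L {λ v → inAp σ′ v ∧ g′ v} {kept (plateauWith g σ)} {w} preimage image
    λ {i} {k} _ _ _ _ c c′ → plateau-injective S (pl {i} (proj₁ (kept-elim {plateauWith g σ} {i} c))) (pl {k} (proj₁ (kept-elim {plateauWith g σ} {k} c′)))
    where
    pl : ∀ {i} → T (plateauWith g σ i) → Plateau w L i
    pl {i} t = plateauᵇ-elim {σ} {i} (proj₁ (∧-elim {plateauᵇ σ i} t))
    preimage′ : ∀ {i} → Position j L i → Plateau w′ (2 + L) i → w′ i ≤ m → T (g′ (w′ i)) →
               ∃ λ k → 1 ≤ k × k ≤ L × T (kept (plateauWith g σ) k) × w k ≡ w′ i
    preimage′ new₁ p u t = ⊥-elim (<⇒≱ ≤-refl (subst (_≤ m) w′-new₁ u))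
    preimage′ new₂ p u t = ⊥-elim (<⇒≱ ≤-refl (subst (_≤ m) w′-new₂ u))
    preimage′ (old {k} lk uk) p u t = let q , a , b = plateau-old⁻ lk uk p in
      k , lk , uk , kept-intro {plateauWith g σ} {k}
        (∧-intro {plateauᵇ σ k} (plateauᵇ-intro {σ} {k} q) (subst T (trans (g≡ {w′ (shift j k)} u) (cong g (w′-old lk uk))) t)) a (λ e → b (cong pred e))
      , sym (w′-old lk uk)
    preimage : ∀ {v} → 1 ≤ v → v ≤ m → T (inAp σ′ v ∧ g′ v) → ∃ λ i →
      1 ≤ i × i ≤ L × T (kept (plateauWith g σ) i) × w i ≡ v
    preimage {v} _ u t with a , b ← ∧-elim {inAp σ′ v} t with i , p , refl ← inAp-elim {σ′} a =
      let p′ = to {λ ℓ → Plateau w′ ℓ i} p ; l , r = plateau-range p′ in preimage′ (pos l r) p′ u b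
    image : ∀ {i} → 1 ≤ i → i ≤ L → T (kept (plateauWith g σ) i) → T (inAp σ′ (w i) ∧ g′ (w i)) × 1 ≤ w i × w i ≤ m
    image {suc i} l u t =
      let c , a , b = kept-elim {plateauWith g σ} {suc i} t ; p , q = ∧-elim {plateauᵇ σ (suc i)} c in
      ∧-intro {inAp σ′ (w (suc i))}
        (subst (T ∘ inAp σ′) (w′-old l u) (inAp-intro {σ′} (from {λ ℓ → Plateau w′ ℓ (shift j (suc i))} (plateau-old⁺ (pl {suc i} c) a (b ∘ cong suc)))))
        (subst T (sym (g≡ (proj₂ (rng l u)))) q)
      , rng l u

  -- New plus lost equals gained plus old. The gain is the plateau of the new value, present unless
  -- j = 0; the old plateaux survive outside j and j + 1. Agreement of `g` and `g′` on old values is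
  -- what `inRlmin-old` supplies.
  count-inAp-child : ∀ {g g′ : ℕ → Bool} → (∀ {v} → v ≤ m → g′ v ≡ g v) →
    count (suc m) (λ v → inAp σ′ v ∧ g′ v) + (ind (plateauWith g σ j) + ind (plateauWith g σ (suc j)))
    ≡ ind ((1 ≤ᵇ j) ∧ g′ (suc m)) + count m (λ v → inAp σ v ∧ g v)
  count-inAp-child {g} {g′} g≡ = begin
    (ind (inAp σ′ (suc m) ∧ g′ (suc m)) + count m (λ v → inAp σ′ v ∧ g′ v)) + hits
      ≡⟨ cong₂ {A = Bool} {B = ℕ} (λ a b → (ind (a ∧ g′ (suc m)) + b) + hits) inAp-new (count-inAp-old {g} {g′} g≡) ⟩
    (ind ((1 ≤ᵇ j) ∧ g′ (suc m)) + count L (kept P)) + hits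
      ≡⟨ +-assoc (ind ((1 ≤ᵇ j) ∧ g′ (suc m))) _ _ ⟩
    ind ((1 ≤ᵇ j) ∧ g′ (suc m)) + (count L (kept P) + hits)
      ≡⟨ cong (ind ((1 ≤ᵇ j) ∧ g′ (suc m)) +_) (+-comm (count L (kept P)) hits) ⟩
    ind ((1 ≤ᵇ j) ∧ g′ (suc m)) + (hits + count L (kept P))
      ≡⟨ cong (ind ((1 ≤ᵇ j) ∧ g′ (suc m)) +_)
        (count-drop₂ L {P} {j} {suc j} (bounds {j}) (bounds {suc j}) (λ _ → 1+n≢n)) ⟨
    ind ((1 ≤ᵇ j) ∧ g′ (suc m)) + count L P
      ≡⟨ cong (ind ((1 ≤ᵇ j) ∧ g′ (suc m)) +_) (count-inAp g S) ⟨
    ind ((1 ≤ᵇ j) ∧ g′ (suc m)) + count m (λ v → inAp σ v ∧ g v) ∎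
    where
    open ≡-Reasoning
    P = plateauWith g σ
    hits = ind (P j) + ind (P (suc j))
    bounds : ∀ {i} → T (P i) → 1 ≤ i × i ≤ L
    bounds {i} t = plateau-range (plateauᵇ-elim {σ} {i} (proj₁ (∧-elim {plateauᵇ σ i} t)))

  pap-child : pap (suc m) σ′ + (ind (plateauWith (not ∘ inRlmin σ) σ j) + ind (plateauWith (not ∘ inRlmin σ) σ (suc j)))
            ≡ ind ((1 ≤ᵇ j) ∧ not (j ≡ᵇ L)) + pap m σ
  pap-child = trans
    (cong (_+ (ind (plateauWith (not ∘ inRlmin σ) σ j) + ind (plateauWith (not ∘ inRlmin σ) σ (suc j))))
      (countR≡count (suc m) (λ v → inAp σ′ v ∧ not (inRlmin σ′ v))))
    (trans (count-inAp-child {not ∘ inRlmin σ} {not ∘ inRlmin σ′} λ {v} u → cong not (inRlmin-old {v} u))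
      (cong₂ (λ a b → ind ((1 ≤ᵇ j) ∧ not a) + b) (inRlmin-new) (sym (countR≡count m (λ v → inAp σ v ∧ not (inRlmin σ v))))))

  impap-child : impap (suc m) σ′ + (ind (plateauWith (inRlmin σ) σ j) + ind (plateauWith (inRlmin σ) σ (suc j)))
              ≡ ind ((1 ≤ᵇ j) ∧ (j ≡ᵇ L)) + impap m σ
  impap-child =
    trans (cong (_+ (ind (plateauWith (inRlmin σ) σ j) + ind (plateauWith (inRlmin σ) σ (suc j))))
      (countR≡count (suc m) (λ v → inAp σ′ v ∧ inRlmin σ′ v)))
    (trans (count-inAp-child {inRlmin σ} {inRlmin σ′} λ {v} u → inRlmin-old {v} u)
      (cong₂ (λ a b → ind ((1 ≤ᵇ j) ∧ a) + b) (inRlmin-new) (sym (countR≡count m (λ v → inAp σ v ∧ inRlmin σ v)))))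

  -- A block at i is broken from inside for j = i and from behind for j = i + 1; the latter is
  -- written i = `pred j`, which is faithful because 1 ≤ i.
  block-old : ∀ {i} → 1 ≤ i → i ≤ L → block2At σ′ (shift j i) ≡ ((blockᵇ σ i ∧ not (i ≡ᵇ j)) ∧ not (i ≡ᵇ pred j))
  block-old {i} l u = T-ext
    (λ t → let b , i≢j , si≢j = block2-old⁻ l u (to {λ ℓ → Block2 w′ ℓ (shift j i)} (block2At-elim {σ′} t)) in
      ∧-intro {blockᵇ σ i ∧ not (i ≡ᵇ j)} (∧-intro {blockᵇ σ i} (blockᵇ-intro {σ} l b) (not-intro (i≢j ∘ ≡ᵇ-elim)))
        (not-intro λ e → si≢j (suc-pred′ j l (≡ᵇ-elim {i} e))))
    (λ t → let a , b = ∧-elim {blockᵇ σ i ∧ not (i ≡ᵇ j)} t ; c , d = ∧-elim {blockᵇ σ i} a in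
      block2At-intro {σ′} (from {λ ℓ → Block2 w′ ℓ (shift j i)} (block2-old⁺ l (proj₂ (blockᵇ-elim {σ} {i} c)) (not-elim d ∘ ≡ᵇ-intro) (λ e → not-elim b (≡ᵇ-intro (cong pred e))))))
    where
    suc-pred′ : ∀ {i} j → 1 ≤ i → i ≡ pred j → suc i ≡ j
    suc-pred′ (suc j) _ refl = refl
    suc-pred′ zero () refl

  bk₂-child : bk₂ σ′ + (ind (blockᵇ σ j) + ind (blockᵇ σ (pred j))) ≡ ind (j ≡ᵇ 0) + bk₂ σ
  bk₂-child = begin
    bk₂ σ′ + hits
      ≡⟨ cong (_+ hits) (trans (countR≡count (length σ′) (block2At σ′)) (cong (λ ℓ → count ℓ (block2At σ′)) len)) ⟩
    count (2 + L) (block2At σ′) + hits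
      ≡⟨ cong (_+ hits) (count-shift L (block2At σ′) j≤L) ⟩
    ((ind (block2At σ′ (suc j)) + ind (block2At σ′ (2 + j))) + count L (block2At σ′ ∘ shift j)) + hits
      ≡⟨ cong (_+ hits)
        (cong₂ _+_ (trans (cong₂ (λ a b → ind a + ind b) at₁ at₂) (+-identityʳ _)) (count-cong L block-old)) ⟩
    (ind (j ≡ᵇ 0) + count L keptB) + hits
      ≡⟨ +-assoc (ind (j ≡ᵇ 0)) _ _ ⟩
    ind (j ≡ᵇ 0) + (count L keptB + hits)
      ≡⟨ cong (ind (j ≡ᵇ 0) +_) (+-comm (count L keptB) hits) ⟩
    ind (j ≡ᵇ 0) + (hits + count L keptB)
      ≡⟨ cong (ind (j ≡ᵇ 0) +_)
        (count-drop₂ L {blockᵇ σ} {j} {pred j} bounds bounds (λ t e → pred≢ j (proj₁ (bounds t)) e)) ⟨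
    ind (j ≡ᵇ 0) + count L (blockᵇ σ)
      ≡⟨ cong (ind (j ≡ᵇ 0) +_) (bk₂≡count σ) ⟨
    ind (j ≡ᵇ 0) + bk₂ σ ∎
    where
    open ≡-Reasoning
    hits = ind (blockᵇ σ j) + ind (blockᵇ σ (pred j))
    keptB = λ i → (blockᵇ σ i ∧ not (i ≡ᵇ j)) ∧ not (i ≡ᵇ pred j)
    bounds : ∀ {i} → T (blockᵇ σ i) → 1 ≤ i × i ≤ L
    bounds {i} t = let l , b = blockᵇ-elim {σ} {i} t in l , <⇒≤ (Block2.i<L b)
    pred≢ : ∀ j → 1 ≤ pred j → pred j ≢ j
    pred≢ (suc j) _ e = 1+n≢n (sym e)
    at₁ : block2At σ′ (suc j) ≡ (j ≡ᵇ 0)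
    at₁ = T-ext (λ t → ≡ᵇ-intro (block2-new₁⁻ (to {λ ℓ → Block2 w′ ℓ (suc j)} (block2At-elim {σ′} t))))
                (λ t → block2At-intro {σ′} (from {λ ℓ → Block2 w′ ℓ (suc j)} (block2-new₁⁺ (≡ᵇ-elim t))))
    at₂ : block2At σ′ (2 + j) ≡ false
    at₂ = ¬T⇒≡ λ t → ¬block2-new₂ (to {λ ℓ → Block2 w′ ℓ (2 + j)} (block2At-elim {σ′} t))

  -- Old letters move by 0 or 2 places and keep their parity; of the new letters only the one at j +
  -- 1 is a first occurrence.
  even-child : even σ′ ≡ ind (evenᵇ (suc j)) + even σ
  even-child = begin
    even σ′                             ≡⟨ trans (countR≡count (length σ′) F′) (cong (λ ℓ → count ℓ F′) len) ⟩
    count (2 + L) F′                    ≡⟨ count-shift L F′ j≤L ⟩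
    (ind (F′ (suc j)) + ind (F′ (2 + j))) + count L (F′ ∘ shift j)
      ≡⟨ cong₂ _+_ (trans (cong₂ (λ a b → ind a + ind b) at₁ at₂) (+-identityʳ _)) (count-cong L same) ⟩
    ind (evenᵇ (suc j)) + count L (λ i → evenᵇ i ∧ firstOcc σ i)  ≡⟨ cong (ind (evenᵇ (suc j)) +_) (countR≡count L _) ⟨
    ind (evenᵇ (suc j)) + even σ ∎
    where
    open ≡-Reasoning
    F′ = λ i → evenᵇ i ∧ firstOcc σ′ i
    at₁ : F′ (suc j) ≡ evenᵇ (suc j)
    at₁ = T-ext (proj₁ ∘ ∧-elim {evenᵇ (suc j)}) (λ t → ∧-intro t (firstOcc-intro {σ′} first-new₁))
    at₂ : F′ (2 + j) ≡ false
    at₂ = ¬T⇒≡ {F′ (2 + j)} λ t → ¬first-new₂ (firstOcc-elim {σ′} (proj₂ (∧-elim {evenᵇ (2 + j)} t)))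
    evenᵇ-shift : ∀ i → evenᵇ (shift j i) ≡ evenᵇ i
    evenᵇ-shift i with i ≤ᵇ j
    ... | true  = refl
    ... | false = refl
    same : ∀ {i} → 1 ≤ i → i ≤ L → F′ (shift j i) ≡ (evenᵇ i ∧ firstOcc σ i)
    same {i} l u = cong₂ _∧_ (evenᵇ-shift i) (T-ext
      (λ t → firstOcc-intro {σ} (first-old⁻ l u (firstOcc-elim {σ′} t)))
      (λ t → firstOcc-intro {σ′} (first-old⁺ l u (firstOcc-elim {σ} t))))

  restrict-old : ∀ {k} → k ≤ m → restrict k σ′ ≡ restrict k σ
  restrict-old {k} u = trans (sym (restrict-restrict u σ′)) (cong (restrict k) res)

  -- An insertion creates no plateau or block of size 2 with an old value, nor does it turn an old
  -- value into a right-to-left minimum. So whatever the longer word traces among old values, its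
  -- parent traced already.
  traced-old : ∀ {v} → v ≤ m → Traced σ′ v → Traced σ v
  traced-old u (inj₁ (i , p , refl , r)) =
    let p′ = to {λ ℓ → Plateau w′ ℓ i} p ; l , n = plateau-range p′ in
    go (pos l n) p′ u (rlMin-old⁻ u (to {λ ℓ → RlMin w′ ℓ (w′ i)} r))
    where
    go : ∀ {i} → Position j L i → Plateau w′ (2 + L) i → w′ i ≤ m → RlMin w L (w′ i) → Traced σ (w′ i)
    go new₁ p u r = ⊥-elim (<⇒≱ ≤-refl (subst (_≤ m) w′-new₁ u))
    go new₂ p u r = ⊥-elim (<⇒≱ ≤-refl (subst (_≤ m) w′-new₂ u))
    go (old {k} lk uk) p u r = inj₁ (k , proj₁ (plateau-old⁻ lk uk p) , sym (w′-old lk uk) , r)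
  traced-old u (inj₂ (i , l , b , refl)) =
    let b′ = to {λ ℓ → Block2 w′ ℓ i} b in go (pos l (<⇒≤ (Block2.i<L b′))) b′ u
    where
    go : ∀ {i} → Position j L i → Block2 w′ (2 + L) i → w′ (suc i) ≤ m → Traced σ (w′ (suc i))
    go new₁ b u = ⊥-elim (<⇒≱ ≤-refl (subst (_≤ m) w′-new₂ u))
    go new₂ b u = ⊥-elim (¬block2-new₂ b)
    go (old {k} lk uk) b u = let b′ , i≢j , _ = block2-old⁻ lk uk b in
      inj₂ (k , lk , b′ , trans (sym (w′-old (s≤s z≤n) (Block2.i<L b′))) (cong w′ (shift-suc i≢j)))

  traced-new⁻ : Traced σ′ (suc m) → j ≡ 0 ⊎ j ≡ L
  traced-new⁻ (inj₁ (i , p , e , r)) = inj₂ (rlMin-new⁻ (to {λ ℓ → RlMin w′ ℓ (suc m)} r))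
  traced-new⁻ (inj₂ (i , l , b , e)) =
    let b′ = to {λ ℓ → Block2 w′ ℓ i} b in inj₁ (go (pos l (<⇒≤ (Block2.i<L b′))) b′ e)
    where
    go : ∀ {i} → Position j L i → Block2 w′ (2 + L) i → w′ (suc i) ≡ suc m → j ≡ 0
    go new₁ b e = block2-new₁⁻ b
    go new₂ b e = ⊥-elim (¬block2-new₂ b)
    go (old {k} lk uk) b e = let b′ , i≢j , _ = block2-old⁻ lk uk b in
      ⊥-elim (<⇒≢ (w<M (s≤s z≤n) (Block2.i<L b′)) (trans (sym (w′-old (s≤s z≤n) (Block2.i<L b′))) (trans (cong w′ (shift-suc i≢j)) e)))

  traced-new⁺ : j ≡ 0 ⊎ j ≡ L → Traced σ′ (suc m)
  traced-new⁺ (inj₁ refl) = inj₂ (1 , ≤-refl , from {λ ℓ → Block2 w′ ℓ 1} (block2-new₁⁺ refl) , w′-new₂)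
  traced-new⁺ (inj₂ e) =
    inj₁ (suc j , from {λ ℓ → Plateau w′ ℓ (suc j)}
      (plateau-new⁺ (≤-trans 1≤L (≤-reflexive (sym e)))) , w′-new₁ , from {λ ℓ → RlMin w′ ℓ (suc m)} (rlMin-new⁺ e))

  restrict-σ′ : restrict (suc m) σ′ ≡ σ′
  restrict-σ′ = restrict-all (letters≤ S′)

  restrict-σ : restrict m σ ≡ σ
  restrict-σ = restrict-all (letters≤ S)

  1≤m : 1 ≤ m
  1≤m = let a , b = rng (s≤s z≤n) 1≤L in ≤-trans a b

  -- For m = 1 the word σ is 1 and has neither plateaux nor blocks of size 2.
  traced⇒2≤m : ∀ {v} → 1 ≤ v → Traced σ v → 2 ≤ m
  traced⇒2≤m {v} 1≤v t with m≤n⇒m<n∨m≡n 1≤m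
  ... | inj₁ p = p
  ... | inj₂ refl = ⊥-elim (<⇒≱ (two-positions t) (≤-reflexive one))
    where
    open StirlingWord S using (one)
    two-at : ∀ {i} → 1 ≤ i → i < L → 2 ≤ count L (λ i → w i ≡ᵇ 1)
    two-at {i} l u = count-≥2 L {λ i → w i ≡ᵇ 1} l (<⇒≤ u) (s≤s z≤n) u (<⇒≢ ≤-refl)
      (≡ᵇ-intro (let a , b = rng l (<⇒≤ u) in ≤-antisym b a)) (≡ᵇ-intro (let a , b = rng (s≤s z≤n) u in ≤-antisym b a))
    two-positions : Traced σ v → 2 ≤ count L (λ i → w i ≡ᵇ 1)
    two-positions (inj₁ (i , p , _)) = two-at (proj₁ (plateau-range p)) (Plateau.i<L p)
    two-positions (inj₂ (i , l , b , _)) = two-at l (Block2.i<L b)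

  -- For k ≤ m the restrictions of child and parent coincide, so a trace survives even if its
  -- plateau or block is broken now. The additional k = m + 1 yields no further old value by
  -- `traced-old`; what it yields is found at k = m.
  inTrace-old : ∀ {v} → 1 ≤ v → v ≤ m → inTrace (suc m) σ′ v ≡ inTrace m σ v
  inTrace-old {v} 1≤v u = T-ext
    (λ t → let k , l , n , t′ = inTrace-elim {suc m} {σ′} t in fwd l (m≤n⇒m<n∨m≡n n) t′)
    (λ t → let k , l , n , t′ = inTrace-elim {m} {σ} t in
      inTrace-intro {suc m} {σ′} l (m≤n⇒m≤1+n n) (subst (λ τ → T (isTraced τ v)) (sym (restrict-old n)) t′))
    where
    fwd : ∀ {k} → 2 ≤ k → k < suc m ⊎ k ≡ suc m → T (isTraced (restrict k σ′) v) → T (inTrace m σ v)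
    fwd l (inj₁ (s≤s n)) t = inTrace-intro {m} {σ} l n (subst (λ τ → T (isTraced τ v)) (restrict-old n) t)
    fwd l (inj₂ refl) t = let t′ = traced-old u (isTraced-elim {σ′} (subst (λ τ → T (isTraced τ v)) restrict-σ′ t)) in
      inTrace-intro {m} {σ} (traced⇒2≤m 1≤v t′) ≤-refl (subst (λ τ → T (isTraced τ v)) (sym restrict-σ) (isTraced-intro {σ} t′))

  inTrace-new : inTrace (suc m) σ′ (suc m) ≡ ((j ≡ᵇ 0) ∨ (j ≡ᵇ L))
  inTrace-new = T-ext
    (λ t → let k , l , n , t′ = inTrace-elim {suc m} {σ′} t in
      ∨-intro {j ≡ᵇ 0} (fwd (m≤n⇒m<n∨m≡n n) (isTraced-elim {restrict k σ′} t′)))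
    (λ t → inTrace-intro {suc m} {σ′} (s≤s 1≤m) ≤-refl (subst (λ τ → T (isTraced τ (suc m))) (sym restrict-σ′)
      (isTraced-intro {σ′} (traced-new⁺ (bwd (∨-elim {j ≡ᵇ 0} t))))))
    where
    fwd : ∀ {k} → k < suc m ⊎ k ≡ suc m → Traced (restrict k σ′) (suc m) → T (j ≡ᵇ 0) ⊎ T (j ≡ᵇ L)
    fwd {k} (inj₁ n) t = ⊥-elim (<⇒≱ n (≤ᵇ-elim {suc m} (proj₂ (∈-filter⁻ (T? ∘ (_≤ᵇ k)) {xs = σ′} (Traced-∈ t)))))
    fwd (inj₂ refl) t with traced-new⁻ (subst (λ τ → Traced τ (suc m)) restrict-σ′ t)
    ... | inj₁ e = inj₁ (≡ᵇ-intro e)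
    ... | inj₂ e = inj₂ (≡ᵇ-intro e)
    bwd : T (j ≡ᵇ 0) ⊎ T (j ≡ᵇ L) → j ≡ 0 ⊎ j ≡ L
    bwd (inj₁ e) = inj₁ (≡ᵇ-elim e)
    bwd (inj₂ e) = inj₂ (≡ᵇ-elim e)

  tr-child : tr (suc m) σ′ ≡ ind ((j ≡ᵇ 0) ∨ (j ≡ᵇ L)) + tr m σ
  tr-child = trans (countR≡count (suc m) (inTrace (suc m) σ′))
    (cong₂ _+_ (cong ind inTrace-new) (trans (count-cong m inTrace-old) (sym (countR≡count m (inTrace m σ)))))

-- Sums over gaps of one parity

sumTo-pairs : ∀ n f → sumTo n (λ k → f (pred (k + k)) + f (k + k)) ≡ sumTo (n + n) f
sumTo-pairs zero    f = refl
sumTo-pairs (suc n) f rewrite +-suc n n = begin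
  (f (suc (n + n)) + f (2 + (n + n))) + sumTo n _     ≡⟨ cong₂ _+_ (+-comm (f (suc (n + n))) _) (sumTo-pairs n f) ⟩
  (f (2 + (n + n)) + f (suc (n + n))) + sumTo (n + n) f ≡⟨ +-assoc (f (2 + (n + n))) _ _ ⟩
  f (2 + (n + n)) + (f (suc (n + n)) + sumTo (n + n) f) ∎
  where open ≡-Reasoning

sumTo-suc : ∀ n f → sumTo n (f ∘ suc) + f 1 ≡ sumTo (suc n) f
sumTo-suc n f = trans (+-comm (sumTo n (f ∘ suc)) (f 1)) (sym (sumTo-head n f))

sumTo-pred : ∀ n f → sumTo n (f ∘ pred) + f n ≡ sumTo n f + f 0
sumTo-pred zero    f = refl
sumTo-pred (suc n) f = begin
  (f n + sumTo n (f ∘ pred)) + f (suc n)  ≡⟨ cong (_+ f (suc n)) (trans (+-comm (f n) _) (sumTo-pred n f)) ⟩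
  (sumTo n f + f 0) + f (suc n)           ≡⟨ +-comm _ (f (suc n)) ⟩
  f (suc n) + (sumTo n f + f 0)           ≡⟨ +-assoc (f (suc n)) _ _ ⟨
  (f (suc n) + sumTo n f) + f 0           ∎
  where open ≡-Reasoning

statQ : ℕ → List ℕ → Stat
statQ n σ = ⟨ pap (suc n) σ , cap n σ , impap (suc n) σ , bk₂ σ , even σ , tr (suc n) σ ⟩

cap≡ : ∀ n σ → cap n σ ≡ n ∸ (pap (suc n) σ + impap (suc n) σ + bk₂ σ)
cap≡ n σ = trans (cong (_∸ bk₂ σ) (∸-+-assoc n (pap (suc n) σ) _)) (∸-+-assoc n (pap (suc n) σ + impap (suc n) σ) _)

kindFrom : Bool → Bool → Bool → Kind
kindFrom x s t = if x then excᵏ else if s then singleᵏ else if t then fixᵏ else aexcᵏ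

isExc-kindFrom : ∀ x s t → isExc (kindFrom x s t) ≡ x
isExc-kindFrom true  _     _     = refl
isExc-kindFrom false true  _     = refl
isExc-kindFrom false false true  = refl
isExc-kindFrom false false false = refl

isSingle-kindFrom : ∀ {x s t} → (T x → T s → ⊥) → isSingle (kindFrom x s t) ≡ s
isSingle-kindFrom {true}  {true}          e = ⊥-elim (e _ _)
isSingle-kindFrom {true}  {false}         e = refl
isSingle-kindFrom {false} {true}          e = refl
isSingle-kindFrom {false} {false} {true}  e = refl
isSingle-kindFrom {false} {false} {false} e = refl

isFix-kindFrom : ∀ {x s t} → (T x → T t → ⊥) → (T s → T t → ⊥) → isFix (kindFrom x s t) ≡ t
isFix-kindFrom {true}  {_}     {true}  e f = ⊥-elim (e _ _)
isFix-kindFrom {true}  {_}     {false} e f = refl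
isFix-kindFrom {false} {true}  {true}  e f = ⊥-elim (f _ _)
isFix-kindFrom {false} {true}  {false} e f = refl
isFix-kindFrom {false} {false} {true}  e f = refl
isFix-kindFrom {false} {false} {false} e f = refl

ind-∨ : ∀ {a b} → (T a → T b → ⊥) → ind (a ∨ b) ≡ ind a + ind b
ind-∨ {true}  {true}  e = ⊥-elim (e _ _)
ind-∨ {true}  {false} e = refl
ind-∨ {false} {b}     e = refl

suc-∸ : ∀ {n s} → s ≤ n → suc n ∸ s ≡ suc (n ∸ s)
suc-∸ s≤n = +-∸-assoc 1 s≤n

-- Each insertion into an inner gap gains one proper plateau and loses at most one item, marked by
-- `x`, `s` or `t`. As the sum of the four exponents grows by one with n, the exponent of y follows
-- from the others; `a + c + d ≤ n` makes the truncated difference grow properly.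
split≡ : ∀ {n a b c d p q a′ b′ c′ d′ p′ q′} x s t e → (T x → T s → ⊥) → (T x → T t → ⊥) → (T s → T t → ⊥) →
  a + c + d ≤ n → b ≡ n ∸ (a + c + d) →
  a′ + ind x ≡ suc a → c′ + ind s ≡ c → d′ + ind t ≡ d → b′ ≡ suc n ∸ (a′ + c′ + d′) → p′ ≡ ind e + p → q′ ≡ q →
  ⟨ a′ , b′ , c′ , d′ , p′ , q′ ⟩ ≡ split (kindFrom x s t) e ⟨ a , b , c , d , p , q ⟩
split≡ {n} {a} {a′ = a′} {c′ = c′} {d′ = d′} true s t e xs xt st le refl ea ec ed refl refl refl
  with s | t | xs _ | xt _
... | true  | _     | f | _ = ⊥-elim (f _)
... | false | true  | _ | f = ⊥-elim (f _)
... | false | false | _ | _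
  with refl ← drop0 {c′} ec | refl ← drop0 {d′} ed | refl ← suc-injective (trans (+-comm 1 a′) ea) =
  stat≡ refl (suc-∸ le) refl refl refl refl
split≡ {n} {a} {a′ = a′} {c′ = c′} {d′ = d′} false true t e xs xt st le refl ea ec ed refl refl refl with t | st _
... | true  | f = ⊥-elim (f _)
... | false | _
  with refl ← drop0 {a′} ea | refl ← drop0 {d′} ed | refl ← ec =
  stat≡ refl (trans (cong (suc n ∸_) eq) (suc-∸ le)) (sym (cong pred (+-comm c′ 1))) refl refl refl
  where
  eq : suc a + c′ + d′ ≡ a + (c′ + 1) + d′
  eq = cong (_+ d′) (trans (sym (+-suc a c′)) (cong (a +_) (+-comm 1 c′)))
split≡ {n} {a} {a′ = a′} {c′ = c′} {d′ = d′} false false true e xs xt st le refl ea ec ed refl refl refl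
  with refl ← drop0 {a′} ea | refl ← drop0 {c′} ec | refl ← ed =
  stat≡ refl (trans (cong (suc n ∸_) eq) (suc-∸ le)) refl (sym (cong pred (+-comm d′ 1))) refl refl
  where
  eq : suc a + c′ + d′ ≡ a + c′ + (d′ + 1)
  eq = sym (trans (cong (a + c′ +_) (+-comm d′ 1)) (+-suc (a + c′) d′))
split≡ {n} {a′ = a′} {c′ = c′} {d′ = d′} false false false e xs xt st le refl ea ec ed refl refl refl
  with refl ← drop0 {a′} ea | refl ← drop0 {c′} ec | refl ← drop0 {d′} ed = refl

count-kinds : ∀ n κ → count n (isExc ∘ κ) + count n (isSingle ∘ κ) + count n (isFix ∘ κ) + count n (isAexc ∘ κ) ≡ n
count-kinds zero    κ = refl
count-kinds (suc n) κ with κ (suc n)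
... | excᵏ = cong suc (count-kinds n κ)
... | aexcᵏ = trans (+-suc _ _) (cong suc (count-kinds n κ))
... | singleᵏ = trans (cong (λ z → z + count n (isFix ∘ κ) + count n (isAexc ∘ κ)) (+-suc (count n (isExc ∘ κ)) _)) (cong suc (count-kinds n κ))
... | fixᵏ = trans (cong (_+ count n (isAexc ∘ κ)) (+-suc (count n (isExc ∘ κ) + count n (isSingle ∘ κ)) _)) (cong suc (count-kinds n κ))

-- Each gap breaks at most one plateau or block

module _ {w : ℕ → ℕ} {L : ℕ} where

  plateau-suc : ∀ {i} → Plateau w L i → ¬ Plateau w L (suc i)
  plateau-suc p q = <⇒≢ (Plateau.rise q) (Plateau.flat p)

  block-suc : ∀ {i} → Block2 w L i → ¬ Block2 w L (suc i)
  block-suc b c = Block2.inner b (Block2.start c)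

  plateau-block : ∀ {i} → Plateau w L i → ¬ Block2 w L i
  plateau-block {suc i} p b = <-asym (Plateau.rise p) (Block2.start b (s≤s⁻¹ (Plateau.2≤i p)) ≤-refl)

  block-plateau₁ : ∀ {i} → Block2 w L i → ¬ Plateau w L (suc i)
  block-plateau₁ (block2 _ _ _ (inj₁ refl)) p = <-irrefl refl (Plateau.i<L p)
  block-plateau₁ (block2 _ _ _ (inj₂ m)) p = <⇒≢ (m (s≤s z≤n) ≤-refl) (sym (Plateau.flat p))

  -- Behind a block of size 2 comes a left-to-right minimum, hence a descent, whereas a plateau
  -- starts with a rise.
  block-plateau₂ : ∀ {i} → Block2 w L i → ¬ Plateau w L (2 + i)
  block-plateau₂ (block2 _ _ _ (inj₁ refl)) p = <⇒≱ (Plateau.i<L p) (n≤1+n _)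
  block-plateau₂ (block2 _ _ _ (inj₂ m)) p = <-asym (m (s≤s z≤n) ≤-refl) (Plateau.rise p)

module Gaps {n σ} (σ∈ : σ ∈ Q (suc n)) where

  private
    L = length σ
    w = at σ
    len : L ≡ suc (n + n)
    len = proj₁ (∈-Q-suc⁻ {n} σ∈)
    S : StirlingWord (suc n) L w
    S = proj₂ (∈-Q-suc⁻ {n} σ∈)

  properAt improperAt : ℕ → Bool
  properAt   = plateauWith (not ∘ inRlmin σ) σ
  improperAt = plateauWith (inRlmin σ) σ

  -- The gap j breaks a plateau at position j or j + 1, or a block starting at j or j − 1.
  breaksProper breaksImproper breaksBlock : ℕ → Bool
  breaksProper j   = properAt j ∨ properAt (suc j)
  breaksImproper j = improperAt j ∨ improperAt (suc j)
  breaksBlock j    = blockᵇ σ j ∨ blockᵇ σ (pred j)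

  gapKind : ℕ → Kind
  gapKind j = kindFrom (breaksProper j) (breaksImproper j) (breaksBlock j)

  plateauOf : ∀ {g i} → T (plateauWith g σ i) → Plateau w L i
  plateauOf {g} {i} t = plateauᵇ-elim {σ} {i} (proj₁ (∧-elim {plateauᵇ σ i} t))

  plateauWith-excl : ∀ {g g′} j → T (plateauWith g σ j) → T (plateauWith g′ σ (suc j)) → ⊥
  plateauWith-excl {g} {g′} j a b = plateau-suc (plateauOf {g} {j} a) (plateauOf {g′} {suc j} b)

  proper-improper : ∀ i → T (properAt i) → T (improperAt i) → ⊥
  proper-improper i a b = not-elim (proj₂ (∧-elim {plateauᵇ σ i} a)) (proj₂ (∧-elim {plateauᵇ σ i} b))

  block-excl : ∀ j → T (blockᵇ σ j) → T (blockᵇ σ (pred j)) → ⊥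
  block-excl (suc j) a b = block-suc (proj₂ (blockᵇ-elim {σ} {j} b)) (proj₂ (blockᵇ-elim {σ} {suc j} a))
  block-excl zero a b = <⇒≱ (proj₁ (blockᵇ-elim {σ} {zero} a)) z≤n

  proper-improper-excl : ∀ j → T (breaksProper j) → T (breaksImproper j) → ⊥
  proper-improper-excl j a b with ∨-elim {properAt j} a | ∨-elim {improperAt j} b
  ... | inj₁ p | inj₁ q = proper-improper j p q
  ... | inj₂ p | inj₂ q = proper-improper (suc j) p q
  ... | inj₁ p | inj₂ q = plateauWith-excl {not ∘ inRlmin σ} {inRlmin σ} j p q
  ... | inj₂ p | inj₁ q = plateauWith-excl {inRlmin σ} {not ∘ inRlmin σ} j q p

  plateau-block-excl : ∀ {g} j → T (plateauWith g σ j ∨ plateauWith g σ (suc j)) → T (breaksBlock j) → ⊥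
  plateau-block-excl {g} j a b with ∨-elim {plateauWith g σ j} a | ∨-elim {blockᵇ σ j} b
  plateau-block-excl {g} j a b | inj₁ p | inj₁ q = plateau-block (plateauOf {g} {j} p) (proj₂ (blockᵇ-elim {σ} {j} q))
  plateau-block-excl {g} j a b | inj₂ p | inj₁ q =
    block-plateau₁ (proj₂ (blockᵇ-elim {σ} {j} q)) (plateauOf {g} {suc j} p)
  plateau-block-excl {g} (suc j) a b | inj₁ p | inj₂ q =
    block-plateau₁ (proj₂ (blockᵇ-elim {σ} {j} q)) (plateauOf {g} {suc j} p)
  plateau-block-excl {g} (suc j) a b | inj₂ p | inj₂ q =
    block-plateau₂ (proj₂ (blockᵇ-elim {σ} {j} q)) (plateauOf {g} {2 + j} p)
  plateau-block-excl {g} zero a b | _ | inj₂ q = <⇒≱ (proj₁ (blockᵇ-elim {σ} {zero} q)) z≤n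

  proper-block-excl : ∀ j → T (breaksProper j) → T (breaksBlock j) → ⊥
  proper-block-excl = plateau-block-excl {not ∘ inRlmin σ}

  improper-block-excl : ∀ j → T (breaksImproper j) → T (breaksBlock j) → ⊥
  improper-block-excl = plateau-block-excl {inRlmin σ}

  ind-breaksProper : ∀ j → ind (breaksProper j) ≡ ind (properAt j) + ind (properAt (suc j))
  ind-breaksProper j = ind-∨ {properAt j} (plateauWith-excl {not ∘ inRlmin σ} {not ∘ inRlmin σ} j)

  ind-breaksImproper : ∀ j → ind (breaksImproper j) ≡ ind (improperAt j) + ind (improperAt (suc j))
  ind-breaksImproper j = ind-∨ {improperAt j} (plateauWith-excl {inRlmin σ} {inRlmin σ} j)

  ind-breaksBlock : ∀ j → ind (breaksBlock j) ≡ ind (blockᵇ σ j) + ind (blockᵇ σ (pred j))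
  ind-breaksBlock j = ind-∨ {blockᵇ σ j} (block-excl j)

  private
    L∸1 : ∀ {i} → i < L → i ≤ n + n
    L∸1 p = s≤s⁻¹ (≤-trans p (≤-reflexive len))

    count-L : ∀ P → count L P ≡ ind (P (suc (n + n))) + count (n + n) P
    count-L P = cong (λ ℓ → count ℓ P) len

  -- Each plateau at i is broken by one even and one odd gap, namely i − 1 and i.

  plateau-evens : ∀ g →
    sumTo n (λ k → ind (plateauWith g σ (k + k)) + ind (plateauWith g σ (suc (k + k)))) ≡ count L (plateauWith g σ)
  plateau-evens g = begin
    sumTo n (λ k → f (k + k) + f (suc (k + k)))               ≡⟨ sumTo-cong n (λ { {suc k} _ _ → refl }) ⟩
    sumTo n (λ k → f (suc (pred (k + k))) + f (suc (k + k)))  ≡⟨ sumTo-pairs n (f ∘ suc) ⟩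
    sumTo (n + n) (f ∘ suc)                                   ≡⟨ +-identityʳ _ ⟨
    sumTo (n + n) (f ∘ suc) + 0                               ≡⟨ cong (sumTo (n + n) (f ∘ suc) +_)
      (ind-¬T {plateauWith g σ 1} λ t → <⇒≱ ≤-refl (Plateau.2≤i (plateauOf {g} {1} t))) ⟨
    sumTo (n + n) (f ∘ suc) + f 1                             ≡⟨ sumTo-suc (n + n) f ⟩
    sumTo (suc (n + n)) f                                     ≡⟨ cong (λ ℓ → sumTo ℓ f) len ⟨
    count L (plateauWith g σ)                                 ∎
    where
    open ≡-Reasoning
    f = ind ∘ plateauWith g σ

  plateau-odds : ∀ g →
    sumTo n (λ k → ind (plateauWith g σ (pred (k + k))) + ind (plateauWith g σ (suc (pred (k + k))))) ≡ count L
    (plateauWith g σ)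
  plateau-odds g = begin
    sumTo n (λ k → f (pred (k + k)) + f (suc (pred (k + k)))) ≡⟨ sumTo-cong n (λ { {suc k} _ _ → refl }) ⟩
    sumTo n (λ k → f (pred (k + k)) + f (k + k))              ≡⟨ sumTo-pairs n f ⟩
    sumTo (n + n) f                                           ≡⟨ cong (_+ sumTo (n + n) f)
      (ind-¬T {plateauWith g σ (suc (n + n))} λ t → <⇒≱ ≤-refl (L∸1 (Plateau.i<L (plateauOf {g} {suc (n + n)} t)))) ⟨
    f (suc (n + n)) + sumTo (n + n) f                         ≡⟨ count-L (plateauWith g σ) ⟨
    count L (plateauWith g σ)                                 ∎
    where
    open ≡-Reasoning
    f = ind ∘ plateauWith g σ

  private
    blockInd = ind ∘ blockᵇ σ

    blockInd-0 : blockInd 0 ≡ 0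
    blockInd-0 = ind-¬T {blockᵇ σ 0} λ t → <⇒≱ (proj₁ (blockᵇ-elim {σ} {0} t)) z≤n

    blockInd-L : blockInd (suc (n + n)) ≡ 0
    blockInd-L =
      ind-¬T {blockᵇ σ (suc (n + n))} λ t → <⇒≱ ≤-refl (L∸1 (Block2.i<L (proj₂ (blockᵇ-elim {σ} {suc (n + n)} t))))

    blockInd-L∸1 : blockInd (n + n) ≡ 0
    blockInd-L∸1 =
      ind-¬T {blockᵇ σ (n + n)} λ t → let l , b = blockᵇ-elim {σ} {n + n} t in <⇒≱ ≤-refl (L∸1 (block-not-last S l b))

    count-block : bk₂ σ ≡ sumTo (n + n) blockInd
    count-block = trans (bk₂≡count σ) (trans (count-L (blockᵇ σ)) (cong (_+ sumTo (n + n) blockInd) blockInd-L))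

  block-evens : sumTo n (λ k → blockInd (k + k) + blockInd (pred (k + k))) ≡ bk₂ σ
  block-evens =
    trans (sumTo-cong n (λ {k} _ _ → +-comm (blockInd (k + k)) _)) (trans (sumTo-pairs n blockInd) (sym count-block))

  -- The odd gaps meet the positions 0, ..., 2n - 1. The missing position 2n could only start a last
  -- block of size 2, which does not exist.
  block-odds : sumTo n (λ k → blockInd (pred (k + k)) + blockInd (pred (pred (k + k)))) ≡ bk₂ σ
  block-odds = begin
    sumTo n (λ k → blockInd (pred (k + k)) + blockInd (pred (pred (k + k)))) ≡⟨ sumTo-cong n
      (λ {k} _ _ → +-comm (blockInd (pred (k + k))) _) ⟩
    sumTo n (λ k → blockInd (pred (pred (k + k))) + blockInd (pred (k + k))) ≡⟨ sumTo-pairs n (blockInd ∘ pred) ⟩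
    sumTo (n + n) (blockInd ∘ pred)                                   ≡⟨ +-identityʳ _ ⟨
    sumTo (n + n) (blockInd ∘ pred) + 0                               ≡⟨ cong
      (sumTo (n + n) (blockInd ∘ pred) +_) blockInd-L∸1 ⟨
    sumTo (n + n) (blockInd ∘ pred) + blockInd (n + n)                       ≡⟨ sumTo-pred (n + n) blockInd ⟩
    sumTo (n + n) blockInd + blockInd 0                                      ≡⟨ cong
      (sumTo (n + n) blockInd +_) blockInd-0 ⟩
    sumTo (n + n) blockInd + 0                                        ≡⟨ +-identityʳ _ ⟩
    sumTo (n + n) blockInd                                            ≡⟨ count-block ⟨
    bk₂ σ                                                      ∎
    where open ≡-Reasoning

  pap≡ : pap (suc n) σ ≡ count L properAt
  pap≡ = trans (countR≡count (suc n) (λ v → inAp σ v ∧ not (inRlmin σ v))) (count-inAp (not ∘ inRlmin σ) S)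

  impap≡ : impap (suc n) σ ≡ count L improperAt
  impap≡ = trans (countR≡count (suc n) (λ v → inAp σ v ∧ inRlmin σ v)) (count-inAp (inRlmin σ) S)

  -- For gaps of one parity, each plateau and each block is broken exactly once, so these n gaps
  -- realise the n factors x, y, s, t of the monomial.
  record Balanced (gap : ℕ → ℕ) : Set where
    field
      #exc : count n (isExc ∘ gapKind ∘ gap) ≡ pap (suc n) σ
      #single : count n (isSingle ∘ gapKind ∘ gap) ≡ impap (suc n) σ
      #fix : count n (isFix ∘ gapKind ∘ gap) ≡ bk₂ σ

    total : pap (suc n) σ + impap (suc n) σ + bk₂ σ + count n (isAexc ∘ gapKind ∘ gap) ≡ n
    total = trans (cong (_+ count n (isAexc ∘ gapKind ∘ gap)) (sym (cong₂ _+_ (cong₂ _+_ #exc #single) #fix)))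
      (count-kinds n (gapKind ∘ gap))

    bound : pap (suc n) σ + impap (suc n) σ + bk₂ σ ≤ n
    bound = m+n≤o⇒m≤o _ (≤-reflexive total)

    -- The four kinds exhaust the n gaps, so the truncated subtractions in `cap` are exact and leave
    -- the gaps that break nothing.
    #aexc : count n (isAexc ∘ gapKind ∘ gap) ≡ cap n σ
    #aexc = trans (sym (m+n∸m≡n (pap (suc n) σ + impap (suc n) σ + bk₂ σ) _))
      (trans (cong (_∸ (pap (suc n) σ + impap (suc n) σ + bk₂ σ)) total) (sym (cap≡ n σ)))

  balanced : ∀ gap →
    (∀ g → sumTo n (λ k → ind (plateauWith g σ (gap k)) + ind (plateauWith g σ (suc (gap k)))) ≡ count L (plateauWith g σ)) →
    sumTo n (λ k → blockInd (gap k) + blockInd (pred (gap k))) ≡ bk₂ σ → Balanced gap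
  balanced gap p b = record
    { #exc = trans (sumTo-cong n λ {k} _ _ → trans (cong ind (isExc-kindFrom (breaksProper (gap k)) (breaksImproper (gap k)) (breaksBlock (gap k)))) (ind-breaksProper (gap k)))
             (trans (p (not ∘ inRlmin σ)) (sym pap≡))
    ; #single = trans
      (sumTo-cong n λ {k} _ _ → trans
        (cong ind (isSingle-kindFrom {breaksProper (gap k)} {breaksImproper (gap k)} {breaksBlock (gap k)}
        (proper-improper-excl (gap k)))) (ind-breaksImproper (gap k)))
             (trans (p (inRlmin σ)) (sym impap≡))
    ; #fix = trans
      (sumTo-cong n λ {k} _ _ → trans
        (cong ind (isFix-kindFrom {breaksProper (gap k)} {breaksImproper (gap k)} {breaksBlock (gap k)}
        (proper-block-excl (gap k)) (improper-block-excl (gap k)))) (ind-breaksBlock (gap k)))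
             b
    }

  balanced-evens : Balanced (λ k → k + k)
  balanced-evens = balanced (λ k → k + k) plateau-evens block-evens

  balanced-odds : Balanced (λ k → pred (k + k))
  balanced-odds = balanced (λ k → pred (k + k)) plateau-odds block-odds

  open Balanced balanced-evens using (bound)

  module At {j} (u : j ≤ suc (n + n)) = Child {suc n} {σ} {childQ n σ j} {j} S
    (proj₂ (∈-Q-suc⁻ {suc n} (childQ-∈ {n} σ∈ u))) (childQ-insertion {n} σ∈ u)
    (length-insertPair j (2 + n) σ) (restrict-insertPair j (letters≤ S))

  stat-inner : ∀ {j} → 1 ≤ j → j ≤ n + n → statQ (suc n) (childQ n σ j) ≡ split (gapKind j) (evenᵇ (suc j)) (statQ n σ)
  stat-inner {j} l u =
    split≡ (breaksProper j) (breaksImproper j) (breaksBlock j) (evenᵇ (suc j)) (proper-improper-excl j)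
    (proper-block-excl j) (improper-block-excl j)
    bound (cap≡ n σ)
    (trans (cong (pap (2 + n) σ′ +_) (ind-breaksProper j)) (trans pap-child (cong₂ (λ a b → ind (a ∧ not b) + pap (suc n) σ) e₁ eL)))
    (trans (cong (impap (2 + n) σ′ +_) (ind-breaksImproper j)) (trans impap-child (cong₂ (λ a b → ind (a ∧ b) + impap (suc n) σ) e₁ eL)))
    (trans (cong (bk₂ σ′ +_) (ind-breaksBlock j)) (trans bk₂-child (cong (λ a → ind a + bk₂ σ) e₀)))
    (cap≡ (suc n) σ′) even-child (trans tr-child (cong₂ (λ a b → ind (a ∨ b) + tr (suc n) σ) e₀ eL))
    where
    open At (m≤n⇒m≤1+n u)
    σ′ = childQ n σ j
    e₁ : (1 ≤ᵇ j) ≡ true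
    e₁ = T⇒≡ (≤⇒≤ᵇ l)
    e₀ : (j ≡ᵇ 0) ≡ false
    e₀ = ¬T⇒≡ {j ≡ᵇ 0} λ t → <⇒≢ l (sym (≡ᵇ-elim t))
    eL : (j ≡ᵇ L) ≡ false
    eL = ¬T⇒≡ {j ≡ᵇ L} λ t → <⇒≢ (s≤s u) (trans (≡ᵇ-elim {j} t) len)

  private
    plateauWith-≥L : ∀ g {i} → L ≤ i → ind (plateauWith g σ i) ≡ 0
    plateauWith-≥L g {i} p = ind-¬T {plateauWith g σ i} λ t → <⇒≱ (Plateau.i<L (plateauOf {g} {i} t)) p

    drop2 : ∀ {a b x y} → x ≡ 0 → y ≡ 0 → a + (x + y) ≡ b → a ≡ b
    drop2 refl refl e = drop0 e

  -- There is no plateau at 0 or 1 and no block at 0, so gap 0 breaks nothing. `cap` is unchanged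
  -- since both n and the number of blocks of size 2 grow by one.
  stat-first : statQ (suc n) (childQ n σ 0) ≡ newFix (statQ n σ)
  stat-first =
    stat≡ pap′ (trans (cap≡ (suc n) σ′)
      (trans (cong (suc n ∸_) (trans (cong₂ _+_ (cong₂ _+_ pap′ impap′) bk′) (+-suc _ _))) (sym (cap≡ n σ)))) impap′ bk′
    even-child tr-child
    where
    open At {0} z≤n
    σ′ = childQ n σ 0
    pap′ : pap (2 + n) σ′ ≡ pap (suc n) σ
    pap′ = drop0 pap-child
    impap′ : impap (2 + n) σ′ ≡ impap (suc n) σ
    impap′ = drop0 impap-child
    bk′ : bk₂ σ′ ≡ suc (bk₂ σ)
    bk′ = drop2 blockInd-0 blockInd-0 bk₂-child

  -- The last gap could break only a plateau or block of size 2 at the very end, and there is none.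
  -- The first new letter stands at the even position 2n + 2, whence the factor p.
  stat-last : statQ (suc n) (childQ n σ (suc (n + n))) ≡ newSingle (statQ n σ)
  stat-last = stat≡ pap′
    (trans (cap≡ (suc n) σ′)
      (trans (cong (suc n ∸_)
      (trans (cong₂ _+_ (cong₂ _+_ pap′ impap′) bk′) (cong (_+ bk₂ σ) (+-suc (pap (suc n) σ) _))))
    (sym (cap≡ n σ)))) impap′ bk′
    (trans even-child (cong (λ a → ind a + even σ) (evenᵇ-double n)))
    (trans tr-child (cong (λ a → ind a + tr (suc n) σ) eL))
    where
    j = suc (n + n)
    open At {j} ≤-refl
    σ′ = childQ n σ j
    eL : (j ≡ᵇ L) ≡ true
    eL = T⇒≡ (≡ᵇ-intro {j} (sym len))
    L≤j = ≤-reflexive len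
    pap′ : pap (2 + n) σ′ ≡ pap (suc n) σ
    pap′ = drop2 (plateauWith-≥L (not ∘ inRlmin σ) L≤j) (plateauWith-≥L (not ∘ inRlmin σ) (m≤n⇒m≤1+n L≤j))
      (trans pap-child (cong (λ a → ind (not a) + pap (suc n) σ) eL))
    impap′ : impap (2 + n) σ′ ≡ suc (impap (suc n) σ)
    impap′ = drop2 (plateauWith-≥L (inRlmin σ) L≤j) (plateauWith-≥L (inRlmin σ) (m≤n⇒m≤1+n L≤j))
      (trans impap-child (cong (λ a → ind a + impap (suc n) σ) eL))
    bk′ : bk₂ σ′ ≡ bk₂ σ
    bk′ = drop2 blockInd-L blockInd-L∸1 bk₂-child

  stat-gaps : ∀ e gap → Balanced gap → (∀ {k} → 1 ≤ k → k ≤ n → 1 ≤ gap k × gap k ≤ n + n × evenᵇ (suc (gap k)) ≡ e) →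
              map (statQ (suc n) ∘ childQ n σ) (map gap (range 1 n)) ↭ map (λ k → split k e (statQ n σ)) (kinds (statQ n σ))
  stat-gaps e gap bal inner = begin
    map (statQ (suc n) ∘ childQ n σ) (map gap (range 1 n))
      ≡⟨ map-∘ (range 1 n) ⟨
    map (statQ (suc n) ∘ childQ n σ ∘ gap) (range 1 n)
      ≡⟨ map-cong-∈ (range 1 n) (λ {k} k∈ → let l , u = ∈-range⁻ {1} {n} k∈ ; l′ , u′ , eq = inner l u in
           trans (stat-inner l′ u′) (cong (λ b → split (gapKind (gap k)) b (statQ n σ)) eq)) ⟩
    map (λ k → split (gapKind (gap k)) e (statQ n σ)) (range 1 n)
      ≡⟨ map-∘ (range 1 n) ⟩
    map (λ k → split k e (statQ n σ)) (map (gapKind ∘ gap) (range 1 n))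
      ↭⟨ map⁺ _ (kinds-↭ n (gapKind ∘ gap) {p = even σ} {q = tr (suc n) σ} #exc #aexc #single #fix) ⟩
    map (λ k → split k e (statQ n σ)) (kinds (statQ n σ)) ∎
    where
    open PermutationReasoning
    open Balanced bal

  stat-evens : map (statQ (suc n) ∘ childQ n σ) (evens n) ↭ map (λ k → split k false (statQ n σ)) (kinds (statQ n σ))
  stat-evens = stat-gaps false (λ k → k + k) balanced-evens λ {k} l u →
    ≤-trans l (m≤m+n k k) , +-mono-≤ u u , evenᵇ-suc-double k

  stat-odds : map (statQ (suc n) ∘ childQ n σ) (odds n) ↭ map (λ k → split k true (statQ n σ)) (kinds (statQ n σ))
  stat-odds = stat-gaps true (λ k → pred (k + k)) balanced-odds inner
    where
    inner : ∀ {k} → 1 ≤ k → k ≤ n → 1 ≤ pred (k + k) × pred (k + k) ≤ n + n × evenᵇ (suc (pred (k + k))) ≡ true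
    inner {suc k} _ u =
      ≤-trans (s≤s z≤n) (≤-reflexive (sym (pred-double k))) , ≤-trans (n≤1+n _) (+-mono-≤ u u) , evenᵇ-double (suc k)

Q-recursion : ∀ n → map (statQ (suc n)) (Q (2 + n)) ↭ concatMap offspring (map (statQ n) (Q (suc n)))
Q-recursion n = recursion-↭ (statQ n) (statQ (suc n)) (childQ n) (Q (suc n)) (gaps n) (Q-suc n) λ {σ} σ∈ →
  let open Gaps {n} {σ} σ∈ in
  offspring-↭ (statQ (suc n)) (childQ n σ) (statQ n σ) 0 (suc (n + n)) (evens n) (odds n) stat-first stat-last stat-evens stat-odds

-- Signed permutations

open Z using (+_; -_)

module SignedWord = Index atZ (λ _ _ → refl) (λ _ _ _ → refl)

<ℤ-intro : ∀ {a b} → a Z.< b → T (a <ℤ b)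
<ℤ-intro a<b = not-intro λ b≤a → Zₚ.<⇒≱ a<b (Zₚ.≤ᵇ⇒≤ b≤a)

<ℤ-elim : ∀ {a b} → T (a <ℤ b) → a Z.< b
<ℤ-elim p = Zₚ.≰⇒> λ b≤a → not-elim p (Zₚ.≤⇒≤ᵇ b≤a)

≡ℤ-intro : ∀ {a b} → a ≡ b → T (a ≡ℤ b)
≡ℤ-intro {a} refl = ∧-intro {a ≤ℤ a} {a ≤ℤ a} (Zₚ.≤⇒≤ᵇ (Zₚ.≤-refl {a})) (Zₚ.≤⇒≤ᵇ (Zₚ.≤-refl {a}))

≡ℤ-elim : ∀ {a b} → T (a ≡ℤ b) → a ≡ b
≡ℤ-elim {a} {b} p = let q , r = ∧-elim {a ≤ℤ b} p in Zₚ.≤-antisym (Zₚ.≤ᵇ⇒≤ q) (Zₚ.≤ᵇ⇒≤ r)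

signed : Bool → ℕ → ℤ
signed e k = if e then - (+ k) else + k

∣signed∣ : ∀ e k → ∣ signed e k ∣ ≡ k
∣signed∣ true  k = Zₚ.∣-i∣≡∣i∣ (+ k)
∣signed∣ false k = refl

signed-injective : ∀ {e e′ n} → signed e (suc n) ≡ signed e′ (suc n) → e ≡ e′
signed-injective {true}  {true}  _ = refl
signed-injective {false} {false} _ = refl
signed-injective {true}  {false} ()
signed-injective {false} {true}  ()

signed-view : ∀ i → ∃ λ e → i ≡ signed e ∣ i ∣
signed-view (+ k)    = false , refl
signed-view -[1+ k ] = true , refl

<+suc : ∀ {c n} → ∣ c ∣ ≤ n → c Z.< + suc n
<+suc {+ k}       k≤n = Z.+<+ (s≤s k≤n)
<+suc { -[1+ k ]} _   = Z.-<+

-suc< : ∀ {c n} → ∣ c ∣ ≤ n → - (+ suc n) Z.< c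
-suc< {+ k}       _   = Z.-<+
-suc< { -[1+ k ]} k<n = Z.-<- k<n

neg-signed : ∀ e n → (signed e (suc n) <ℤ + 0) ≡ e
neg-signed true  n = refl
neg-signed false n = refl

-- Iteration

iter : (ℕ → ℕ) → ℕ → ℕ → ℕ
iter f zero    i = i
iter f (suc r) i = f (iter f r i)

record Permutes (n : ℕ) (f : ℕ → ℕ) : Set where
  field
    into : ∀ {i} → 1 ≤ i → i ≤ n → 1 ≤ f i × f i ≤ n
    inj  : ∀ {i j} → 1 ≤ i → i ≤ n → 1 ≤ j → j ≤ n → f i ≡ f j → i ≡ j
    surj : ∀ {k} → 1 ≤ k → k ≤ n → ∃ λ i → 1 ≤ i × i ≤ n × f i ≡ k

cycleMin : ℕ → (ℕ → ℕ) → ℕ → Bool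
cycleMin n f i = allR 1 n (λ r → i ≤ᵇ iter f r i)

module _ {n f} (F : Permutes n f) where
  open Permutes F

  iter-into : ∀ r {i} → 1 ≤ i → i ≤ n → 1 ≤ iter f r i × iter f r i ≤ n
  iter-into zero    l u = l , u
  iter-into (suc r) l u = let l′ , u′ = iter-into r l u in into l′ u′

  iter-cancel : ∀ a d {i} → 1 ≤ i → i ≤ n → iter f (a + d) i ≡ iter f a i → iter f d i ≡ i
  iter-cancel zero    d l u e = e
  iter-cancel (suc a) d l u e =
    let l₁ , u₁ = iter-into (a + d) l u ; l₂ , u₂ = iter-into a l u
    in iter-cancel a d l u (inj l₁ u₁ l₂ u₂ e)

  -- Among the n + 1 iterates from 0 to n two coincide, and injectivity cancels the common part. The
  -- bound d ≤ n is what makes the n iterates tested in `cyc` sufficient.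
  period : ∀ {i} → 1 ≤ i → i ≤ n → ∃ λ d → 1 ≤ d × d ≤ n × iter f d i ≡ i
  period {i} l u with Fin.pigeonhole (n<1+n n) orbit
    where
    orbit : Fin (suc n) → Fin n
    orbit r = fromℕ< {pred (iter f (toℕ r) i)}
      (let l′ , u′ = iter-into (toℕ r) l u in ≤-trans (≤-reflexive (suc-pred _ {{>-nonZero l′}})) u′)
  ... | a , b , a<b , e = toℕ b ∸ toℕ a , m<n⇒0<n∸m a<b
      , ≤-trans (m∸n≤m (toℕ b) (toℕ a)) (s≤s⁻¹ (Fin.toℕ<n b))
      , iter-cancel (toℕ a) _ l u (trans (cong (λ r → iter f r i) (m+[n∸m]≡n (<⇒≤ a<b)))
          (let la , _ = iter-into (toℕ a) l u ; lb , _ = iter-into (toℕ b) l u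
           in sym (pred-injective {{>-nonZero la}} {{>-nonZero lb}} (Fin.fromℕ<-injective _ _ _ _ e))))

  iter-bounded : ∀ {i d} → 1 ≤ d → iter f d i ≡ i → ∀ r → ∃ λ r′ → r′ < d × iter f r i ≡ iter f r′ i
  iter-bounded p e zero = zero , p , refl
  iter-bounded {i} {d} p e (suc r) with r′ , r′<d , e′ ← iter-bounded p e r with suc r′ ≟ d
  ... | yes refl = zero , p , trans (cong f e′) e
  ... | no ≢d    = suc r′ , ≤∧≢⇒< r′<d ≢d , cong f e′

  -- At most n iterates exhaust the orbit, so the bounded test speaks about all iterates. In this
  -- form it no longer depends on n, and orbits before and after an insertion can be compared.
  cycleMin-elim : ∀ {i} → 1 ≤ i → i ≤ n → T (cycleMin n f i) → ∀ r → i ≤ iter f r i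
  cycleMin-elim {i} l u m r with d , 1≤d , d≤n , e ← period l u with iter-bounded 1≤d e r
  ... | zero   , _   , e′ = ≤-reflexive (sym e′)
  ... | suc r′ , r<d , e′ = subst (i ≤_) (sym e′)
          (≤ᵇ-elim {i} (allR-elim {P = λ r → i ≤ᵇ iter f r i} m (s≤s z≤n) (≤-trans (<⇒≤ r<d) d≤n)))

  cycleMin-intro : ∀ {i} → (∀ r → i ≤ iter f r i) → T (cycleMin n f i)
  cycleMin-intro {i} m = allR-intro {1} {n} {λ r → i ≤ᵇ iter f r i} λ {r} _ _ → ≤⇒≤ᵇ (m r)

-- Inserting the value n + 1 into a signed permutation

-- `c` and `d` are the letters at the two ends of the arc at `h`. In a signed permutation they agree
-- only for a loop, where the sign decides between fixed point and singleton.
kindOf : ℤ → ℤ → ℕ → Kind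
kindOf c d h = if c <ℤ d then excᵏ else if d <ℤ c then aexcᵏ else if c ≡ℤ + h then fixᵏ else singleᵏ

kindOf-< : ∀ {c d h} → c Z.< d → kindOf c d h ≡ excᵏ
kindOf-< c<d rewrite T⇒≡ (<ℤ-intro c<d) = refl

kindOf-> : ∀ {c d h} → d Z.< c → kindOf c d h ≡ aexcᵏ
kindOf-> d<c rewrite ¬T⇒≡ (Zₚ.<-asym d<c ∘ <ℤ-elim) | T⇒≡ (<ℤ-intro d<c) = refl

kindOf-≡ : ∀ {c h} → kindOf c c h ≡ (if c ≡ℤ + h then fixᵏ else singleᵏ)
kindOf-≡ {c} rewrite ¬T⇒≡ (Zₚ.<-irrefl {c} refl ∘ <ℤ-elim) = refl

-- The position enters only when the two letters agree, so an arc that is not a loop keeps its kind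
-- when its starting letter is moved.
kindOf-≢ : ∀ {c d} h h′ → c ≢ d → kindOf c d h ≡ kindOf c d h′
kindOf-≢ {c} {d} h h′ c≢d with Zₚ.<-cmp c d
... | tri< c<d _ _ = trans (kindOf-< c<d) (sym (kindOf-< c<d))
... | tri≈ _ c≡d _ = ⊥-elim (c≢d c≡d)
... | tri> _ _ d<c = trans (kindOf-> d<c) (sym (kindOf-> d<c))

kind : (ℕ → ℤ) → ℕ → Kind
kind p h = kindOf (p h) (p ∣ p h ∣) h

module _ {n p} (F : Permutes n (∣_∣ ∘ p)) where
  open Permutes F

  isExc-kind : ∀ h → isExc (kind p h) ≡ (p h <ℤ p ∣ p h ∣)
  isExc-kind h with p h <ℤ p ∣ p h ∣ | p ∣ p h ∣ <ℤ p h | p h ≡ℤ + h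
  ... | true  | _     | _     = refl
  ... | false | true  | _     = refl
  ... | false | false | true  = refl
  ... | false | false | false = refl

  isAexc-kind : ∀ h → isAexc (kind p h) ≡ (p ∣ p h ∣ <ℤ p h)
  isAexc-kind h with Zₚ.<-cmp (p h) (p ∣ p h ∣)
  ... | tri< c<d _ d≮c rewrite kindOf-< {h = h} c<d = sym (¬T⇒≡ (d≮c ∘ <ℤ-elim))
  ... | tri> _ _ d<c rewrite kindOf-> {h = h} d<c = sym (T⇒≡ (<ℤ-intro d<c))
  ... | tri≈ _ c≡d d≮c rewrite sym c≡d | kindOf-≡ {p h} {h} | ¬T⇒≡ (Zₚ.<-irrefl {p h} refl ∘ <ℤ-elim)
    with p h ≡ℤ + h
  ...   | true  = refl
  ...   | false = refl

  loop : ∀ {h} → 1 ≤ h → h ≤ n → p h ≡ p ∣ p h ∣ → ∣ p h ∣ ≡ h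
  loop l u e = let l′ , u′ = into l u in inj l′ u′ l u (cong ∣_∣ (sym e))

  isFix-kind : ∀ {h} → 1 ≤ h → h ≤ n → isFix (kind p h) ≡ (p h ≡ℤ + h)
  isFix-kind {h} l u with Zₚ.<-cmp (p h) (p ∣ p h ∣)
  ... | tri< c<d c≢d _ rewrite kindOf-< {h = h} c<d =
    sym (¬T⇒≡ λ t → c≢d (cong p (sym (cong ∣_∣ (≡ℤ-elim {p h} t)))))
  ... | tri> _ c≢d d<c rewrite kindOf-> {h = h} d<c =
    sym (¬T⇒≡ λ t → c≢d (cong p (sym (cong ∣_∣ (≡ℤ-elim {p h} t)))))
  ... | tri≈ _ c≡d _ rewrite sym c≡d | kindOf-≡ {p h} {h} with p h ≡ℤ + h
  ...   | true  = refl
  ...   | false = refl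

  isSingle-kind : ∀ {h} → 1 ≤ h → h ≤ n → isSingle (kind p h) ≡ (p h ≡ℤ - (+ h))
  isSingle-kind {h} l u with Zₚ.<-cmp (p h) (p ∣ p h ∣)
  ... | tri< c<d c≢d _ rewrite kindOf-< {h = h} c<d =
    sym (¬T⇒≡ λ t → c≢d (cong p (sym (trans (cong ∣_∣ (≡ℤ-elim {p h} t)) (∣signed∣ true h)))))
  ... | tri> _ c≢d d<c rewrite kindOf-> {h = h} d<c =
    sym (¬T⇒≡ λ t → c≢d (cong p (sym (trans (cong ∣_∣ (≡ℤ-elim {p h} t)) (∣signed∣ true h)))))
  ... | tri≈ _ c≡d _ with loop l u c≡d | signed-view (p h)
  isSingle-kind {suc h} l u | tri≈ _ c≡d _ | a | false , e
    rewrite sym c≡d | kindOf-≡ {p (suc h)} {suc h} | T⇒≡ (≡ℤ-intro (trans e (cong +_ a)))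
    | trans e (cong +_ a) = refl
  isSingle-kind {suc h} l u | tri≈ _ c≡d _ | a | true , e
    rewrite sym c≡d | trans e (cong (λ k → - (+ k)) a) | kindOf-≡ { -[1+ h ]} {suc h} =
      sym (T⇒≡ (≡ℤ-intro { -[1+ h ]} refl))

-- The positions other than `i` are enumerated by 1, ..., n once n + 1 stands in for `i`; this is
-- how the letters are moved when `i` receives the new letter.
σ-count : ∀ n i P′ → 1 ≤ i → i ≤ n →
          count (suc n) P′ ≡ ind (P′ i) + count n (λ k → P′ (if k ≡ᵇ i then suc n else k))
σ-count n i P′ l u = sym (begin
  ind (P′ i) + count n Q′           ≡⟨ +-comm (ind (P′ i)) _ ⟩
  count n Q′ + ind (P′ i)           ≡⟨ sumTo-update n {ind ∘ Q′} {ind ∘ P′} l u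
    (λ {k} _ _ k≢i → cong (λ b → ind (P′ (if b then suc n else k))) (¬T⇒≡ {k ≡ᵇ i} (k≢i ∘ ≡ᵇ-elim))) ⟩
  count n P′ + ind (Q′ i)           ≡⟨ cong (λ b → count n P′ + ind (P′ (if b then suc n else i)))
    (T⇒≡ {i ≡ᵇ i} (≡ᵇ-intro {i} refl)) ⟩
  count n P′ + ind (P′ (suc n))     ≡⟨ +-comm (count n P′) _ ⟩
  count (suc n) P′                  ∎)
  where
  open ≡-Reasoning
  Q′ = λ k → P′ (if k ≡ᵇ i then suc n else k)

statOf : ℕ → (ℕ → ℤ) → Stat
statOf n p =
  ⟨ count n (isExc ∘ kind p) , count n (isAexc ∘ kind p) , count n (isSingle ∘ kind p) , count n (isFix ∘ kind p)
             , count n (λ i → p i <ℤ + 0) , count n (cycleMin n (∣_∣ ∘ p)) ⟩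

-- The letter ±(n + 1) is put between `p h` and its successor `p ∣ p h ∣` in a cycle. The parameter
-- is the arc `h` and not the position `∣ p h ∣` of the new letter, because the kind that gets lost
-- is the one at `h`.
module Break {n p p′ h e} (F : Permutes n (∣_∣ ∘ p)) (F′ : Permutes (suc n) (∣_∣ ∘ p′))
             (1≤h : 1 ≤ h) (h≤n : h ≤ n)
             (old : ∀ {k} → 1 ≤ k → k ≤ n → k ≢ ∣ p h ∣ → p′ k ≡ p k)
             (hit : p′ ∣ p h ∣ ≡ signed e (suc n))
             (end : p′ (suc n) ≡ p ∣ p h ∣) where
  open Permutes F

  i = ∣ p h ∣
  1≤i = proj₁ (into 1≤h h≤n)
  i≤n = proj₂ (into 1≤h h≤n)
  ∣pi∣≤n = proj₂ (into 1≤i i≤n)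

  -- `σ k` is the position of the letter `p k` in `p′`. Following letters instead of positions
  -- treats a loop, where the displaced letter is `p h` itself, like every other arc.
  σ : ℕ → ℕ
  σ k = if k ≡ᵇ i then suc n else k

  σ-i : ∀ {k} → k ≡ i → σ k ≡ suc n
  σ-i {k} refl rewrite T⇒≡ {k ≡ᵇ k} (≡ᵇ-intro {k} refl) = refl

  σ-≢ : ∀ {k} → k ≢ i → σ k ≡ k
  σ-≢ {k} k≢i rewrite ¬T⇒≡ {k ≡ᵇ i} (k≢i ∘ ≡ᵇ-elim) = refl

  p′σ : ∀ {k} → 1 ≤ k → k ≤ n → p′ (σ k) ≡ p k
  p′σ {k} l u with k ≟ i
  ... | yes refl = trans (cong p′ (σ-i refl)) end
  ... | no k≢i   = trans (cong p′ (σ-≢ k≢i)) (old l u k≢i)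

  -- The arc at i = |p h| moves to n + 1, so along σ only the kind at h changes, and i becomes a new arc.
  kind-σ : ∀ {k} → 1 ≤ k → k ≤ n → k ≢ h → kind p′ (σ k) ≡ kind p k
  kind-σ {k} l u k≢h = trans
    (cong₂ (λ c d → kindOf c d (σ k)) e₁ (trans (cong (λ c → p′ ∣ c ∣) e₁) e₂))
    same
    where
    e₁ = p′σ l u
    pk≢i : ∣ p k ∣ ≢ i
    pk≢i eq = k≢h (inj l u 1≤h h≤n eq)
    e₂ : p′ ∣ p k ∣ ≡ p ∣ p k ∣
    e₂ = let l′ , u′ = into l u in old l′ u′ pk≢i
    same : kindOf (p k) (p ∣ p k ∣) (σ k) ≡ kind p k
    same with k ≟ i
    ... | no k≢i rewrite σ-≢ k≢i = refl
    -- Only this arc changes its position. It is no loop: otherwise `∣ p k ∣` would be `i`, contrary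
    -- to `pk≢i`.
    ... | yes k≡i = kindOf-≢ {p k} {p ∣ p k ∣} (σ k) k λ c≡d → pk≢i (trans (loop {p = p} F l u c≡d) k≡i)

  -- The letter n + 1 is larger and -(n + 1) smaller than all other letters. So, of the arcs into
  -- and out of the new letter, one is an excedance and the other an anti-excedance, in an order
  -- given by the sign.
  kind-σh : kind p′ (σ h) ≡ (if e then aexcᵏ else excᵏ)
  kind-σh = trans
    (cong₂ (λ c d → kindOf c d (σ h)) (p′σ 1≤h h≤n) (trans (cong (λ c → p′ ∣ c ∣) (p′σ 1≤h h≤n)) hit)) (go e)
    where
    go : ∀ e → kindOf (p h) (signed e (suc n)) (σ h) ≡ (if e then aexcᵏ else excᵏ)
    go true  = kindOf-> {h = σ h} (-suc< {p h} i≤n)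
    go false = kindOf-< {h = σ h} (<+suc {p h} i≤n)

  kind-i : kind p′ i ≡ (if e then excᵏ else aexcᵏ)
  kind-i = trans
    (cong₂ (λ c d → kindOf c d i) hit
      (trans (cong (λ c → p′ ∣ c ∣) hit) (trans (cong p′ (∣signed∣ e (suc n))) end))) (go e)
    where
    go : ∀ e → kindOf (signed e (suc n)) (p i) i ≡ (if e then excᵏ else aexcᵏ)
    go true  = kindOf-< {h = i} (-suc< {p i} ∣pi∣≤n)
    go false = kindOf-> {h = i} (<+suc {p i} ∣pi∣≤n)

  count-kind : ∀ f →
    count (suc n) (f ∘ kind p′) + ind (f (kind p h)) ≡ (ind (f excᵏ) + ind (f aexcᵏ)) + count n (f ∘ kind p)
  count-kind f = begin
    count (suc n) (f ∘ kind p′) + ind (f (kind p h))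
      ≡⟨ cong (λ z → z + ind (f (kind p h))) (σ-count n i (f ∘ kind p′) 1≤i i≤n) ⟩
    (ind (f (kind p′ i)) + count n (f ∘ kind p′ ∘ σ)) + ind (f (kind p h))
      ≡⟨ +-assoc (ind (f (kind p′ i))) _ _ ⟩
    ind (f (kind p′ i)) + (count n (f ∘ kind p′ ∘ σ) + ind (f (kind p h)))
      ≡⟨ cong (λ z → ind (f (kind p′ i)) + z) (sumTo-update n 1≤h h≤n λ l u k≢h → cong (ind ∘ f) (kind-σ l u k≢h)) ⟩
    ind (f (kind p′ i)) + (count n (f ∘ kind p) + ind (f (kind p′ (σ h))))
      ≡⟨ cong (λ z → ind (f (kind p′ i)) + z) (+-comm (count n (f ∘ kind p)) _) ⟩
    ind (f (kind p′ i)) + (ind (f (kind p′ (σ h))) + count n (f ∘ kind p))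
      ≡⟨ +-assoc (ind (f (kind p′ i))) _ _ ⟨
    (ind (f (kind p′ i)) + ind (f (kind p′ (σ h)))) + count n (f ∘ kind p)
      ≡⟨ cong₂ (λ a b → (ind (f a) + ind (f b)) + count n (f ∘ kind p)) kind-i kind-σh ⟩
    (ind (f (if e then excᵏ else aexcᵏ)) + ind (f (if e then aexcᵏ else excᵏ))) + count n (f ∘ kind p)
      ≡⟨ cong (λ z → z + count n (f ∘ kind p)) (swp e) ⟩
    (ind (f excᵏ) + ind (f aexcᵏ)) + count n (f ∘ kind p) ∎
    where
    open ≡-Reasoning
    swp : ∀ e → ind (f (if e then excᵏ else aexcᵏ)) + ind (f (if e then aexcᵏ else excᵏ)) ≡ ind (f excᵏ) + ind (f aexcᵏ)
    swp true  = refl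
    swp false = +-comm (ind (f aexcᵏ)) _

  count-neg : count (suc n) (λ k → p′ k <ℤ + 0) ≡ ind e + count n (λ k → p k <ℤ + 0)
  count-neg = trans (σ-count n i _ 1≤i i≤n) (cong₂ _+_
    (cong ind (trans (cong (_<ℤ + 0) hit) (neg-signed e n)))
    (count-cong n λ l u → cong (_<ℤ + 0) (p′σ l u)))

  f f′ : ℕ → ℕ
  f  = ∣_∣ ∘ p
  f′ = ∣_∣ ∘ p′

  f′-i : f′ i ≡ suc n
  f′-i = trans (cong ∣_∣ hit) (∣signed∣ e (suc n))

  -- The step out of `i` becomes two steps, by way of n + 1; all other steps stay the same.
  -- Conversely, n + 1 is met only directly behind `i`.
  iter⇒iter′ : ∀ {k} → 1 ≤ k → k ≤ n → ∀ r → ∃ λ r′ → iter f r k ≡ iter f′ r′ k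
  iter⇒iter′ l u zero = zero , refl
  iter⇒iter′ {k} l u (suc r) with r′ , e′ ← iter⇒iter′ l u r with iter f r k ≟ i
  ... | no ≢i  = suc r′ , trans (cong ∣_∣ (sym (let l′ , u′ = iter-into F r l u in old l′ u′ ≢i))) (cong f′ e′)
  ... | yes ≡i = suc (suc r′) , trans (trans (cong f ≡i) (cong ∣_∣ (sym end))) (cong f′ (trans (sym f′-i) (cong f′ (trans (sym ≡i) e′))))

  iter′⇒iter : ∀ {k} → 1 ≤ k → k ≤ n → ∀ r →
               ∃ λ r′ → iter f′ r k ≡ iter f r′ k ⊎ (iter f′ r k ≡ suc n × iter f r′ k ≡ i)
  iter′⇒iter l u zero = zero , inj₁ refl
  iter′⇒iter {k} l u (suc r) with iter′⇒iter l u r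
  ... | r′ , inj₂ (e₁ , e₂) = suc r′ , inj₁ (trans (cong f′ e₁) (trans (cong ∣_∣ end) (cong f (sym e₂))))
  ... | r′ , inj₁ e₁ with iter f r′ k ≟ i
  ...   | no ≢i = suc r′ , inj₁ (trans (cong f′ e₁) (cong ∣_∣ (let l′ , u′ = iter-into F r′ l u in old l′ u′ ≢i)))
  ...   | yes ≡i = r′ , inj₂ (trans (cong f′ (trans e₁ ≡i)) f′-i , ≡i)

  -- The orbits differ at most by the element n + 1, which is larger than `k` and cannot disturb its
  -- minimality.
  cycleMin-old : ∀ {k} → 1 ≤ k → k ≤ n → cycleMin (suc n) f′ k ≡ cycleMin n f k
  cycleMin-old {k} l u = T-ext
    (λ m → cycleMin-intro F λ r → let r′ , e′ = iter⇒iter′ l u r in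
       subst (k ≤_) (sym e′) (cycleMin-elim F′ l (m≤n⇒m≤1+n u) m r′))
    (λ m → cycleMin-intro F′ λ r → case′ m r (iter′⇒iter l u r))
    where
    case′ : T (cycleMin n f k) → ∀ r →
      (∃ λ r′ → iter f′ r k ≡ iter f r′ k ⊎ (iter f′ r k ≡ suc n × iter f r′ k ≡ i)) → k ≤ iter f′ r k
    case′ m r (r′ , inj₁ e′)       = subst (k ≤_) (sym e′) (cycleMin-elim F l u m r′)
    case′ m r (r′ , inj₂ (e′ , _)) = subst (k ≤_) (sym e′) (m≤n⇒m≤1+n u)

  cycleMin-N : cycleMin (suc n) f′ (suc n) ≡ false
  cycleMin-N = ¬T⇒≡ λ m → <⇒≱ (s≤s ∣pi∣≤n)
    (subst (suc n ≤_) (cong ∣_∣ end) (cycleMin-elim F′ (s≤s z≤n) ≤-refl m 1))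

  count-cyc : count (suc n) (cycleMin (suc n) f′) ≡ count n (cycleMin n f)
  count-cyc = cong₂ _+_ (cong ind cycleMin-N) (count-cong n cycleMin-old)

  stat-break : statOf (suc n) p′ ≡ split (kind p h) e (statOf n p)
  stat-break with kind p h | count-kind isExc | count-kind isAexc | count-kind isSingle | count-kind isFix
  ... | excᵏ  | a | b | c | d = stat≡ (suc-injective (trans (+-comm 1 _) a)) (drop0 b) (drop0 c) (drop0 d) count-neg count-cyc
  ... | aexcᵏ  | a | b | c | d = stat≡ (drop0 a) (suc-injective (trans (+-comm 1 _) b)) (drop0 c) (drop0 d) count-neg count-cyc
  ... | singleᵏ  | a | b | c | d = stat≡ (drop0 a) (drop0 b) (cong pred (trans (+-comm 1 _) c)) (drop0 d) count-neg count-cyc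
  ... | fixᵏ | a | b | c | d = stat≡ (drop0 a) (drop0 b) (drop0 c) (cong pred (trans (+-comm 1 _) d)) count-neg count-cyc

module Append {n p p′ e} (F : Permutes n (∣_∣ ∘ p)) (F′ : Permutes (suc n) (∣_∣ ∘ p′))
             (old : ∀ {k} → 1 ≤ k → k ≤ n → p′ k ≡ p k)
             (end : p′ (suc n) ≡ signed e (suc n)) where
  open Permutes F

  kind-old : ∀ {k} → 1 ≤ k → k ≤ n → kind p′ k ≡ kind p k
  kind-old {k} l u = cong₂ (λ c d → kindOf c d k) (old l u)
    (trans (cong (λ c → p′ ∣ c ∣) (old l u)) (let l′ , u′ = into l u in old l′ u′))

  kind-N : kind p′ (suc n) ≡ (if e then singleᵏ else fixᵏ)
  kind-N = trans
    (cong₂ (λ c d → kindOf c d (suc n)) end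
      (trans (cong (λ c → p′ ∣ c ∣) end) (trans (cong p′ (∣signed∣ e (suc n))) end)))
    (trans (kindOf-≡ {signed e (suc n)} {suc n}) (go e))
    where
    go : ∀ e → (if signed e (suc n) ≡ℤ + suc n then fixᵏ else singleᵏ) ≡ (if e then singleᵏ else fixᵏ)
    go true  = refl
    go false rewrite T⇒≡ (≡ℤ-intro {+ suc n} refl) = refl

  count-kind : ∀ g → count (suc n) (g ∘ kind p′) ≡ ind (g (if e then singleᵏ else fixᵏ)) + count n (g ∘ kind p)
  count-kind g = cong₂ _+_ (cong (ind ∘ g) kind-N) (count-cong n λ l u → cong g (kind-old l u))

  count-neg : count (suc n) (λ k → p′ k <ℤ + 0) ≡ ind e + count n (λ k → p k <ℤ + 0)
  count-neg = cong₂ _+_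
    (cong ind (trans (cong (_<ℤ + 0) end) (neg-signed e n)))
    (count-cong n λ l u → cong (_<ℤ + 0) (old l u))

  f f′ : ℕ → ℕ
  f  = ∣_∣ ∘ p
  f′ = ∣_∣ ∘ p′

  iter-old : ∀ {k} → 1 ≤ k → k ≤ n → ∀ r → iter f′ r k ≡ iter f r k
  iter-old l u zero    = refl
  iter-old l u (suc r) = trans (cong f′ (iter-old l u r)) (cong ∣_∣ (let l′ , u′ = iter-into F r l u in old l′ u′))

  iter-N : ∀ r → iter f′ r (suc n) ≡ suc n
  iter-N zero    = refl
  iter-N (suc r) = trans (cong f′ (iter-N r)) (trans (cong ∣_∣ end) (∣signed∣ e (suc n)))

  cycleMin-old : ∀ {k} → 1 ≤ k → k ≤ n → cycleMin (suc n) f′ k ≡ cycleMin n f k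
  cycleMin-old {k} l u = T-ext
    (λ m → cycleMin-intro F λ r → subst (k ≤_) (iter-old l u r) (cycleMin-elim F′ l (m≤n⇒m≤1+n u) m r))
    (λ m → cycleMin-intro F′ λ r → subst (k ≤_) (sym (iter-old l u r)) (cycleMin-elim F l u m r))

  count-cyc : count (suc n) (cycleMin (suc n) f′) ≡ suc (count n (cycleMin n f))
  count-cyc = cong₂ _+_ (cong ind (T⇒≡ (cycleMin-intro F′ λ r → ≤-reflexive (sym (iter-N r)))))
    (count-cong n cycleMin-old)

  stat-append : statOf (suc n) p′ ≡ (if e then newSingle else newFix) (statOf n p)
  stat-append = go e refl
    where
    go : ∀ e′ → e ≡ e′ → statOf (suc n) p′ ≡ (if e′ then newSingle else newFix) (statOf n p)
    go true  refl =
      stat≡ (count-kind isExc) (count-kind isAexc) (count-kind isSingle) (count-kind isFix) count-neg count-cyc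
    go false refl =
      stat≡ (count-kind isExc) (count-kind isAexc) (count-kind isSingle) (count-kind isFix) count-neg count-cyc

-- Signed permutations as words, and insertion of the letter of largest absolute value

letters : ℕ → List ℤ
letters n = map (λ k → + k) (range 1 n) ++ map (λ k → - (+ k)) (range 1 n)

signedWords≡wordsOver : ∀ n ℓ → signedWords n ℓ ≡ wordsOver (letters n) ℓ
signedWords≡wordsOver n zero    = refl
signedWords≡wordsOver n (suc ℓ) = trans
  (cong (λ ws → concatMap (λ a → map (a ∷_) ws) (letters n)) (signedWords≡wordsOver n ℓ))
  (concatMap≡cartesianProductWith _∷_ (letters n) (wordsOver (letters n) ℓ))

letters-unique : ∀ n → Unique (letters n)
letters-unique n = Uniq.++⁺ (Uniq.map⁺ Zₚ.+-injective (range-unique 1 n))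
  (Uniq.map⁺ (λ e → Zₚ.+-injective (Zₚ.neg-injective e)) (range-unique 1 n)) disj
  where
  disj : ∀ {a} → ¬ (a ∈ map (λ k → + k) (range 1 n) × a ∈ map (λ k → - (+ k)) (range 1 n))
  disj (p , q) with j , _ , refl ← ∈-map⁻ (λ k → + k) p with k , k∈ , e ← ∈-map⁻ (λ k → - (+ k)) q
    with k | proj₁ (∈-range⁻ {1} {n} k∈) | e
  ... | suc k′ | _ | ()

∈-letters : ∀ {n a} → 1 ≤ ∣ a ∣ → ∣ a ∣ ≤ n → a ∈ letters n
∈-letters {n} {a} l u with signed-view a
... | false , e = ∈-++⁺ˡ (subst (_∈ map (λ k → + k) (range 1 n)) (sym e) (∈-map⁺ (λ k → + k) (∈-range⁺ l u)))
... | true  , e = ∈-++⁺ʳ _ (subst (_∈ map (λ k → - (+ k)) (range 1 n)) (sym e) (∈-map⁺ (λ k → - (+ k)) (∈-range⁺ l u)))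

record SignedPerm (n : ℕ) (p : ℕ → ℤ) : Set where
  field
    rng : ∀ {k} → 1 ≤ k → k ≤ n → 1 ≤ ∣ p k ∣ × ∣ p k ∣ ≤ n
    one : ∀ {v} → 1 ≤ v → v ≤ n → count n (λ k → ∣ p k ∣ ≡ᵇ v) ≡ 1

  permutes : Permutes n (∣_∣ ∘ p)
  permutes = record
    { into = rng
    ; inj  = λ {i} {j} l u l′ u′ e → inj′ l u l′ u′ e (i ≟ j)
    ; surj = λ l u → let i , l′ , u′ , t = count-witness n (≤-reflexive (sym (one l u))) in i , l′ , u′ , ≡ᵇ-elim t
    }
    where
    inj′ : ∀ {i j} → 1 ≤ i → i ≤ n → 1 ≤ j → j ≤ n → ∣ p i ∣ ≡ ∣ p j ∣ → _ → i ≡ j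
    inj′ l u l′ u′ e (yes i≡j) = i≡j
    inj′ {i} {j} l u l′ u′ e (no i≢j) = ⊥-elim (<-irrefl refl (subst (2 ≤_) (let l″ , u″ = rng l u in one l″ u″)
      (count-≥2 n {λ k → ∣ p k ∣ ≡ᵇ ∣ p i ∣} l u l′ u′ i≢j (≡ᵇ-intro {∣ p i ∣} refl) (≡ᵇ-intro (sym e)))))

SignedPerm-cong : ∀ {n p p′} → (∀ {k} → 1 ≤ k → k ≤ n → p′ k ≡ p k) → SignedPerm n p → SignedPerm n p′
SignedPerm-cong {n} e S = record
  { rng = λ l u → subst (λ a → 1 ≤ ∣ a ∣ × ∣ a ∣ ≤ n) (sym (e l u)) (SignedPerm.rng S l u)
  ; one = λ {v} l u → trans (count-cong n λ l′ u′ → cong (λ a → ∣ a ∣ ≡ᵇ v) (e l′ u′)) (SignedPerm.one S l u)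
  }

∈-SB⁻ : ∀ {n π} → π ∈ SB n → length π ≡ n × SignedPerm n (atZ π)
∈-SB⁻ {n} {π} π∈ with w , t ← ∈-filter⁻ (T? ∘ isSignedPerm n) {xs = signedWords n n} π∈
  with tl , t′ ← ∧-elim {length π ≡ᵇ n} t
  with ta , tc ← ∧-elim {allB (λ a → (1 ≤ᵇ ∣ a ∣) ∧ (∣ a ∣ ≤ᵇ n)) π} t′
  with refl ← ≡ᵇ-elim {length π} {n} tl = refl , record
  { rng = λ {k} l u → let p , q = ∧-elim {1 ≤ᵇ ∣ atZ π k ∣} (allB-elim {P = λ a → (1 ≤ᵇ ∣ a ∣) ∧ (∣ a ∣ ≤ᵇ n)} {π} ta (SignedWord.‼-∈ {π} {k} l u)) in
          ≤ᵇ-elim {1} p , ≤ᵇ-elim {∣ atZ π k ∣} q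
  ; one = λ {v} l u → trans (sym (SignedWord.countB-‼ (λ a → ∣ a ∣ ≡ᵇ v) π))
          (≡ᵇ-elim (allR-elim {P = λ k → countB (λ a → ∣ a ∣ ≡ᵇ k) π ≡ᵇ 1} tc l u))
  }

∈-SB⁺ : ∀ {n π} → length π ≡ n → SignedPerm n (atZ π) → π ∈ SB n
∈-SB⁺ {n} {π} refl S = ∈-filter⁺ (T? ∘ isSignedPerm n)
  (subst (π ∈_) (sym (signedWords≡wordsOver n n)) (∈-wordsOver⁺ n refl λ a∈ → let l , u = rng′ a∈ in ∈-letters l u))
  (∧-intro {length π ≡ᵇ n} (≡ᵇ-intro {length π} refl)
    (∧-intro {allB (λ a → (1 ≤ᵇ ∣ a ∣) ∧ (∣ a ∣ ≤ᵇ n)) π}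
      (allB-intro λ {a} a∈ → let l , u = rng′ a∈ in ∧-intro {1 ≤ᵇ ∣ a ∣} (≤⇒≤ᵇ l) (≤⇒≤ᵇ u))
      (allR-intro {1} {n} λ {v} l u → ≡ᵇ-intro (trans (SignedWord.countB-‼ (λ a → ∣ a ∣ ≡ᵇ v) π) (one l u)))))
  where
  open SignedPerm S
  rng′ : ∀ {a} → a ∈ π → 1 ≤ ∣ a ∣ × ∣ a ∣ ≤ n
  rng′ a∈ with k , l , u , refl ← SignedWord.∈-‼ a∈ = rng l u

SB-unique : ∀ n → Unique (SB n)
SB-unique n = Uniq.filter⁺ (T? ∘ isSignedPerm n)
  (subst Unique (sym (signedWords≡wordsOver n n)) (wordsOver-unique (letters-unique n) n))

-- The letter ±(n+1) is put at position i, and the letter it displaces goes to position n+1;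
-- for i = n+1 this creates a new cycle.

insertLetter : ℕ → (ℕ → ℤ) → ℕ × Bool → ℕ → ℤ
insertLetter n p (i , e) k = if k ≡ᵇ i then signed e (suc n) else if k ≡ᵇ suc n then p i else p k

module _ (n : ℕ) (p : ℕ → ℤ) (i : ℕ) (e : Bool) where

  private p′ = insertLetter n p (i , e)

  insertLetter-at : p′ i ≡ signed e (suc n)
  insertLetter-at rewrite T⇒≡ {i ≡ᵇ i} (≡ᵇ-intro {i} refl) = refl

  insertLetter-end : i ≤ n → p′ (suc n) ≡ p i
  insertLetter-end i≤n rewrite ¬T⇒≡ {suc n ≡ᵇ i} (λ t → <⇒≱ (s≤s i≤n) (≤-reflexive (≡ᵇ-elim t)))
                             | T⇒≡ {n ≡ᵇ n} (≡ᵇ-intro {n} refl) = refl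

  insertLetter-old : ∀ {k} → k ≤ n → k ≢ i → p′ k ≡ p k
  insertLetter-old {k} k≤n k≢i rewrite ¬T⇒≡ {k ≡ᵇ i} (k≢i ∘ ≡ᵇ-elim)
                                     | ¬T⇒≡ {k ≡ᵇ suc n} (λ t → <⇒≢ (s≤s k≤n) (≡ᵇ-elim {k} t)) = refl

  count-insertLetter : 1 ≤ i → i ≤ suc n → (P : ℤ → Bool) →
    count (suc n) (P ∘ p′) ≡ ind (P (signed e (suc n))) + count n (P ∘ p)
  count-insertLetter l u P with i ≟ suc n
  ... | yes refl = cong₂ _+_ (cong (ind ∘ P) insertLetter-at)
    (count-cong n λ _ u′ → cong P (insertLetter-old u′ (<⇒≢ (s≤s u′))))
  ... | no i≢ = trans (σ-count n i (P ∘ p′) l i≤n)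
    (cong₂ _+_ (cong (ind ∘ P) insertLetter-at) (count-cong n go))
    where
    i≤n = s≤s⁻¹ (≤∧≢⇒< u i≢)
    go : ∀ {k} → 1 ≤ k → k ≤ n → P (p′ (if k ≡ᵇ i then suc n else k)) ≡ P (p k)
    go {k} _ u′ with k ≟ i
    ... | yes refl rewrite T⇒≡ {k ≡ᵇ k} (≡ᵇ-intro {k} refl) = cong P (insertLetter-end i≤n)
    ... | no k≢i = trans (cong (λ b → P (p′ (if b then suc n else k))) (¬T⇒≡ {k ≡ᵇ i} (k≢i ∘ ≡ᵇ-elim)))
                         (cong P (insertLetter-old u′ k≢i))

insertLetter-∣∣ : ∀ n p i e {k} → 1 ≤ i → i ≤ suc n → (∀ {k} → 1 ≤ k → k ≤ n → 1 ≤ ∣ p k ∣ × ∣ p k ∣ ≤ n) →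
                  1 ≤ k → k ≤ suc n → k ≢ i →
                  1 ≤ ∣ insertLetter n p (i , e) k ∣ × ∣ insertLetter n p (i , e) k ∣ ≤ n
insertLetter-∣∣ n p i e {k} l u rng l′ u′ k≢i with k ≟ suc n
... | no k≢  = let k≤n = s≤s⁻¹ (≤∧≢⇒< u′ k≢) in
  subst (λ a → 1 ≤ ∣ a ∣ × ∣ a ∣ ≤ n) (sym (insertLetter-old n p i e k≤n k≢i)) (rng l′ k≤n)
... | yes refl = let i≤n = s≤s⁻¹ (≤∧≢⇒< u (k≢i ∘ sym)) in
  subst (λ a → 1 ≤ ∣ a ∣ × ∣ a ∣ ≤ n) (sym (insertLetter-end n p i e i≤n)) (rng l i≤n)

insertLetter-SignedPerm : ∀ {n p i e} → 1 ≤ i → i ≤ suc n → SignedPerm n p →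
  SignedPerm (suc n) (insertLetter n p (i , e))
insertLetter-SignedPerm {n} {p} {i} {e} l u S = record { rng = rng′ ; one = one′ }
  where
  open SignedPerm S
  rng′ : ∀ {k} → 1 ≤ k → k ≤ suc n → 1 ≤ ∣ insertLetter n p (i , e) k ∣ × ∣ insertLetter n p (i , e) k ∣ ≤ suc n
  rng′ {k} l′ u′ with k ≟ i
  ... | no k≢i = let a , b = insertLetter-∣∣ n p i e l u rng l′ u′ k≢i in a , m≤n⇒m≤1+n b
  ... | yes refl = let eq = trans (cong ∣_∣ (insertLetter-at n p k e)) (∣signed∣ e (suc n)) in
    subst (1 ≤_) (sym eq) (s≤s z≤n) , ≤-reflexive eq
  one′ : ∀ {v} → 1 ≤ v → v ≤ suc n → count (suc n) (λ k → ∣ insertLetter n p (i , e) k ∣ ≡ᵇ v) ≡ 1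
  one′ {v} l′ u′ = trans (count-insertLetter n p i e l u (λ a → ∣ a ∣ ≡ᵇ v))
    (trans (cong (λ a → ind (a ≡ᵇ v) + count n (λ k → ∣ p k ∣ ≡ᵇ v)) (∣signed∣ e (suc n))) go)
    where
    go : ind (suc n ≡ᵇ v) + count n (λ k → ∣ p k ∣ ≡ᵇ v) ≡ 1
    go with v ≟ suc n
    ... | yes refl = cong₂ _+_ (ind-T {n ≡ᵇ n} (≡ᵇ-intro {n} refl))
      (sumTo-zero n λ {k} l″ u″ → ind-¬T {∣ p k ∣ ≡ᵇ suc n} λ t →
        <⇒≢ (s≤s (proj₂ (rng l″ u″))) (≡ᵇ-elim t))
    ... | no v≢ = cong₂ _+_ (ind-¬T {suc n ≡ᵇ v} (λ t → v≢ (sym (≡ᵇ-elim t)))) (one l′ (s≤s⁻¹ (≤∧≢⇒< u′ v≢)))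

-- The letter at n + 1 goes back to the position `i` of ±(n + 1). For i = n + 1 the new letter is a
-- cycle of its own, and cutting off the last position suffices.
deleteLetter : ∀ {n p′} → SignedPerm (suc n) p′ →
               ∃ λ p → ∃ λ i → ∃ λ e → SignedPerm n p × 1 ≤ i × i ≤ suc n ×
               (∀ {k} → 1 ≤ k → k ≤ suc n → insertLetter n p (i , e) k ≡ p′ k)
deleteLetter {n} {p′} S with Permutes.surj (SignedPerm.permutes S) {suc n} (s≤s z≤n) ≤-refl
... | i , 1≤i , i≤N , ∣p′i∣≡N with signed-view (p′ i)
...   | e , p′i = p , i , e , record { rng = rng′ ; one = one′ } , 1≤i , i≤N , ins
  where
  open SignedPerm S
  open Permutes permutes using (inj)
  p : ℕ → ℤ
  p k = if k ≡ᵇ i then p′ (suc n) else p′ k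
  p-i : p i ≡ p′ (suc n)
  p-i rewrite T⇒≡ {i ≡ᵇ i} (≡ᵇ-intro {i} refl) = refl
  p-≢ : ∀ {k} → k ≢ i → p k ≡ p′ k
  p-≢ {k} k≢i rewrite ¬T⇒≡ {k ≡ᵇ i} (k≢i ∘ ≡ᵇ-elim) = refl
  small : ∀ {k} → 1 ≤ k → k ≤ suc n → k ≢ i → 1 ≤ ∣ p′ k ∣ × ∣ p′ k ∣ ≤ n
  small l u k≢i = let a , b = rng l u in
    a , s≤s⁻¹ (≤∧≢⇒< b λ eq → k≢i (inj l u 1≤i i≤N (trans eq (sym ∣p′i∣≡N))))
  rng′ : ∀ {k} → 1 ≤ k → k ≤ n → 1 ≤ ∣ p k ∣ × ∣ p k ∣ ≤ n
  rng′ {k} l u with k ≟ i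
  ... | no k≢i = subst (λ a → 1 ≤ ∣ a ∣ × ∣ a ∣ ≤ n) (sym (p-≢ k≢i)) (small l (m≤n⇒m≤1+n u) k≢i)
  ... | yes refl = subst (λ a → 1 ≤ ∣ a ∣ × ∣ a ∣ ≤ n) (sym p-i) (small (s≤s z≤n) ≤-refl (λ eq → <⇒≢ (s≤s u) (sym eq)))
  ins : ∀ {k} → 1 ≤ k → k ≤ suc n → insertLetter n p (i , e) k ≡ p′ k
  ins {k} l u with k ≟ i
  ... | yes refl = trans (insertLetter-at n p k e) (trans (cong (signed e) (sym ∣p′i∣≡N)) (sym p′i))
  ... | no k≢i with k ≟ suc n
  ...   | yes refl = trans (insertLetter-end n p i e (s≤s⁻¹ (≤∧≢⇒< i≤N (k≢i ∘ sym)))) p-i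
  ...   | no k≢N = trans (insertLetter-old n p i e (s≤s⁻¹ (≤∧≢⇒< u k≢N)) k≢i) (p-≢ k≢i)
  one′ : ∀ {v} → 1 ≤ v → v ≤ n → count n (λ k → ∣ p k ∣ ≡ᵇ v) ≡ 1
  one′ {v} l u = begin
    count n (λ k → ∣ p k ∣ ≡ᵇ v)
      ≡⟨ cong (λ z → z + count n (λ k → ∣ p k ∣ ≡ᵇ v))
        (ind-¬T {∣ signed e (suc n) ∣ ≡ᵇ v} λ t → <⇒≢ (s≤s u) (sym (trans (sym (∣signed∣ e (suc n))) (≡ᵇ-elim t)))) ⟨
    ind (∣ signed e (suc n) ∣ ≡ᵇ v) + count n (λ k → ∣ p k ∣ ≡ᵇ v)
      ≡⟨ count-insertLetter n p i e 1≤i i≤N (λ a → ∣ a ∣ ≡ᵇ v) ⟨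
    count (suc n) (λ k → ∣ insertLetter n p (i , e) k ∣ ≡ᵇ v)
      ≡⟨ count-cong (suc n) (λ l′ u′ → cong (λ a → ∣ a ∣ ≡ᵇ v) (ins l′ u′)) ⟩
    count (suc n) (λ k → ∣ p′ k ∣ ≡ᵇ v)
      ≡⟨ one l (m≤n⇒m≤1+n u) ⟩
    1 ∎
    where open ≡-Reasoning

-- The place of the new letter is visible in the word: it is the only position whose absolute value
-- exceeds n. Place and sign then determine the displaced letter at n + 1.
insertLetter-injective : ∀ {n p ρ i j e e′} → 1 ≤ i → i ≤ suc n → 1 ≤ j → j ≤ suc n →
  SignedPerm n p → SignedPerm n ρ →
  (∀ {k} → 1 ≤ k → k ≤ suc n → insertLetter n p (i , e) k ≡ insertLetter n ρ (j , e′) k) →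
  (∀ {k} → 1 ≤ k → k ≤ n → p k ≡ ρ k) × i ≡ j × e ≡ e′
insertLetter-injective {n} {p} {ρ} {i} {j} {e} {e′} l u l′ u′ S S′ eq with i ≟ j
... | no i≢j = ⊥-elim (<-irrefl refl (subst (_≤ n)
    (trans (cong ∣_∣ (trans (sym (eq l u)) (insertLetter-at n p i e))) (∣signed∣ e (suc n)))
    (proj₂ (insertLetter-∣∣ n ρ j e′ l′ u′ (SignedPerm.rng S′) l u i≢j))))
... | yes refl = same , refl , signed-injective {n = n} (trans (sym (insertLetter-at n p i e)) (trans (eq l u) (insertLetter-at n ρ i e′)))
  where
  same : ∀ {k} → 1 ≤ k → k ≤ n → p k ≡ ρ k
  same {k} l″ u″ with k ≟ i
  ... | no k≢i = trans (sym (insertLetter-old n p i e u″ k≢i)) (trans (eq l″ (m≤n⇒m≤1+n u″)) (insertLetter-old n ρ i e′ u″ k≢i))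
  ... | yes refl = trans (sym (insertLetter-end n p i e u″)) (trans (eq (s≤s z≤n) ≤-refl) (insertLetter-end n ρ i e′ u″))

child : ℕ → List ℤ → ℕ × Bool → List ℤ
child n π m = SignedWord.table (suc n) (insertLetter n (atZ π) m)

length-child : ∀ n π m → length (child n π m) ≡ suc n
length-child n π m = length-applyUpTo (insertLetter n (atZ π) m ∘ suc) (suc n)

atZ-child : ∀ n π m {k} → 1 ≤ k → k ≤ suc n → atZ (child n π m) k ≡ insertLetter n (atZ π) m k
atZ-child n π m = SignedWord.‼-table (suc n) (insertLetter n (atZ π) m)

moves : ℕ → List (ℕ × Bool)
moves n = (suc n , false) ∷ (suc n , true) ∷ map (_, false) (range 1 n) ++ map (_, true) (range 1 n)

∈-moves⁻ : ∀ {n i e} → (i , e) ∈ moves n → 1 ≤ i × i ≤ suc n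
∈-moves⁻ (here refl) = s≤s z≤n , ≤-refl
∈-moves⁻ (there (here refl)) = s≤s z≤n , ≤-refl
∈-moves⁻ {n} (there (there m∈)) with ∈-++⁻ (map (_, false) (range 1 n)) m∈
... | inj₁ p with j , j∈ , refl ← ∈-map⁻ (_, false) p = let l , u = ∈-range⁻ {1} {n} j∈ in l , m≤n⇒m≤1+n u
... | inj₂ p with j , j∈ , refl ← ∈-map⁻ (_, true) p = let l , u = ∈-range⁻ {1} {n} j∈ in l , m≤n⇒m≤1+n u

∈-moves⁺ : ∀ {n i e} → 1 ≤ i → i ≤ suc n → (i , e) ∈ moves n
∈-moves⁺ {n} {i} {e} l u with i ≟ suc n
∈-moves⁺ {n} {i} {false} l u | yes refl = here refl
∈-moves⁺ {n} {i} {true}  l u | yes refl = there (here refl)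
∈-moves⁺ {n} {i} {false} l u | no i≢ = there (there (∈-++⁺ˡ (∈-map⁺ (_, false) (∈-range⁺ l (s≤s⁻¹ (≤∧≢⇒< u i≢))))))
∈-moves⁺ {n} {i} {true}  l u | no i≢ = there (there (∈-++⁺ʳ _ (∈-map⁺ (_, true) (∈-range⁺ l (s≤s⁻¹ (≤∧≢⇒< u i≢))))))

moves-unique : ∀ n → Unique (moves n)
moves-unique n = ((λ ()) ∷ All.tabulate fresh) ∷ (All.tabulate fresh ∷
  Uniq.++⁺ (Uniq.map⁺ (proj₁ ∘ ,-injective) (range-unique 1 n)) (Uniq.map⁺ (proj₁ ∘ ,-injective) (range-unique 1 n)) disj)
  where
  fresh : ∀ {e m} → m ∈ map (_, false) (range 1 n) ++ map (_, true) (range 1 n) → (suc n , e) ≢ m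
  fresh m∈ refl with ∈-++⁻ (map (_, false) (range 1 n)) m∈
  ... | inj₁ p with j , j∈ , refl ← ∈-map⁻ (_, false) p = <-irrefl refl (proj₂ (∈-range⁻ {1} {n} j∈))
  ... | inj₂ p with j , j∈ , refl ← ∈-map⁻ (_, true) p = <-irrefl refl (proj₂ (∈-range⁻ {1} {n} j∈))
  disj : ∀ {m} → ¬ (m ∈ map (_, false) (range 1 n) × m ∈ map (_, true) (range 1 n))
  disj (p , q) with j , j∈ , refl ← ∈-map⁻ (_, false) p with k , k∈ , () ← ∈-map⁻ (_, true) q

SB-suc : ∀ n → SB (suc n) ↭ cartesianProductWith (child n) (SB n) (moves n)
SB-suc n = unique⇒↭ (SB-unique (suc n))
  (cartesianProductWith-unique (child n) inj′ (SB-unique n) (moves-unique n)) to from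
  where
  inj′ : ∀ {π ρ m m′} → π ∈ SB n → ρ ∈ SB n → m ∈ moves n → m′ ∈ moves n → child n π m ≡ child n ρ m′ → π ≡ ρ × m ≡ m′
  inj′ {π} {ρ} {m} {m′} π∈ ρ∈ m∈ m′∈ eq =
    let lπ , Sπ = ∈-SB⁻ π∈
        lρ , Sρ = ∈-SB⁻ ρ∈
        l , u = ∈-moves⁻ m∈
        l′ , u′ = ∈-moves⁻ m′∈
        same , i≡j , e≡e′ = insertLetter-injective l u l′ u′ Sπ Sρ
          (λ {k} lk uk → trans (sym (atZ-child n π m lk uk)) (trans (cong (λ τ → atZ τ k) eq) (atZ-child n ρ m′ lk uk)))
    in SignedWord.‼-ext (trans lπ (sym lρ)) (λ lk uk → same lk (≤-trans uk (≤-reflexive lπ))) , cong₂ _,_ i≡j e≡e′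
  to : ∀ {π′} → π′ ∈ SB (suc n) → π′ ∈ cartesianProductWith (child n) (SB n) (moves n)
  to {π′} π′∈ with l′ , S′ ← ∈-SB⁻ π′∈ with p , i , e , S , li , ui , eq ← deleteLetter S′ =
    subst (_∈ _) (SignedWord.‼-ext (trans (length-child n π (i , e)) (sym l′))
        (λ {k} lk uk → let uk′ = ≤-trans uk (≤-reflexive (length-child n π (i , e))) in
           trans (atZ-child n π (i , e) lk uk′) (trans (ins≡ lk uk′) (eq lk uk′))))
      (∈-cartesianProductWith⁺ (child n) (∈-SB⁺ (length-applyUpTo (p ∘ suc) n) (SignedPerm-cong (SignedWord.‼-table n p) S)) (∈-moves⁺ li ui))
    where
    π = SignedWord.table n p
    ins≡ : ∀ {k} → 1 ≤ k → k ≤ suc n → insertLetter n (atZ π) (i , e) k ≡ insertLetter n p (i , e) k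
    ins≡ {k} lk uk with k ≟ i
    ... | yes refl = trans (insertLetter-at n (atZ π) k e) (sym (insertLetter-at n p k e))
    ... | no k≢i with k ≟ suc n
    ...   | no k≢N = let u = s≤s⁻¹ (≤∧≢⇒< uk k≢N) in
      trans (insertLetter-old n (atZ π) i e u k≢i) (trans (SignedWord.‼-table n p lk u) (sym (insertLetter-old n p i e u k≢i)))
    ...   | yes refl = let u = s≤s⁻¹ (≤∧≢⇒< ui (k≢i ∘ sym)) in
      trans (insertLetter-end n (atZ π) i e u) (trans (SignedWord.‼-table n p li u) (sym (insertLetter-end n p i e u)))
  from : ∀ {π′} → π′ ∈ cartesianProductWith (child n) (SB n) (moves n) → π′ ∈ SB (suc n)
  from π′∈ with π , m , π∈ , m∈ , refl ← ∈-cartesianProductWith⁻ (child n) (SB n) (moves n) π′∈ =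
    let l , u = ∈-moves⁻ m∈ in
    ∈-SB⁺ (length-child n π m) (SignedPerm-cong (atZ-child n π m) (insertLetter-SignedPerm l u (proj₂ (∈-SB⁻ π∈))))

-- The recursion for the exponents of signed permutations

statB : ℕ → List ℤ → Stat
statB n π = ⟨ exc n π , aexc n π , single n π , fix n π , neg n π , cyc n π ⟩

iterAbs≡iter : ∀ π r i → iterAbs π r i ≡ iter (∣_∣ ∘ atZ π) r i
iterAbs≡iter π zero    i = refl
iterAbs≡iter π (suc r) i = cong (∣_∣ ∘ atZ π) (iterAbs≡iter π r i)

statB≡statOf : ∀ {n π} → SignedPerm n (atZ π) → statB n π ≡ statOf n (atZ π)
statB≡statOf {n} {π} S = stat≡
  (trans (countR≡count n _) (count-cong n λ {h} l u → sym (isExc-kind {p = atZ π} F h)))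
  (trans (countR≡count n _) (count-cong n λ {h} l u → sym (isAexc-kind {p = atZ π} F h)))
  (trans (countR≡count n _) (count-cong n λ {h} l u → sym (isSingle-kind {p = atZ π} F l u)))
  (trans (countR≡count n _) (count-cong n λ {h} l u → sym (isFix-kind {p = atZ π} F l u)))
  (countR≡count n _)
  (trans (countR≡count n _) (count-cong n λ {i} _ _ → T-ext
    (λ m → allR-intro {1} {n} λ {r} l u → subst (λ z → T (i ≤ᵇ z)) (iterAbs≡iter π r i) (allR-elim {P = λ r → i ≤ᵇ iterAbs π r i} m l u))
    (λ m → allR-intro {1} {n} λ {r} l u → subst (λ z → T (i ≤ᵇ z)) (sym (iterAbs≡iter π r i)) (allR-elim {P = λ r → i ≤ᵇ iter (∣_∣ ∘ atZ π) r i} m l u))))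
  where F = SignedPerm.permutes S

module _ {n π} (S : SignedPerm n (atZ π)) where

  private
    p = atZ π
    F = SignedPerm.permutes S
    w = statB n π
    w≡ = statB≡statOf S
    F′ : ∀ {i e} → 1 ≤ i → i ≤ suc n → SignedPerm (suc n) (atZ (child n π (i , e)))
    F′ {i} {e} l u = SignedPerm-cong (atZ-child n π (i , e)) (insertLetter-SignedPerm l u S)

  stat-new : ∀ e → statB (suc n) (child n π (suc n , e)) ≡ (if e then newSingle else newFix) w
  stat-new e = trans (statB≡statOf S′)
    (trans (Append.stat-append {p = p} {e = e} F (SignedPerm.permutes S′)
       (λ l u → trans (atZ-child n π (suc n , e) l (m≤n⇒m≤1+n u)) (insertLetter-old n p (suc n) e u (<⇒≢ (s≤s u))))
       (trans (atZ-child n π (suc n , e) (s≤s z≤n) ≤-refl) (insertLetter-at n p (suc n) e)))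
     (cong (if e then newSingle else newFix) (sym w≡)))
    where S′ = F′ {suc n} {e} (s≤s z≤n) ≤-refl

  stat-arc : ∀ e {h} → 1 ≤ h → h ≤ n → statB (suc n) (child n π (∣ p h ∣ , e)) ≡ split (kind p h) e w
  stat-arc e {h} l u = trans (statB≡statOf S′)
    (trans (Break.stat-break {p = p} {e = e} F (SignedPerm.permutes S′) l u
       (λ lk uk k≢i → trans (atZ-child n π (i , e) lk (m≤n⇒m≤1+n uk)) (insertLetter-old n p i e uk k≢i))
       (trans (atZ-child n π (i , e) li (m≤n⇒m≤1+n ui)) (insertLetter-at n p i e))
       (trans (atZ-child n π (i , e) (s≤s z≤n) ≤-refl) (insertLetter-end n p i e ui)))
     (cong (split (kind p h) e) (sym w≡)))
    where
    i = ∣ p h ∣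
    li = proj₁ (Permutes.into F l u)
    ui = proj₂ (Permutes.into F l u)
    S′ = F′ {i} {e} li (m≤n⇒m≤1+n ui)

  -- The moves list places of insertion, while the kinds are attached to arcs. An insertion at
  -- `∣ p h ∣` breaks the arc `h`, so the places are relabelled by arcs.
  range-↭ : range 1 n ↭ map (∣_∣ ∘ p) (range 1 n)
  range-↭ = unique⇒↭ (range-unique 1 n)
    (map-unique (∣_∣ ∘ p) (λ x∈ y∈ e → let l , u = ∈-range⁻ {1} {n} x∈ ; l′ , u′ = ∈-range⁻ {1} {n} y∈ in
      Permutes.inj F l u l′ u′ e) (range-unique 1 n))
    (λ k∈ → let l , u = ∈-range⁻ {1} {n} k∈ ; h , l′ , u′ , e = Permutes.surj F l u in
       subst (_∈ map (∣_∣ ∘ p) (range 1 n)) e (∈-map⁺ (∣_∣ ∘ p) (∈-range⁺ l′ u′)))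
    from
    where
    from : ∀ {k} → k ∈ map (∣_∣ ∘ p) (range 1 n) → k ∈ range 1 n
    from k∈ with h , h∈ , refl ← ∈-map⁻ (∣_∣ ∘ p) k∈ =
      let l , u = ∈-range⁻ {1} {n} h∈ ; l′ , u′ = Permutes.into F l u in ∈-range⁺ l′ u′

  stat-arcs : ∀ e → map (statB (suc n) ∘ child n π) (map (_, e) (range 1 n)) ↭ map (λ k → split k e w) (kinds w)
  stat-arcs e = begin
    map (statB (suc n) ∘ child n π) (map (_, e) (range 1 n))
      ↭⟨ map⁺ _ (map⁺ (_, e) range-↭) ⟩
    map (statB (suc n) ∘ child n π) (map (_, e) (map (∣_∣ ∘ p) (range 1 n)))
      ≡⟨ cong (map (statB (suc n) ∘ child n π)) (map-∘ {g = _, e} {f = ∣_∣ ∘ p} (range 1 n)) ⟨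
    map (statB (suc n) ∘ child n π) (map (λ h → ∣ p h ∣ , e) (range 1 n))
      ≡⟨ map-∘ (range 1 n) ⟨
    map (λ h → statB (suc n) (child n π (∣ p h ∣ , e))) (range 1 n)
      ≡⟨ map-cong-∈ (range 1 n) (λ h∈ → let l , u = ∈-range⁻ {1} {n} h∈ in stat-arc e l u) ⟩
    map (λ h → split (kind p h) e w) (range 1 n)
      ≡⟨ map-∘ (range 1 n) ⟩
    map (λ k → split k e w) (map (kind p) (range 1 n))
      ↭⟨ map⁺ _ (kinds-↭ n (kind p) {p = Stat.pᵉ w} {q = Stat.qᵉ w} (cong Stat.xᵉ (sym w≡)) (cong Stat.yᵉ (sym w≡)) (cong Stat.sᵉ (sym w≡)) (cong Stat.tᵉ (sym w≡))) ⟩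
    map (λ k → split k e w) (kinds w) ∎
    where open PermutationReasoning

SB-recursion : ∀ n → map (statB (suc n)) (SB (suc n)) ↭ concatMap offspring (map (statB n) (SB n))
SB-recursion n = recursion-↭ (statB n) (statB (suc n)) (child n) (SB n) (moves n) (SB-suc n) λ {π} π∈ →
  let S = proj₂ (∈-SB⁻ π∈) in
  offspring-↭ (statB (suc n)) (child n π) (statB n π) (suc n , false) (suc n , true)
    (map (_, false) (range 1 n)) (map (_, true) (range 1 n))
    (stat-new {n} {π} S false) (stat-new {n} {π} S true) (stat-arcs {n} {π} S false) (stat-arcs {n} {π} S true)

-- Agreement of the two lists of exponents

stat-↭ : ∀ n → map (statQ n) (Q (suc n)) ↭ map (statB n) (SB n)
-- The word 1 and the empty signed permutation both have all six exponents zero, by computation.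
stat-↭ zero    = ↭-refl
stat-↭ (suc n) = ↭-trans (Q-recursion n) (↭-trans (concatMap-↭ offspring (stat-↭ n)) (↭-sym (SB-recursion n)))

theorem3p10 : ∀ {c ℓ} (R : CommutativeSemiring c ℓ) (n : ℕ) → 1 ≤ n →
    (x y s t p q : CommutativeSemiring.Carrier R) →
    let open CommutativeSemiring R in
    sumOver R (Q (suc n)) (λ σ →
    pow R x (pap (suc n) σ) * pow R y (cap n σ) * pow R s (impap (suc n) σ)
    * pow R t (bk₂ σ) * pow R p (even σ) * pow R q (tr (suc n) σ))
    ≈
    sumOver R (SB n) (λ π →
    pow R x (exc n π) * pow R y (aexc n π) * pow R s (single n π)
    * pow R t (fix n π) * pow R p (neg n π) * pow R q (cyc n π))
theorem3p10 R n _ x y s t p q = sumOver-map-↭ R (statQ n) (statB n) monomial (Q (suc n)) (SB n) (stat-↭ n)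
  where
  open CommutativeSemiring R using (Carrier; _*_)
  monomial : Stat → Carrier
  monomial ⟨ a , b , c , d , e , f ⟩ = pow R x a * pow R y b * pow R s c * pow R t d * pow R p e * pow R q f
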